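{- For any fixed integers $r>k\ge 2$, $$\frac{1}{r^k-r}\le\liminf_{n\to\infty}\frac{f_r(n,3r-2k,3)}{n^k}\le\limsup_{n\to\infty}\frac{f_r(n,3r-2k,3)}{n^k}\le \frac{1}{k!\binom{r}{k}-\frac{k!}{2}}.$$
   Context: An $r$-uniform hypergraph ($r$-graph) on a vertex set $V$ is a family of distinct $r$-element subsets of $V$, called edges. For integers $r\ge 2$, $e\ge 2$, $v\ge r+1$, an $r$-graph is called $\mathscr{G}_r(v,e)$-free if the union of any $e$ distinct edges of it contains at least $v+1$ vertices. $f_r(n,v,e)$ denotes the maximum number of edges in a $\mathscr{G}_r(v,e)$-free $r$-graph on $n$ vertices. -}

module Defs where

open import Data.Bool.Base using (true; false)
import Data.Bool.Properties as Bool
open import Data.Fin.Base using (Fin; zero; suc; combine)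
open import Data.Fin.Properties using (combine-injective; injective⇒≤)
open import Data.Fin.Subset using (Subset; ∣_∣; ⋃)
open import Data.Fin.Subset.Properties using (anySubset?)
open import Data.Integer.Base as ℤ using (+_)
import Data.Integer.Properties as ℤ
open import Data.List.Base using (List; []; _∷_; length; lookup)
open import Data.List.Membership.Propositional.Properties using (∈-lookup)
import Data.List.Relation.Binary.Subset.DecPropositional as Subset?
open import Data.List.Relation.Binary.Subset.Propositional using (_⊆_)
open import Data.List.Relation.Unary.All as All using (All; []; _∷_)
open import Data.List.Relation.Unary.AllPairs using ([]; _∷_)
import Data.List.Relation.Unary.Unique.DecPropositional as Unique?
open import Data.List.Relation.Unary.Any using (here)
open import Data.List.Relation.Unary.Unique.Propositional using (Unique)
open import Data.Nat.Base as ℕ using (ℕ; zero; suc; _^_; _!; z≤n; s≤s)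
open import Data.Nat.Combinatorics using (_C_; nCk+nC[k+1]≡[n+1]C[k+1])
import Data.Nat.Properties as ℕ
open import Data.Product.Base using (∃; ∃-syntax; _×_; _,_; proj₁; proj₂)
open import Data.Rational.Base as ℚ using (ℚ; _/_; _<_; _-_; NonZero)
import Data.Rational.Properties as ℚ
import Data.Rational.Unnormalised.Base as ℚᵘ
import Data.Rational.Unnormalised.Properties as ℚᵘ
open import Data.Vec.Base using ([]; _∷_)
import Data.Vec.Properties as Vec
open import Function.Base using (_∘_)
open import Relation.Binary.Definitions using (DecidableEquality)
open import Relation.Binary.PropositionalEquality using (_≡_; refl; sym; cong; subst; subst₂)
open import Relation.Nullary using (Dec; yes; no; ¬_; contradiction)
open import Relation.Nullary.Decidable using (map′; ¬?; _×-dec_; _→-dec_; decidable-stable)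
open import Relation.Unary using (Pred; Decidable)

record Hypergraph (r n : ℕ) : Set where
  field
    edges   : List (Subset n)
    unique  : Unique edges
    uniform : All (λ A → ∣ A ∣ ≡ r) edges

open Hypergraph public

Free : ∀ {r n} → ℕ → ℕ → Hypergraph r n → Set
Free v e G = ∀ es → Unique es → es ⊆ edges G → length es ≡ e → v ℕ.< ∣ ⋃ es ∣

IsSize : (r n v e m : ℕ) → Set
IsSize r n v e m = ∃[ G ] Free {r} {n} v e G × length (edges G) ≡ m

IsMaximum : (ℕ → Set) → ℕ → Set
IsMaximum P m = P m × (∀ {j} → P j → j ℕ.≤ m)

private
  _≟ˢ_ : ∀ {n} → DecidableEquality (Subset n)
  _≟ˢ_ = Vec.≡-dec Bool._≟_

  anyList? : ∀ {n p} {P : Pred (List (Subset n)) p} → Decidable P →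
             ∀ m → Dec (∃[ es ] length es ≡ m × P es)
  anyList? P? zero = map′ (λ p → [] , refl , p) (λ { ([] , refl , p) → p }) (P? [])
  anyList? P? (suc m) =
    map′ (λ { (A , es , eq , p) → A ∷ es , cong suc eq , p })
         (λ { (A ∷ es , eq , p) → A , es , ℕ.suc-injective eq , p })
         (anySubset? λ A → anyList? (P? ∘ (A ∷_)) m)

  allList? : ∀ {n p} {P : Pred (List (Subset n)) p} → Decidable P →
             ∀ m → Dec (∀ es → length es ≡ m → P es)
  allList? P? m =
    map′ (λ none es eq → decidable-stable (P? es) λ ¬p → none (es , eq , ¬p))
         (λ { all (es , eq , ¬p) → ¬p (all es eq) })
         (¬? (anyList? (¬? ∘ P?) m))

  isSize? : ∀ r n v e → Decidable (IsSize r n v e)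
  isSize? r n v e m =
    map′ (λ { (E , eq , u , a , fr) →
                record { edges = E ; unique = u ; uniform = a }
                , (λ es us sub le → fr es le us λ {A} → sub {A}) , eq })
         (λ { (G , fr , eq) →
                edges G , eq , unique G , uniform G
                , (λ es le us sub → fr es us (λ {A} → sub {A}) le) })
         (anyList? (λ E →
            Unique?.unique? _≟ˢ_ E ×-dec
            All.all? (λ A → ∣ A ∣ ℕ.≟ r) E ×-dec
            allList? (λ es → Unique?.unique? _≟ˢ_ es →-dec
                             (Subset?._⊆?_ _≟ˢ_ es E →-dec
                             (v ℕ.<? ∣ ⋃ es ∣))) e) m)

  encode : ∀ {n} → Subset n → Fin (2 ^ n)
  encode []          = zero
  encode (false ∷ A) = combine {2} zero (encode A)
  encode (true  ∷ A) = combine {2} (suc zero) (encode A)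

  encode-injective : ∀ {n} (A B : Subset n) → encode A ≡ encode B → A ≡ B
  encode-injective []          []          _  = refl
  encode-injective (false ∷ A) (false ∷ B) eq =
    cong (false ∷_) (encode-injective A B
      (proj₂ (combine-injective {2} zero (encode A) zero (encode B) eq)))
  encode-injective (true ∷ A)  (true ∷ B)  eq =
    cong (true ∷_) (encode-injective A B
      (proj₂ (combine-injective {2} (suc zero) (encode A) (suc zero) (encode B) eq)))
  encode-injective (false ∷ A) (true ∷ B)  eq
    with () ← proj₁ (combine-injective {2} zero (encode A) (suc zero) (encode B) eq)
  encode-injective (true ∷ A)  (false ∷ B) eq
    with () ← proj₁ (combine-injective {2} (suc zero) (encode A) zero (encode B) eq)

  lookup-injective : ∀ {A : Set} {xs : List A} → Unique xs →
                     ∀ i j → lookup xs i ≡ lookup xs j → i ≡ j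
  lookup-injective (_ ∷ _)    zero    zero    _  = refl
  lookup-injective (x∉ ∷ _)   zero    (suc j) eq = contradiction eq (All.lookup x∉ (∈-lookup j))
  lookup-injective (x∉ ∷ _)   (suc i) zero    eq = contradiction (sym eq) (All.lookup x∉ (∈-lookup i))
  lookup-injective (_ ∷ u)    (suc i) (suc j) eq = cong suc (lookup-injective u i j eq)

  length≤2^n : ∀ {n} (E : List (Subset n)) → Unique E → length E ℕ.≤ 2 ^ n
  length≤2^n E u = injective⇒≤ {f = encode ∘ lookup E} λ {i} {j} eq →
    lookup-injective u i j (encode-injective (lookup E i) (lookup E j) eq)

  maximum : ∀ {P : ℕ → Set} → Decidable P → ∀ b → (∀ {j} → P j → j ℕ.≤ b) →
            ∃ P → ∃ (IsMaximum P)
  maximum P? zero bd (j , p) with z≤n ← bd p = 0 , p , bd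
  maximum P? (suc b) bd ex with P? (suc b)
  ... | yes p = suc b , p , bd
  ... | no ¬p = maximum P? b
    (λ q → ℕ.≤-pred (ℕ.≤∧≢⇒< (bd q) λ { refl → ¬p q })) ex

  -- With e = 0 no hypergraph need be free; e ≥ 1 makes the empty one free.
  emptySize : ∀ r n v e → IsSize r n v (suc e) 0
  emptySize r n v e =
    record { edges = [] ; unique = [] ; uniform = [] }
    , (λ { (A ∷ _) _ sub _ → contradiction (sub (here refl)) λ () })
    , refl

maximumExists : ∀ r n v e .{{_ : ℕ.NonZero e}} → ∃ (IsMaximum (IsSize r n v e))
maximumExists r n v (suc e) =
  maximum (isSize? r n v (suc e)) (2 ^ n)
    (λ { (G , _ , refl) → length≤2^n (edges G) (unique G) })
    (0 , emptySize r n v e)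

f : (r n v e : ℕ) .{{_ : ℕ.NonZero e}} → ℕ
f r n v e = proj₁ (maximumExists r n v e)

f-isMaximum : ∀ r n v e .{{_ : ℕ.NonZero e}} → IsMaximum (IsSize r n v e) (f r n v e)
f-isMaximum r n v e = proj₂ (maximumExists r n v e)

-- Extended reals as two-sided Dedekind cuts of ℚ.  Locatedness
-- (p < q → lower p ⊎ upper q) is not required: suprema and infima of
-- sequences do not preserve it constructively, although classically they do.
-- Either side may be empty, so ±∞ are included.
record Real : Set₁ where
  field
    lower upper   : ℚ → Set
    lower-closed  : ∀ {p q} → p < q → lower q → lower p
    lower-rounded : ∀ {p} → lower p → ∃[ q ] p < q × lower q
    upper-closed  : ∀ {p q} → p < q → upper p → upper q
    upper-rounded : ∀ {q} → upper q → ∃[ p ] p < q × upper p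
    disjoint      : ∀ {p q} → lower p → upper q → p < q

open Real public

infix 4 _≤_

_≤_ : Real → Real → Set
x ≤ y = (∀ {q} → lower x q → lower y q) × (∀ {q} → upper y q → upper x q)

fromℚ : ℚ → Real
fromℚ p = record
  { lower         = _< p
  ; upper         = p <_
  ; lower-closed  = ℚ.<-trans
  ; lower-rounded = ℚ.<-dense
  ; upper-closed  = λ p<q r<p → ℚ.<-trans r<p p<q
  ; upper-rounded = λ p<q → let m , p<m , m<q = ℚ.<-dense p<q in m , m<q , p<m
  ; disjoint      = ℚ.<-trans
  }

-- q lies strictly above a supremum when some p < q is above every member;
-- the strict gap keeps the cut rounded. Dually for the infimum.
sup inf : (ℕ → Real) → Real
sup x = record
  { lower         = λ q → ∃[ i ] lower (x i) q
  ; upper         = λ q → ∃[ p ] p < q × (∀ i → upper (x i) p)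
  ; lower-closed  = λ { p<q (i , l) → i , lower-closed (x i) p<q l }
  ; lower-rounded = λ { (i , l) →
      let q , p<q , l′ = lower-rounded (x i) l in q , p<q , i , l′ }
  ; upper-closed  = λ { p<q (s , s<p , u) → s , ℚ.<-trans s<p p<q , u }
  ; upper-rounded = λ { (s , s<q , u) →
      let m , s<m , m<q = ℚ.<-dense s<q in m , m<q , s , s<m , u }
  ; disjoint      = λ { (i , l) (s , s<q , u) →
      ℚ.<-trans (disjoint (x i) l (u i)) s<q }
  }
inf x = record
  { lower         = λ p → ∃[ q ] p < q × (∀ i → lower (x i) q)
  ; upper         = λ q → ∃[ i ] upper (x i) q
  ; lower-closed  = λ { p<q (s , q<s , l) → s , ℚ.<-trans p<q q<s , l }
  ; lower-rounded = λ { (s , p<s , l) →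
      let m , p<m , m<s = ℚ.<-dense p<s in m , p<m , s , m<s , l }
  ; upper-closed  = λ { p<q (i , u) → i , upper-closed (x i) p<q u }
  ; upper-rounded = λ { (i , u) →
      let p , p<q , u′ = upper-rounded (x i) u in p , p<q , i , u′ }
  ; disjoint      = λ { (s , p<s , l) (i , u) →
      ℚ.<-trans p<s (disjoint (x i) (l i) u) }
  }

liminf limsup : (ℕ → ℚ) → Real
liminf a = sup λ N → inf λ m → fromℚ (a (N ℕ.+ m))
limsup a = inf λ N → sup λ m → fromℚ (a (N ℕ.+ m))

-- The sequence g(n)/nᵏ for n ≥ 1, shifted to start at index 0.
_/n^_ : (ℕ → ℕ) → ℕ → ℕ → ℚ
(g /n^ k) i = (+ g (suc i) / suc i ^ k) {{ℕ.m^n≢0 (suc i) k}}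

fromℕ : ℕ → ℚ
fromℕ n = + n / 1

private
  <⇒-≢0 : ∀ {p q} → q < p → NonZero (p - q)
  <⇒-≢0 {p} {q} q<p = ℚ.pos⇒nonZero (p - q) {{ℚ.positive
    (subst (_< p - q) (ℚ.+-inverseʳ q) (ℚ.+-monoˡ-< (ℚ.- q) q<p))}}

  /-mono-< : ∀ {a b c d} .{{_ : ℕ.NonZero b}} .{{_ : ℕ.NonZero d}} →
             a ℕ.* d ℕ.< c ℕ.* b → + a / b < + c / d
  /-mono-< {a} {suc b} {c} {suc d} lt = ℚ.toℚᵘ-cancel-<
    (ℚᵘ.<-respˡ-≃ (ℚᵘ.≃-sym (ℚ.toℚᵘ-fromℚᵘ (+ a ℚᵘ./ suc b)))
    (ℚᵘ.<-respʳ-≃ (ℚᵘ.≃-sym (ℚ.toℚᵘ-fromℚᵘ (+ c ℚᵘ./ suc d)))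
    (ℚᵘ.*<* (subst₂ ℤ._<_ (ℤ.pos-* a (suc d)) (ℤ.pos-* c (suc b)) (ℤ.+<+ lt)))))

  nCk>0 : ∀ {n k} → k ℕ.≤ n → 0 ℕ.< n C k
  nCk>0 {n} z≤n = s≤s z≤n
  nCk>0 {suc n} {suc k} (s≤s k≤n) =
    subst (0 ℕ.<_) (nCk+nC[k+1]≡[n+1]C[k+1] n k)
      (ℕ.≤-trans (nCk>0 k≤n) (ℕ.m≤m+n (n C k) _))

r^k-r≢0 : ∀ {r k} → 2 ℕ.≤ k → k ℕ.< r → NonZero (fromℕ (r ^ k) - fromℕ r)
r^k-r≢0 {r} {k} 2≤k k<r = <⇒-≢0 (/-mono-< {r} {1} {r ^ k} {1}
  (subst (λ m → m ℕ.* 1 ℕ.< r ^ k ℕ.* 1) (ℕ.^-identityʳ r)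
    (ℕ.*-monoˡ-< 1 (ℕ.^-monoʳ-< r (ℕ.<-trans 2≤k k<r) 2≤k))))

k!C-k!/2≢0 : ∀ {r k} → k ℕ.< r → NonZero (fromℕ (k ! ℕ.* (r C k)) - + (k !) / 2)
k!C-k!/2≢0 {r} {k} k<r = <⇒-≢0 (/-mono-< {k !} {2} {k ! ℕ.* (r C k)} {1}
  (begin-strict
    k ! ℕ.* 1                ≡⟨ ℕ.*-identityʳ (k !) ⟩
    k !                      ≤⟨ ℕ.m≤m*n (k !) (r C k) ⟩
    k ! ℕ.* (r C k)          <⟨ ℕ.m<m*n (k ! ℕ.* (r C k)) 2 (s≤s (s≤s z≤n)) ⟩
    k ! ℕ.* (r C k) ℕ.* 2    ∎))
  where
  open ℕ.≤-Reasoning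
  instance
    _ = ℕ.>-nonZero (nCk>0 (ℕ.<⇒≤ k<r))
    _ = k ℕ.!≢0
    _ = ℕ.m*n≢0 (k !) (r C k)

{-# OPTIONS --safe #-}

-- Lower bound: split r q vertices into r blocks of size q, take as edges the transversals
-- (vᵢ · x mod m)ᵢ for x ∈ (ℤ/m)ᵏ with m ≤ q, and recurse inside the blocks; the density then satisfies
-- c = r⁻ᵏ + r c r⁻ᵏ, so c = 1/(rᵏ − r).  Three transversals spanning too few vertices yield, through the
-- positions where two or three of them agree, a homogeneous linear system for the two differences of their
-- coefficient vectors.  For each pattern of agreement the system becomes unimodular when the vᵢ are
-- specialised to suitable unit vectors, hence for generic integer vᵢ all these systems are nonsingular.
-- They remain so modulo every m ≡ 1 mod E for a fixed E, and such m have bounded gaps.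
--
-- Upper bound: no edge shares k vertices with two others, so for all but O(nᵏ⁻¹) edges the other edges
-- cover at most one of its k-subsets.  Summing d² + 2 ≥ 3 d over all k-sets, where d is the number of
-- edges containing the k-set, gives (2 C(r,k) − 1) |E| ≤ 2 C(n,k) + O(nᵏ⁻¹).
module Submission where

open import Defs
open import Data.Bool.Base using (Bool; true; false; _∨_; _∧_)
import Data.Bool.Properties as Bool
open import Data.Fin.Base as Fin using (Fin; zero; suc; toℕ; fromℕ<; inject≤; finToFun; funToFin)
import Data.Fin.Properties as Fin
open import Data.Fin.Subset using (Subset; ∣_∣; ⋃; _∩_; _∪_; ⊥; ⊤; ⁅_⁆)
import Data.Fin.Subset.Properties as Subset
open import Data.Integer.Base as ℤ using (ℤ; +_; -[1+_]; 0ℤ; 1ℤ)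
import Data.Integer.DivMod as ℤ
open import Data.Integer.Divisibility.Signed as ℤ∣ using (_∣_; divides)
import Data.Integer.Properties as ℤ
import Data.Integer.Tactic.RingSolver as ℤRing
open import Data.List.Base as List using (List; []; _∷_; length; filter; map)
open import Data.List.Membership.Propositional using (_∈_; find; lose)
import Data.List.Membership.Propositional.Properties as ∈
import Data.List.Properties as List
open import Data.List.Relation.Unary.All as All using (All; []; _∷_)
import Data.List.Relation.Unary.All.Properties as All
open import Data.List.Relation.Unary.AllPairs using ([]; _∷_)
open import Data.List.Relation.Unary.Any as Any using (here; there)
open import Data.List.Relation.Unary.Unique.Propositional using (Unique)
import Data.List.Relation.Unary.Unique.Propositional.Properties as Unique
open import Data.Maybe.Base using (Maybe; just; nothing)
import Data.Maybe.Properties as Maybe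
open import Data.Nat.Base as ℕ using (ℕ; zero; suc; _*_; _∸_; _^_; _!; _<_; z≤n; s≤s)
open import Data.Nat.Combinatorics as Comb using (_C_; nCk+nC[k+1]≡[n+1]C[k+1]; k>n⇒nCk≡0; nCk≡nPk/k!; nCn≡1)
open import Data.Nat.Combinatorics.Base as Comb using (_P′_)
import Data.Nat.DivMod as ℕ
import Data.Nat.Divisibility as ℕ
open import Data.Nat.Induction using (<-rec)
import Data.Nat.Properties as ℕ
import Data.Nat.Tactic.RingSolver as ℕRing
open import Data.Product.Base using (∃-syntax; _×_; _,_; proj₁; proj₂)
open import Data.Rational.Base as ℚ using (ℚ; mkℚ; _/_; _-_; 1/_; NonZero)
import Data.Rational.Properties as ℚ
import Data.Rational.Unnormalised.Base as ℚᵘ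
import Data.Rational.Unnormalised.Properties as ℚᵘ
open import Data.Sum.Base as Sum using (_⊎_; inj₁; inj₂)
open import Data.Unit.Base using (tt) renaming (⊤ to Unit)
open import Data.Vec.Base as Vec using (Vec; []; _∷_; zipWith; replicate; _++_; lookup; tabulate; _[_]≔_)
import Data.Vec.Properties as Vec
open import Data.Vec.Relation.Unary.All as VAll using ([]; _∷_)
import Data.Vec.Relation.Unary.All.Properties as VAll
open import Function.Base using (_∘_)
open import Relation.Binary.Definitions using (DecidableEquality)
open import Relation.Binary.PropositionalEquality
open import Relation.Nullary using (¬_; Dec; yes; no; contradiction)
open import Relation.Nullary.Decidable using (map′; ¬?; _×-dec_; decidable-stable)
open import Relation.Unary using (Decidable)

-- A prime modulus would require primes just below every block size. A modulus m ≡ 1 mod E need not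
-- be prime: it is enough that finitely many nonzero integers, one for each system, divide E and are
-- therefore invertible modulo m. Genericity is likewise obtained without determinants or
-- non-vanishing of polynomials. Injectivity modulo a single d ≥ 2 certifies that a system is
-- nonsingular, and a further system is accommodated by a Chinese remainder step that leaves the
-- certified ones intact.
--
-- Freeness restricts only triples and lets two edges share k vertices. The constructed families
-- also keep all pairwise intersections below k. This supplies three of the four inequalities in
-- `Ample`, and it controls triples with two edges in one class and the third in another.
--
-- In the upper bound, the obstacle is a pair of edges with more than k common vertices: together
-- they cover up to C(r,k) k-sets twice instead of one. Such edges are counted through the
-- (k-1)-sets they contain, which is the source of the error O(nᵏ⁻¹).

private variable
  k r n n′ q N N′ : ℕ
  X Y : Set

-- Linear systems over ℤ

dot : Vec ℤ N → Vec ℤ N → ℤ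
dot []      []      = 0ℤ
dot (a ∷ u) (b ∷ v) = a ℤ.* b ℤ.+ dot u v

infixr 7 _·_
infixl 6 _⊕_

_⊕_ : Vec ℤ N → Vec ℤ N → Vec ℤ N
_⊕_ = zipWith ℤ._+_

_·_ : ℤ → Vec ℤ N → Vec ℤ N
c · u = Vec.map (c ℤ.*_) u

𝟎 : Vec ℤ N
𝟎 = replicate _ 0ℤ

dot-⊕ˡ : (u v w : Vec ℤ N) → dot (u ⊕ v) w ≡ dot u w ℤ.+ dot v w
dot-⊕ˡ []      []      []      = refl
dot-⊕ˡ (a ∷ u) (b ∷ v) (c ∷ w) = trans (cong (λ x → (a ℤ.+ b) ℤ.* c ℤ.+ x) (dot-⊕ˡ u v w))
  (lemma a b c (dot u w) (dot v w))
  where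
  lemma : ∀ a b c x y → (a ℤ.+ b) ℤ.* c ℤ.+ (x ℤ.+ y) ≡ a ℤ.* c ℤ.+ x ℤ.+ (b ℤ.* c ℤ.+ y)
  lemma = ℤRing.solve-∀

dot-·ˡ : ∀ c (u v : Vec ℤ N) → dot (c · u) v ≡ c ℤ.* dot u v
dot-·ˡ c []      []      = sym (ℤ.*-zeroʳ c)
dot-·ˡ c (a ∷ u) (b ∷ v) = trans (cong (λ x → c ℤ.* a ℤ.* b ℤ.+ x) (dot-·ˡ c u v))
  (lemma c a b (dot u v))
  where
  lemma : ∀ c a b x → c ℤ.* a ℤ.* b ℤ.+ c ℤ.* x ≡ c ℤ.* (a ℤ.* b ℤ.+ x)
  lemma = ℤRing.solve-∀

dot-comm : (u v : Vec ℤ N) → dot u v ≡ dot v u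
dot-comm []      []      = refl
dot-comm (a ∷ u) (b ∷ v) = cong₂ ℤ._+_ (ℤ.*-comm a b) (dot-comm u v)

dot-·ʳ : ∀ c (u v : Vec ℤ N) → dot u (c · v) ≡ c ℤ.* dot u v
dot-·ʳ c u v = trans (dot-comm u (c · v)) (trans (dot-·ˡ c v u) (cong (c ℤ.*_) (dot-comm v u)))

dot-⊕ʳ : (u v w : Vec ℤ N) → dot u (v ⊕ w) ≡ dot u v ℤ.+ dot u w
dot-⊕ʳ u v w = trans (dot-comm u (v ⊕ w))
  (trans (dot-⊕ˡ v w u) (cong₂ ℤ._+_ (dot-comm v u) (dot-comm w u)))

dot-𝟎ʳ : (u : Vec ℤ N) → dot u 𝟎 ≡ 0ℤ
dot-𝟎ʳ []      = refl
dot-𝟎ʳ (a ∷ u) = cong₂ ℤ._+_ (ℤ.*-zeroʳ a) (dot-𝟎ʳ u)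

dot-++ : (u v : Vec ℤ N) (u′ v′ : Vec ℤ N′) → dot (u ++ u′) (v ++ v′) ≡ dot u v ℤ.+ dot u′ v′
dot-++ []      []      u′ v′ = sym (ℤ.+-identityˡ _)
dot-++ (a ∷ u) (b ∷ v) u′ v′ = trans (cong (λ x → a ℤ.* b ℤ.+ x) (dot-++ u v u′ v′))
  (sym (ℤ.+-assoc (a ℤ.* b) (dot u v) (dot u′ v′)))

∣-dotʳ : ∀ {m} (u v : Vec ℤ N) → VAll.All (m ∣_) v → m ∣ dot u v
∣-dotʳ []      []      []       = divides 0ℤ refl
∣-dotʳ (a ∷ u) (b ∷ v) (d ∷ ds) = ℤ∣.∣m∣n⇒∣m+n (ℤ∣.∣n⇒∣m*n a d) (∣-dotʳ u v ds)

Solution : ℤ → List (Vec ℤ N) → Vec ℤ N → Set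
Solution m R z = All (λ ρ → m ∣ dot ρ z) R

InjectiveMod : ℤ → List (Vec ℤ N) → Set
InjectiveMod m R = ∀ z → Solution m R z → VAll.All (m ∣_) z

-- Cramer's rule reduced to its consequence for congruences, with `D` independent of `m`. At `m = 0`
-- and for nonzero `D` it says that the kernel over ℤ is trivial.
Controls : ℤ → List (Vec ℤ N) → Set
Controls D R = ∀ m z → Solution m R z → VAll.All (λ x → m ∣ D ℤ.* x) z

private
  cancel-· : ∀ p {z : Vec ℤ N} → p ≢ 0ℤ → p · z ≡ 𝟎 → z ≡ 𝟎
  cancel-· p {[]}    p≢0 eq = refl
  cancel-· p {x ∷ z} p≢0 eq with ℤ.i*j≡0⇒i≡0∨j≡0 p (Vec.∷-injectiveˡ eq)
  ... | inj₁ p≡0 = contradiction p≡0 p≢0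
  ... | inj₂ x≡0 = cong₂ _∷_ x≡0 (cancel-· p p≢0 (Vec.∷-injectiveʳ eq))

  eliminate : Vec ℤ (suc N) → Vec ℤ (suc N) → Vec ℤ N
  eliminate (p ∷ P) (s ∷ S) = p · S ⊕ (ℤ.- s) · P

  dot-eliminate : ∀ p (P : Vec ℤ N) s S z →
    dot (eliminate (p ∷ P) (s ∷ S)) z ≡ p ℤ.* dot S z ℤ.+ (ℤ.- s) ℤ.* dot P z
  dot-eliminate p P s S z = trans (dot-⊕ˡ (p · S) ((ℤ.- s) · P) z)
    (cong₂ ℤ._+_ (dot-·ˡ p S z) (dot-·ˡ (ℤ.- s) P z))

-- Fraction-free Gaussian elimination: D is essentially a nonzero maximal minor.
gauss : (R : List (Vec ℤ N)) →
  (∃[ z ] z ≢ 𝟎 × All (λ ρ → dot ρ z ≡ 0ℤ) R) ⊎ (∃[ D ] D ≢ 0ℤ × Controls D R)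
gauss {zero}  R = inj₂ (1ℤ , (λ ()) , λ { m [] _ → [] })
gauss {suc N} R with Any.any? (λ ρ → ¬? (Vec.head ρ ℤ.≟ 0ℤ)) R
... | no ¬pivot = inj₁ (1ℤ ∷ 𝟎 , (λ ()) , All.map (λ {ρ} → kills {ρ}) (All.¬Any⇒All¬ R ¬pivot))
  where
  kills : {ρ : Vec ℤ (suc N)} → ¬ (Vec.head ρ ≢ 0ℤ) → dot ρ (1ℤ ∷ 𝟎) ≡ 0ℤ
  kills {s ∷ S} stable = cong₂ ℤ._+_
    (trans (ℤ.*-identityʳ s) (decidable-stable (s ℤ.≟ 0ℤ) stable)) (dot-𝟎ʳ S)
... | yes pivot with find pivot
... | p ∷ P , P∈R , p≢0 with gauss (map (eliminate (p ∷ P)) R)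
... | inj₁ (z , z≢0 , sol) = inj₁
  -- Scaling the kernel vector by the pivot lets the pivot equation be solved for the first
  -- coordinate without division.
  ( (ℤ.- dot P z) ∷ p · z
  , (λ eq → z≢0 (cancel-· p p≢0 (Vec.∷-injectiveʳ eq)))
  , All.map (λ {ρ} → lift {ρ}) (All.map⁻ sol))
  where
  rearrange : ∀ p s S P → s ℤ.* (ℤ.- P) ℤ.+ p ℤ.* S ≡ p ℤ.* S ℤ.+ (ℤ.- s) ℤ.* P
  rearrange = ℤRing.solve-∀
  lift : {ρ : Vec ℤ (suc N)} → dot (eliminate (p ∷ P) ρ) z ≡ 0ℤ →
         dot ρ ((ℤ.- dot P z) ∷ p · z) ≡ 0ℤ
  lift {s ∷ S} eq = trans (cong (λ x → s ℤ.* (ℤ.- dot P z) ℤ.+ x) (dot-·ʳ p S z))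
    (trans (rearrange p s (dot S z) (dot P z))
    (trans (sym (dot-eliminate p P s S z)) eq))
... | inj₂ (D , D≢0 , controls) = inj₂ (D ℤ.* p , Dp≢0 , controls′)
  where
  Dp≢0 : D ℤ.* p ≢ 0ℤ
  Dp≢0 eq with ℤ.i*j≡0⇒i≡0∨j≡0 D eq
  ... | inj₁ D≡0 = D≢0 D≡0
  ... | inj₂ p≡0 = p≢0 p≡0
  combine : ∀ p P s S x → p ℤ.* (s ℤ.* x ℤ.+ S) ℤ.- s ℤ.* (p ℤ.* x ℤ.+ P) ≡ p ℤ.* S ℤ.+ (ℤ.- s) ℤ.* P
  combine = ℤRing.solve-∀
  solve-head : ∀ D p P x → D ℤ.* (p ℤ.* x ℤ.+ P) ℤ.- D ℤ.* P ≡ D ℤ.* p ℤ.* x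
  solve-head = ℤRing.solve-∀
  swap : ∀ D p x → p ℤ.* (D ℤ.* x) ≡ D ℤ.* p ℤ.* x
  swap = ℤRing.solve-∀
  controls′ : Controls (D ℤ.* p) R
  controls′ m (x ∷ z) sol =
    subst (m ∣_) (solve-head D p (dot P z) x)
      (ℤ∣.∣m∣n⇒∣m-n (ℤ∣.∣n⇒∣m*n D m∣pivot)
        (subst (m ∣_) (dot-·ʳ D P z) (∣-dotʳ P (D · z) (scaled z IH))))
    ∷ VAll.map (λ {y} d → subst (m ∣_) (swap D p y) (ℤ∣.∣n⇒∣m*n p d)) IH
    where
    m∣pivot : m ∣ dot (p ∷ P) (x ∷ z)
    m∣pivot = All.lookup sol P∈R
    step : {ρ : Vec ℤ (suc N)} → m ∣ dot ρ (x ∷ z) → m ∣ dot (eliminate (p ∷ P) ρ) z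
    step {s ∷ S} d = subst (m ∣_)
      (trans (combine p (dot P z) s (dot S z) x) (sym (dot-eliminate p P s S z)))
      (ℤ∣.∣m∣n⇒∣m-n (ℤ∣.∣n⇒∣m*n p d) (ℤ∣.∣n⇒∣m*n s m∣pivot))
    IH : VAll.All (λ y → m ∣ D ℤ.* y) z
    IH = controls m z (All.map⁺ (All.map (λ {ρ} → step {ρ}) sol))
    scaled : ∀ {n} (w : Vec ℤ n) → VAll.All (λ y → m ∣ D ℤ.* y) w → VAll.All (m ∣_) (D · w)
    scaled []      []       = []
    scaled (_ ∷ w) (d ∷ ds) = d ∷ scaled w ds

private
  quotients : ∀ {m} {z : Vec ℤ N} → VAll.All (m ∣_) z → ∃[ w ] z ≡ m · w
  quotients []                         = [] , refl
  quotients {m = m} (divides q eq ∷ ds) with quotients ds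
  ... | w , eq′ = q ∷ w , cong₂ _∷_ (trans eq (ℤ.*-comm q m)) eq′

  n<d^n : ∀ {d} → 2 ℕ.≤ d → ∀ n → n ℕ.< d ℕ.^ n
  n<d^n 2≤d zero    = s≤s z≤n
  n<d^n {d} 2≤d (suc n) = begin
    suc (suc n)       ≤⟨ s≤s (n<d^n 2≤d n) ⟩
    1 ℕ.+ d ℕ.^ n     ≤⟨ ℕ.+-monoˡ-≤ (d ℕ.^ n) (ℕ.≤-trans (s≤s z≤n) (n<d^n 2≤d n)) ⟩
    d ℕ.^ n ℕ.+ d ℕ.^ n ≡⟨ cong (d ℕ.^ n ℕ.+_) (sym (ℕ.+-identityʳ (d ℕ.^ n))) ⟩
    2 ℕ.* d ℕ.^ n     ≤⟨ ℕ.*-monoˡ-≤ (d ℕ.^ n) 2≤d ⟩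
    d ℕ.* d ℕ.^ n     ∎
    where open ℕ.≤-Reasoning

  divisible-by-powers : ∀ {d} → 2 ℕ.≤ d → ∀ x → (∀ e → + (d ℕ.^ e) ∣ x) → x ≡ 0ℤ
  divisible-by-powers {d} 2≤d x all with ℤ.∣ x ∣ in eq
  ... | zero  = ℤ.∣i∣≡0⇒i≡0 eq
  ... | suc n = contradiction
    (ℕ.≤-trans (n<d^n 2≤d (suc n))
      (ℕ.∣⇒≤ (subst (d ℕ.^ suc n ℕ.∣_) eq (ℤ∣.∣⇒∣ᵤ (all (suc n))))))
    (ℕ.<-irrefl refl)

  all-zero : {z : Vec ℤ N} → VAll.All (_≡ 0ℤ) z → z ≡ 𝟎
  all-zero []       = refl
  all-zero (p ∷ ps) = cong₂ _∷_ p (all-zero ps)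

-- If R is injective mod d, an integer solution of R z = 0 is divisible by every power of d.
injective⇒trivial-kernel : ∀ {d} → 2 ℕ.≤ d → (R : List (Vec ℤ N)) → InjectiveMod (+ d) R →
  ∀ z → All (λ ρ → dot ρ z ≡ 0ℤ) R → z ≡ 𝟎
injective⇒trivial-kernel {d = d@(suc _)} 2≤d R inj z ker = all-zero
  (VAll.lookup⁻ λ i → divisible-by-powers 2≤d _ λ e → VAll.lookup⁺ (powers e z ker) i)
  where
  powers : ∀ e z → All (λ ρ → dot ρ z ≡ 0ℤ) R → VAll.All (+ (d ℕ.^ e) ∣_) z
  powers zero    z ker = VAll.universal (λ x → divides x (sym (ℤ.*-identityʳ x))) z
  powers (suc e) z ker with quotients (inj z (All.map (λ eq → divides 0ℤ eq) ker))
  ... | w , refl = lift w (powers e w (All.map (λ {ρ} → descend {ρ}) ker))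
    where
    descend : ∀ {ρ} → dot ρ (+ d · w) ≡ 0ℤ → dot ρ w ≡ 0ℤ
    descend {ρ} eq with ℤ.i*j≡0⇒i≡0∨j≡0 (+ d) (trans (sym (dot-·ʳ (+ d) ρ w)) eq)
    ... | inj₂ eq′ = eq′
    lift : ∀ {n} (w : Vec ℤ n) → VAll.All (+ (d ℕ.^ e) ∣_) w → VAll.All (+ (d ℕ.^ suc e) ∣_) (+ d · w)
    lift []      []       = []
    lift (x ∷ w) (p ∷ ps) =
      subst (_∣ + d ℤ.* x) (sym (ℤ.pos-* d (d ℕ.^ e))) (ℤ∣.*-monoʳ-∣ (+ d) p) ∷ lift w ps

-- Passes from one modulus to all of them: the other outcome of `gauss` is a nonzero integer kernel
-- vector, which injectivity modulo `d` excludes.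
controlled : ∀ {d} → 2 ℕ.≤ d → (R : List (Vec ℤ N)) → InjectiveMod (+ d) R →
  ∃[ D ] D ≢ 0ℤ × Controls D R
controlled 2≤d R inj with gauss R
... | inj₁ (z , z≢0 , ker) = contradiction (injective⇒trivial-kernel 2≤d R inj z ker) z≢0
... | inj₂ res = res

-- The modulus is 1 modulo `D`, so `D` is invertible and can be cancelled from `m ∣ D x`. The
-- inverse is explicit in `rearrange`: x = m x - (j q)(D x).
controls⇒injective : ∀ {D E} (R : List (Vec ℤ N)) → Controls D R → D ∣ E →
  ∀ j → InjectiveMod (1ℤ ℤ.+ j ℤ.* E) R
controls⇒injective {D = D} R controls (divides q refl) j z sol = VAll.map step (controls m z sol)
  where
  m = 1ℤ ℤ.+ j ℤ.* (q ℤ.* D)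
  rearrange : ∀ j q D x → (1ℤ ℤ.+ j ℤ.* (q ℤ.* D)) ℤ.* x ℤ.- (j ℤ.* q) ℤ.* (D ℤ.* x) ≡ x
  rearrange = ℤRing.solve-∀
  step : ∀ {x} → m ∣ D ℤ.* x → m ∣ x
  step {x} d = subst (m ∣_) (rearrange j q D x)
    (ℤ∣.∣m∣n⇒∣m-n (ℤ∣.∣m⇒∣m*n x ℤ∣.∣-refl) (ℤ∣.∣n⇒∣m*n (j ℤ.* q) d))

-- Generic vectors

-- Which of three codewords agree at a given position.
data Label : Set where
  none 1=2 2=3 1=3 all : Label

private
  code : Label → ℕ
  code none = 0
  code 1=2  = 1
  code 2=3  = 2
  code 1=3  = 3
  code all  = 4

  decode : ℕ → Label
  decode 0 = none
  decode 1 = 1=2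
  decode 2 = 2=3
  decode 3 = 1=3
  decode _ = all

  decode-code : ∀ l → decode (code l) ≡ l
  decode-code none = refl
  decode-code 1=2  = refl
  decode-code 2=3  = refl
  decode-code 1=3  = refl
  decode-code all  = refl

infix 4 _≟_
_≟_ : (l l′ : Label) → Dec (l ≡ l′)
l ≟ l′ = map′ (λ eq → trans (sym (decode-code l)) (trans (cong decode eq) (decode-code l′)))
              (cong code) (code l ℕ.≟ code l′)

δ : Label → Label → ℕ
δ l l′ with l ≟ l′
... | yes _ = 1
... | no  _ = 0

count : Label → Vec Label r → ℕ
count l []        = 0
count l (l′ ∷ ls) = δ l l′ ℕ.+ count l ls

-- Used positions are blanked with `none` instead of deleted, so indices keep their meaning
-- throughout the descent. The count of `none` itself may grow, hence its exclusion.
pick : ∀ {l} (ls : Vec Label r) → 0 ℕ.< count l ls →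
  ∃[ i ] lookup ls i ≡ l × (∀ l′ → l′ ≢ none → count l′ ls ≡ δ l′ l ℕ.+ count l′ (ls [ i ]≔ none))
pick {l = l} (l₀ ∷ ls) pos with l ≟ l₀
... | yes refl = zero , refl , λ l′ l′≢none →
      cong (λ x → δ l′ l ℕ.+ (x ℕ.+ count l′ ls)) (sym (δ-none l′≢none))
  where
  δ-none : ∀ {l′} → l′ ≢ none → δ l′ none ≡ 0
  δ-none {none} ≢ = contradiction refl ≢
  δ-none {1=2}  _ = refl
  δ-none {2=3}  _ = refl
  δ-none {1=3}  _ = refl
  δ-none {all}  _ = refl
... | no _ with pick ls pos
... | i , eq , counts = suc i , eq , λ l′ l′≢none →
      trans (cong (δ l′ l₀ ℕ.+_) (counts l′ l′≢none))
            (swap (δ l′ l₀) (δ l′ l) _)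
  where
  swap : ∀ a b c → a ℕ.+ (b ℕ.+ c) ≡ b ℕ.+ (a ℕ.+ c)
  swap = ℕRing.solve-∀

-- Double covers of a k-set by t elements of multiplicity two and by a, b and c elements of three
-- classes, no point being covered twice by the same class, exist under these inequalities.
record Ample (k t a b c : ℕ) : Set where
  constructor ample
  field
    total : 2 ℕ.* k ℕ.≤ 2 ℕ.* t ℕ.+ (a ℕ.+ (b ℕ.+ c))
    not-c : k ℕ.≤ t ℕ.+ (a ℕ.+ b)
    not-b : k ℕ.≤ t ℕ.+ (a ℕ.+ c)
    not-a : k ℕ.≤ t ℕ.+ (b ℕ.+ c)

ample? : ∀ k t a b c → Dec (Ample k t a b c)
ample? k t a b c = map′ (λ { (p , q , r , s) → ample p q r s }) (λ { (ample p q r s) → p , q , r , s })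
  (2 ℕ.* k ℕ.≤? _ ×-dec (k ℕ.≤? _ ×-dec (k ℕ.≤? _ ×-dec k ℕ.≤? _)))

private
  swap-ab : ∀ {k t a b c} → Ample k t a b c → Ample k t b a c
  swap-ab {k} {t} {a} {b} {c} (ample p q r s) =
    ample (subst (2 ℕ.* k ℕ.≤_) (eq t a b c) p) (subst (λ x → k ℕ.≤ t ℕ.+ x) (ℕ.+-comm a b) q) s r
    where
    eq : ∀ t a b c → 2 ℕ.* t ℕ.+ (a ℕ.+ (b ℕ.+ c)) ≡ 2 ℕ.* t ℕ.+ (b ℕ.+ (a ℕ.+ c))
    eq = ℕRing.solve-∀

  swap-bc : ∀ {k t a b c} → Ample k t a b c → Ample k t a c b
  swap-bc {k} {t} {a} {b} {c} (ample p q r s) =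
    ample (subst (λ x → 2 ℕ.* k ℕ.≤ 2 ℕ.* t ℕ.+ (a ℕ.+ x)) (ℕ.+-comm b c) p) r q
          (subst (λ x → k ℕ.≤ t ℕ.+ x) (ℕ.+-comm b c) s)

  drop-all : ∀ {k t a b c} → Ample (suc k) (suc t) a b c → Ample k t a b c
  drop-all {k} {t} {a} {b} {c} (ample p q r s) =
    ample (ℕ.+-cancelˡ-≤ 2 _ _ (subst₂ ℕ._≤_ (e₁ k) (e₂ t (a ℕ.+ (b ℕ.+ c))) p))
          (ℕ.s≤s⁻¹ q) (ℕ.s≤s⁻¹ r) (ℕ.s≤s⁻¹ s)
    where
    e₁ : ∀ k → 2 ℕ.* suc k ≡ 2 ℕ.+ 2 ℕ.* k
    e₁ = ℕRing.solve-∀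
    e₂ : ∀ t x → 2 ℕ.* suc t ℕ.+ x ≡ 2 ℕ.+ (2 ℕ.* t ℕ.+ x)
    e₂ = ℕRing.solve-∀

  -- Only the inequality that omits the smallest class is in danger, since its right side falls by
  -- two. If it failed, then a + b ≤ k + 1 for the old counts, and c ≤ (a + b)/2 would give 4(k + 1)
  -- ≤ 2(a + b + c) ≤ 3(a + b) ≤ 3(k + 1).
  drop-largest : ∀ {k a b c} → c ℕ.≤ a → c ℕ.≤ b → Ample (suc k) 0 a b c →
    ∃[ a′ ] ∃[ b′ ] a ≡ suc a′ × b ≡ suc b′ × Ample k 0 a′ b′ c
  drop-largest {a = zero} z≤n c≤b (ample _ _ () _)
  drop-largest {a = suc a} {zero} c≤a z≤n (ample _ _ _ ())
  drop-largest {k} {suc a} {suc b} {c} c≤a c≤b (ample p q r s) =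
    a , b , refl , refl ,
    ample (ℕ.+-cancelˡ-≤ 2 _ _ (subst₂ ℕ._≤_ (e₁ k) (e₂ a b c) p)) k≤a+b (ℕ.s≤s⁻¹ r) (ℕ.s≤s⁻¹ s)
    where
    e₁ : ∀ k → 2 ℕ.* suc k ≡ 2 ℕ.+ 2 ℕ.* k
    e₁ = ℕRing.solve-∀
    e₂ : ∀ a b c → suc a ℕ.+ (suc b ℕ.+ c) ≡ 2 ℕ.+ (a ℕ.+ (b ℕ.+ c))
    e₂ = ℕRing.solve-∀
    e₃ : ∀ a b c → 2 ℕ.* (suc a ℕ.+ (suc b ℕ.+ c)) ≡ 2 ℕ.* (suc a ℕ.+ suc b) ℕ.+ (c ℕ.+ c)
    e₃ = ℕRing.solve-∀
    e₄ : ∀ a b → 2 ℕ.* (suc a ℕ.+ suc b) ℕ.+ (suc a ℕ.+ suc b) ≡ 3 ℕ.* suc (suc (a ℕ.+ b))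
    e₄ = ℕRing.solve-∀
    e₅ : ∀ k → 2 ℕ.* (2 ℕ.* suc k) ≡ suc (k ℕ.+ 3 ℕ.* suc k)
    e₅ = ℕRing.solve-∀
    k≤a+b : k ℕ.≤ a ℕ.+ b
    k≤a+b with k ℕ.≤? a ℕ.+ b
    ... | yes le = le
    ... | no  gt = contradiction
      (begin-strict
        3 ℕ.* suc k                                 ≤⟨ ℕ.m≤n+m _ k ⟩
        k ℕ.+ 3 ℕ.* suc k                           <⟨ ℕ.≤-refl ⟩
        suc (k ℕ.+ 3 ℕ.* suc k)                     ≡⟨ sym (e₅ k) ⟩
        2 ℕ.* (2 ℕ.* suc k)                         ≤⟨ ℕ.*-monoʳ-≤ 2 p ⟩
        2 ℕ.* (suc a ℕ.+ (suc b ℕ.+ c))             ≡⟨ e₃ a b c ⟩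
        2 ℕ.* (suc a ℕ.+ suc b) ℕ.+ (c ℕ.+ c)       ≤⟨ ℕ.+-monoʳ-≤ (2 ℕ.* (suc a ℕ.+ suc b)) (ℕ.+-mono-≤ c≤a c≤b) ⟩
        2 ℕ.* (suc a ℕ.+ suc b) ℕ.+ (suc a ℕ.+ suc b) ≡⟨ e₄ a b ⟩
        3 ℕ.* suc (suc (a ℕ.+ b))                   ≤⟨ ℕ.*-monoʳ-≤ 3 (s≤s (ℕ.≰⇒> gt)) ⟩
        3 ℕ.* suc k                                 ∎)
      (ℕ.<-irrefl refl)
      where open ℕ.≤-Reasoning

-- These are the evident dimension counts for a nonsingular system in the differences x and y. There
-- are 2k unknowns, and an `all` position gives two equations. On each of the k-dimensional
-- subspaces x + y = 0, y = 0 and x = 0, one class of equations becomes void and an `all` position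
-- counts once, so the rest must still number at least k. The descent below shows that the counts
-- are also sufficient for some choice of vectors.
Rich : ℕ → Vec Label r → Set
Rich k ls = Ample k (count all ls) (count 1=2 ls) (count 2=3 ls) (count 1=3 ls)

-- Pairs of labels whose conditions together force both differences to vanish on a form. `all` is
-- paired with itself so that a single position can serve as both members.
data Determine : Label → Label → Set where
  all      : Determine all all
  1=2,2=3  : Determine 1=2 2=3
  1=2,1=3  : Determine 1=2 1=3
  2=3,1=3  : Determine 2=3 1=3

record Descent (k : ℕ) (ls : Vec Label r) : Set where
  constructor descent
  field
    ls′        : Vec Label r
    i i′       : Fin r
    determine  : Determine (lookup ls i) (lookup ls i′)
    richer     : Rich k ls′
    unchanged  : ∀ x → lookup ls′ x ≢ none → x ≢ i × x ≢ i′ × lookup ls′ x ≡ lookup ls x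

private
  transport : ∀ {t t′ a a′ b b′ c c′} → t ≡ t′ → a ≡ a′ → b ≡ b′ → c ≡ c′ →
              Ample k t a b c → Ample k t′ a′ b′ c′
  transport refl refl refl refl x = x

  pick-two : ∀ {l l′} (ls : Vec Label r) → Determine l l′ → l ≢ none → l′ ≢ none → δ l′ l ≡ 0 →
    0 ℕ.< count l ls → 0 ℕ.< count l′ ls → ((ls′ : Vec Label r) →
      (∀ σ → σ ≢ none → count σ ls ≡ δ σ l ℕ.+ (δ σ l′ ℕ.+ count σ ls′)) → Rich k ls′) →
    Descent k ls
  pick-two {l = l} {l′} ls det l≢ l′≢ δ≡0 l> l′> rich
    with i , i≡ , cᵢ ← pick ls l>
    with i′ , i′≡ , cᵢ′ ← pick (ls [ i ]≔ none)
           (subst (0 ℕ.<_) (trans (cᵢ l′ l′≢) (cong (ℕ._+ count l′ (ls [ i ]≔ none)) δ≡0)) l′>) =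
    descent ((ls [ i ]≔ none) [ i′ ]≔ none) i i′ (subst₂ Determine (sym i≡) (sym (trans (sym i′-old) i′≡)) det)
      (rich ((ls [ i ]≔ none) [ i′ ]≔ none) λ σ σ≢ → trans (cᵢ σ σ≢) (cong (δ σ l ℕ.+_) (cᵢ′ σ σ≢)))
      λ x x≢none →
        let x≢i′ = λ { refl → x≢none (Vec.lookup∘update x (ls [ i ]≔ none) none) }
            old  = Vec.lookup∘update′ x≢i′ (ls [ i ]≔ none) none
            x≢i  = λ { refl → x≢none (trans old (Vec.lookup∘update x ls none)) }
        in x≢i , x≢i′ , trans old (Vec.lookup∘update′ x≢i ls none)
    where
    i′≢i : i′ ≢ i
    i′≢i refl = l′≢ (trans (sym i′≡) (Vec.lookup∘update i ls none))
    i′-old : lookup (ls [ i ]≔ none) i′ ≡ lookup ls i′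
    i′-old = Vec.lookup∘update′ i′≢i ls none

  positive : ∀ {m n} → m ≡ suc n → 0 ℕ.< m
  positive refl = s≤s z≤n

  smallest : ∀ a b c → (c ℕ.≤ a × c ℕ.≤ b) ⊎ (b ℕ.≤ a × b ℕ.≤ c) ⊎ (a ℕ.≤ b × a ℕ.≤ c)
  smallest a b c with ℕ.≤-total a b | ℕ.≤-total b c | ℕ.≤-total a c
  ... | inj₁ a≤b | _        | inj₁ a≤c = inj₂ (inj₂ (a≤b , a≤c))
  ... | inj₁ a≤b | _        | inj₂ c≤a = inj₁ (c≤a , ℕ.≤-trans c≤a a≤b)
  ... | inj₂ b≤a | inj₁ b≤c | _        = inj₂ (inj₁ (b≤a , b≤c))
  ... | inj₂ b≤a | inj₂ c≤b | _        = inj₁ (ℕ.≤-trans c≤b b≤a , c≤b)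

  drop-suc : {m n m′ : ℕ} → m ≡ suc m′ → m ≡ suc n → m′ ≡ n
  drop-suc refl refl = refl

-- One coordinate is paid for by an `all` position whenever there is one, which lowers both sides of
-- every inequality equally. Otherwise it is paid for by one position from each of the two larger
-- classes, where `drop-largest` applies after a permutation of the classes.
descend : (ls : Vec Label r) → Rich (suc k) ls → Descent k ls
descend {k = k} ls rich with count all ls in t≡
... | suc t with i , l≡ , counts ← pick ls (positive t≡) =
  descent (ls [ i ]≔ none) i i (subst₂ Determine (sym l≡) (sym l≡) all)
    (transport (drop-suc t≡ (counts all λ ())) (counts 1=2 λ ()) (counts 2=3 λ ()) (counts 1=3 λ ())
      (drop-all rich))
    λ x ≢none → let x≢i = λ { refl → ≢none (Vec.lookup∘update x ls none) } in
      x≢i , x≢i , Vec.lookup∘update′ x≢i ls none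
... | zero with smallest (count 1=2 ls) (count 2=3 ls) (count 1=3 ls)
... | inj₁ (≤a , ≤b) with _ , _ , a≡ , b≡ , less ← drop-largest ≤a ≤b rich =
  pick-two ls 1=2,2=3 (λ ()) (λ ()) refl (positive a≡) (positive b≡) λ _ eq →
    transport (trans (sym t≡) (eq all λ ())) (drop-suc a≡ (eq 1=2 λ ()))
      (drop-suc b≡ (eq 2=3 λ ())) (eq 1=3 λ ()) less
... | inj₂ (inj₁ (≤a , ≤c)) with _ , _ , a≡ , c≡ , less ← drop-largest ≤a ≤c (swap-bc rich) =
  pick-two ls 1=2,1=3 (λ ()) (λ ()) refl (positive a≡) (positive c≡) λ _ eq →
    transport (trans (sym t≡) (eq all λ ())) (drop-suc a≡ (eq 1=2 λ ()))
      (eq 2=3 λ ()) (drop-suc c≡ (eq 1=3 λ ())) (swap-bc less)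
... | inj₂ (inj₂ (≤b , ≤c))
    with _ , _ , b≡ , c≡ , less ← drop-largest ≤b ≤c (swap-bc (swap-ab rich)) =
  pick-two ls 2=3,1=3 (λ ()) (λ ()) refl (positive b≡) (positive c≡) λ _ eq →
    transport (trans (sym t≡) (eq all λ ())) (eq 1=2 λ ())
      (drop-suc b≡ (eq 2=3 λ ())) (drop-suc c≡ (eq 1=3 λ ())) (swap-ab (swap-bc less))

-- Specialisation to unit vectors.

basis : Fin k → Vec ℤ k
basis zero    = 1ℤ ∷ 𝟎
basis (suc j) = 0ℤ ∷ basis j

dot-basis : (j : Fin k) (z : Vec ℤ k) → dot (basis j) z ≡ lookup z j
dot-basis zero    (x ∷ z) = trans
  (cong₂ ℤ._+_ (ℤ.*-identityˡ x) (trans (dot-comm 𝟎 z) (dot-𝟎ʳ z))) (ℤ.+-identityʳ x)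
dot-basis (suc j) (x ∷ z) = trans (ℤ.+-identityˡ _) (dot-basis j z)

-- With such vectors the selected equations decouple into k systems, the j-th of which involves only
-- the j-th coordinates of the two differences.
Specialization : Vec Label r → Vec (Vec ℤ k) r → Set
Specialization {r} {k} ls U = ∀ j → ∃[ i ] ∃[ i′ ]
  Determine (lookup ls i) (lookup ls i′) × lookup U i ≡ basis {k} j × lookup U i′ ≡ basis j

specialize : ∀ k (ls : Vec Label r) → Rich k ls → ∃[ U ] Specialization {k = k} ls U
specialize {r} zero ls _ = replicate r [] , λ ()
specialize (suc k) ls rich = tabulate U , λ { zero → chosen ; (suc j) → rest (proj₂ IH j) }
  where
  open Descent (descend ls rich)
  IH = specialize k ls′ richer
  U : Fin _ → Vec ℤ (suc k)
  U x with x Fin.≟ i | x Fin.≟ i′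
  ... | no _ | no _ = 0ℤ ∷ lookup (proj₁ IH) x
  -- Overwriting the vectors at `i` and `i′` is safe: the positions selected for the smaller problem
  -- carry a label other than `none` in `ls′`, hence differ from both.
  ... | _    | _    = basis zero
  U-i : U i ≡ basis zero
  U-i with i Fin.≟ i | i Fin.≟ i′
  ... | yes _ | _  = refl
  ... | no  ≢ | _  = contradiction refl ≢
  U-i′ : U i′ ≡ basis zero
  U-i′ with i′ Fin.≟ i | i′ Fin.≟ i′
  ... | yes _ | _     = refl
  ... | no _  | yes _ = refl
  ... | no _  | no  ≢ = contradiction refl ≢
  U-rest : ∀ {x j} → lookup ls′ x ≢ none → lookup (proj₁ IH) x ≡ basis j → U x ≡ basis (suc j)
  U-rest {x} ≢none eq with x Fin.≟ i | x Fin.≟ i′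
  ... | yes x≡i | _        = contradiction x≡i (proj₁ (unchanged x ≢none))
  ... | no  _   | yes x≡i′ = contradiction x≡i′ (proj₁ (proj₂ (unchanged x ≢none)))
  ... | no  _   | no  _    = cong (0ℤ ∷_) eq
  tab : ∀ {x v} → U x ≡ v → lookup (tabulate U) x ≡ v
  tab {x} = trans (Vec.lookup∘tabulate U x)
  chosen : ∃[ i ] ∃[ i′ ] Determine (lookup ls i) (lookup ls i′)
             × lookup (tabulate U) i ≡ basis zero × lookup (tabulate U) i′ ≡ basis zero
  chosen = i , i′ , determine , tab U-i , tab U-i′
  determine⇒≢noneˡ : ∀ {l l′} → Determine l l′ → l ≢ none
  determine⇒≢noneˡ all     ()
  determine⇒≢noneˡ 1=2,2=3 ()
  determine⇒≢noneˡ 1=2,1=3 ()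
  determine⇒≢noneˡ 2=3,1=3 ()
  determine⇒≢noneʳ : ∀ {l l′} → Determine l l′ → l′ ≢ none
  determine⇒≢noneʳ all     ()
  determine⇒≢noneʳ 1=2,2=3 ()
  determine⇒≢noneʳ 1=2,1=3 ()
  determine⇒≢noneʳ 2=3,1=3 ()
  rest : ∀ {j} → (∃[ x ] ∃[ x′ ] Determine (lookup ls′ x) (lookup ls′ x′)
             × lookup (proj₁ IH) x ≡ basis j × lookup (proj₁ IH) x′ ≡ basis j) →
         ∃[ x ] ∃[ x′ ] Determine (lookup ls x) (lookup ls x′)
             × lookup (tabulate U) x ≡ basis (suc j) × lookup (tabulate U) x′ ≡ basis (suc j)
  rest (x , x′ , det , eq , eq′) =
    let ≢none  = determine⇒≢noneˡ det
        ≢none′ = determine⇒≢noneʳ det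
    in x , x′ , subst₂ Determine (proj₂ (proj₂ (unchanged x ≢none)))
                                 (proj₂ (proj₂ (unchanged x′ ≢none′))) det
       , tab (U-rest ≢none eq) , tab (U-rest ≢none′ eq′)

-- x and y stand for the differences first − second and second − third; p and q are the
-- values of a linear form at x and at y.
Agree : ℤ → Label → ℤ → ℤ → Set
Agree m none p q = Unit
Agree m 1=2  p q = m ∣ p
Agree m 2=3  p q = m ∣ q
Agree m 1=3  p q = m ∣ p ℤ.+ q
Agree m all  p q = (m ∣ p) × (m ∣ q)

determine⇒∣ : ∀ {m l l′ p q} → Determine l l′ → Agree m l p q → Agree m l′ p q → (m ∣ p) × (m ∣ q)
determine⇒∣ all     pq _ = pq
determine⇒∣ 1=2,2=3 p  q = p , q
determine⇒∣ 1=2,1=3 p  s = p , ℤ∣.∣m+n∣m⇒∣n s p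
determine⇒∣ {p = p} {q} 2=3,1=3 d s = ℤ∣.∣m+n∣n⇒∣m {m = p} s d , d

-- The unknowns are the two differences, concatenated. The two rows for `all` account for the weight
-- 2 of `t` in `Ample`.
rows : Label → Vec ℤ k → List (Vec ℤ (k ℕ.+ k))
rows none v = []
rows 1=2  v = (v ++ 𝟎) ∷ []
rows 2=3  v = (𝟎 ++ v) ∷ []
rows 1=3  v = (v ++ v) ∷ []
rows all  v = (v ++ 𝟎) ∷ (𝟎 ++ v) ∷ []

system : Vec (Vec ℤ k) r → Vec Label r → List (Vec ℤ (k ℕ.+ k))
system []      []       = []
system (v ∷ V) (l ∷ ls) = rows l v List.++ system V ls

module _ (m : ℤ) (x y : Vec ℤ k) where
  private
    first : ∀ v → dot (v ++ 𝟎) (x ++ y) ≡ dot v x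
    first v = trans (dot-++ v x 𝟎 y)
      (trans (cong (λ t → dot v x ℤ.+ t) (trans (dot-comm 𝟎 y) (dot-𝟎ʳ y))) (ℤ.+-identityʳ _))
    second : ∀ v → dot (𝟎 ++ v) (x ++ y) ≡ dot v y
    second v = trans (dot-++ 𝟎 x v y)
      (trans (cong (ℤ._+ dot v y) (trans (dot-comm 𝟎 x) (dot-𝟎ʳ x))) (ℤ.+-identityˡ _))

    rows⇒agree : ∀ l v → Solution m (rows l v) (x ++ y) → Agree m l (dot v x) (dot v y)
    rows⇒agree none v []            = tt
    rows⇒agree 1=2  v (d ∷ [])      = subst (m ∣_) (first v) d
    rows⇒agree 2=3  v (d ∷ [])      = subst (m ∣_) (second v) d
    rows⇒agree 1=3  v (d ∷ [])      = subst (m ∣_) (dot-++ v x v y) d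
    rows⇒agree all  v (d ∷ d′ ∷ []) = subst (m ∣_) (first v) d , subst (m ∣_) (second v) d′

    agree⇒rows : ∀ l v → Agree m l (dot v x) (dot v y) → Solution m (rows l v) (x ++ y)
    agree⇒rows none v _        = []
    agree⇒rows 1=2  v d        = subst (m ∣_) (sym (first v)) d ∷ []
    agree⇒rows 2=3  v d        = subst (m ∣_) (sym (second v)) d ∷ []
    agree⇒rows 1=3  v d        = subst (m ∣_) (sym (dot-++ v x v y)) d ∷ []
    agree⇒rows all  v (d , d′) = subst (m ∣_) (sym (first v)) d ∷ subst (m ∣_) (sym (second v)) d′ ∷ []

  system⇒agree : (V : Vec (Vec ℤ k) r) (ls : Vec Label r) → Solution m (system V ls) (x ++ y) →
    ∀ i → Agree m (lookup ls i) (dot (lookup V i) x) (dot (lookup V i) y)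
  system⇒agree (v ∷ V) (l ∷ ls) sol zero    = rows⇒agree l v (All.++⁻ˡ (rows l v) sol)
  system⇒agree (v ∷ V) (l ∷ ls) sol (suc i) = system⇒agree V ls (All.++⁻ʳ (rows l v) sol) i

  agree⇒system : (V : Vec (Vec ℤ k) r) (ls : Vec Label r) →
    (∀ i → Agree m (lookup ls i) (dot (lookup V i) x) (dot (lookup V i) y)) →
    Solution m (system V ls) (x ++ y)
  agree⇒system []      []       ag = []
  agree⇒system (v ∷ V) (l ∷ ls) ag =
    All.++⁺ (agree⇒rows l v (ag zero)) (agree⇒system V ls (ag ∘ suc))

-- For each `j` the two selected equations form a 2 × 2 block of determinant ±1, so the argument is
-- the same for every modulus.
specialization-injective : ∀ {ls : Vec Label r} {U : Vec (Vec ℤ k) r} → Specialization ls U →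
  ∀ m → InjectiveMod m (system U ls)
specialization-injective {k = k} {ls} {U} spec m z sol with Vec.splitAt k z
... | x , y , refl = VAll.++⁺ {xs = x} {ys = y} (VAll.lookup⁻ (proj₁ ∘ both)) (VAll.lookup⁻ (proj₂ ∘ both))
  where
  both : ∀ j → (m ∣ lookup x j) × (m ∣ lookup y j)
  both j with spec j
  ... | i , i′ , det , eq , eq′ = determine⇒∣ det (agree i eq) (agree i′ eq′)
    where
    agree : ∀ i → lookup U i ≡ basis j → Agree m (lookup ls i) (lookup x j) (lookup y j)
    agree i eq = subst₂ (Agree m (lookup ls i))
      (trans (cong (λ v → dot v x) eq) (dot-basis j x))
      (trans (cong (λ v → dot v y) eq) (dot-basis j y))
      (system⇒agree m x y U ls sol i)

agree-cong : ∀ {m p q p′ q′} l → m ∣ p ℤ.- p′ → m ∣ q ℤ.- q′ → Agree m l p q → Agree m l p′ q′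
agree-cong {m} {p} {q} {p′} {q′} = go
  where
  shift : ∀ {x x′} → m ∣ x ℤ.- x′ → m ∣ x → m ∣ x′
  shift {x} {x′} d e = subst (m ∣_) (cancel x x′) (ℤ∣.∣m∣n⇒∣m-n e d)
    where
    cancel : ∀ x x′ → x ℤ.- (x ℤ.- x′) ≡ x′
    cancel = ℤRing.solve-∀
  sum : ∀ p q p′ q′ → (p ℤ.- p′) ℤ.+ (q ℤ.- q′) ≡ (p ℤ.+ q) ℤ.- (p′ ℤ.+ q′)
  sum = ℤRing.solve-∀
  go : ∀ l → m ∣ p ℤ.- p′ → m ∣ q ℤ.- q′ → Agree m l p q → Agree m l p′ q′
  go none d e _       = tt
  go 1=2  d e a       = shift d a
  go 2=3  d e a       = shift e a
  go 1=3  d e a       = shift (subst (m ∣_) (sum p q p′ q′) (ℤ∣.∣m∣n⇒∣m+n d e)) a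
  go all  d e (a , b) = shift d a , shift e b

injective-cong : ∀ {m} {V W : Vec (Vec ℤ k) r} (ls : Vec Label r) →
  (∀ i x → m ∣ dot (lookup W i) x ℤ.- dot (lookup V i) x) →
  InjectiveMod m (system V ls) → InjectiveMod m (system W ls)
injective-cong {k = k} {m = m} {V} {W} ls close inj z sol with Vec.splitAt k z
... | x , y , refl = inj (x ++ y) (agree⇒system m x y V ls λ i →
  agree-cong (lookup ls i) (close i x) (close i y) (system⇒agree m x y W ls sol i))

-- A certificate of nonsingularity over ℚ. The modulus may differ from one labelling to another,
-- which is what makes the induction in `independent` possible.
Independent : Vec (Vec ℤ k) r → Vec Label r → Set
Independent V ls = ∃[ d ] 2 ℕ.≤ d × InjectiveMod (+ d) (system V ls)

Controlled : ℕ → Vec (Vec ℤ k) r → Vec Label r → Set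
Controlled E V ls = ∃[ D ] D ∣ + E × Controls D (system V ls)

common-control : (V : Vec (Vec ℤ k) r) (L : List (Vec Label r)) → All (Independent V) L →
  ∃[ E ] 1 ℕ.≤ E × All (Controlled E V) L
common-control V []       []                  = 1 , s≤s z≤n , []
common-control V (ls ∷ L) ((d , 2≤d , inj) ∷ ind)
  with controlled 2≤d (system V ls) inj | common-control V L ind
... | D , D≢0 , ctrl | E , 1≤E , ctrls =
  ℤ.∣ D ∣ ℕ.* E
  , ℕ.*-mono-≤ (ℕ.n≢0⇒n>0 (D≢0 ∘ ℤ.∣i∣≡0⇒i≡0)) 1≤E
  , (D , subst (D ∣_) (sym (ℤ.pos-* ℤ.∣ D ∣ E)) (ℤ∣.∣m⇒∣m*n (+ E) ℤ∣.m∣∣m∣) , ctrl)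
  ∷ All.map (λ { (D′ , D′∣E , c) →
      D′ , subst (D′ ∣_) (sym (ℤ.pos-* ℤ.∣ D ∣ E)) (ℤ∣.∣n⇒∣m*n (+ ℤ.∣ D ∣) D′∣E) , c }) ctrls

-- W = V + M(U − V) with M = 1 + 2E is congruent to V mod M and to U mod M − 1.
independent : ∀ k (L : List (Vec Label r)) → All (Rich k) L → ∃[ V ] All (Independent {k = k} V) L
independent {r} k []       []          = replicate r 𝟎 , []
independent {r} k (ls ∷ L) (rich ∷ richs)
  with V , ind ← independent k L richs
  with U , spec ← specialize k ls rich
  with E , 1≤E , ctrl ← common-control V L ind =
  W , (2 ℕ.* E , ℕ.*-monoʳ-≤ 2 1≤E
        , injective-cong {V = U} {W} ls close-U (specialization-injective {ls = ls} {U} spec (+ (2 ℕ.* E))))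
    ∷ All.map (λ {ls′} → keep ls′) ctrl
  where
  -- The factor 2 makes M - 1 = 2E at least 2 even when `E` is 1, as `Independent` demands. Since M
  -- ≡ 1 mod E, the earlier systems are injective modulo M.
  M = 1ℤ ℤ.+ + 2 ℤ.* + E
  W : Vec (Vec ℤ k) r
  W = zipWith (λ v u → v ⊕ M · (u ⊕ (ℤ.- 1ℤ) · v)) V U
  dot-W : ∀ i x → dot (lookup W i) x ≡
    dot (lookup V i) x ℤ.+ M ℤ.* (dot (lookup U i) x ℤ.+ (ℤ.- 1ℤ) ℤ.* dot (lookup V i) x)
  dot-W i x rewrite Vec.lookup-zipWith (λ v u → v ⊕ M · (u ⊕ (ℤ.- 1ℤ) · v)) i V U =
    trans (dot-⊕ˡ v (M · (u ⊕ (ℤ.- 1ℤ) · v)) x) (cong (λ t → dot v x ℤ.+ t) (trans (dot-·ˡ M (u ⊕ (ℤ.- 1ℤ) · v) x)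
      (cong (M ℤ.*_) (trans (dot-⊕ˡ u ((ℤ.- 1ℤ) · v) x) (cong (λ t → dot u x ℤ.+ t) (dot-·ˡ (ℤ.- 1ℤ) v x))))))
    where
    v = lookup V i
    u = lookup U i
  close-V : ∀ i x → M ∣ dot (lookup W i) x ℤ.- dot (lookup V i) x
  close-V i x = divides (dot (lookup U i) x ℤ.+ (ℤ.- 1ℤ) ℤ.* dot (lookup V i) x) 
    (trans (cong (ℤ._- dot (lookup V i) x) (dot-W i x)) (eq M (dot (lookup V i) x) _))
    where
    eq : ∀ M p d → p ℤ.+ M ℤ.* d ℤ.- p ≡ d ℤ.* M
    eq = ℤRing.solve-∀
  close-U : ∀ i x → + (2 ℕ.* E) ∣ dot (lookup W i) x ℤ.- dot (lookup U i) x
  close-U i x = subst (_∣ dot (lookup W i) x ℤ.- dot (lookup U i) x) (sym (ℤ.pos-* 2 E))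
    (divides (dot (lookup U i) x ℤ.- dot (lookup V i) x)
      (trans (cong (ℤ._- dot (lookup U i) x) (dot-W i x)) (eq (+ E) (dot (lookup V i) x) (dot (lookup U i) x))))
    where
    eq : ∀ E p q → p ℤ.+ (1ℤ ℤ.+ + 2 ℤ.* E) ℤ.* (q ℤ.+ (ℤ.- 1ℤ) ℤ.* p) ℤ.- q ≡ (q ℤ.- p) ℤ.* (+ 2 ℤ.* E)
    eq = ℤRing.solve-∀
  M≡ : + (1 ℕ.+ 2 ℕ.* E) ≡ M
  M≡ = trans (ℤ.pos-+ 1 (2 ℕ.* E)) (cong (ℤ._+_ 1ℤ) (ℤ.pos-* 2 E))
  keep : ∀ ls′ → Controlled E V ls′ → Independent W ls′
  keep ls′ (D , D∣E , c) = 1 ℕ.+ 2 ℕ.* E , s≤s (ℕ.≤-trans 1≤E (ℕ.m≤n*m E 2)) ,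
    subst (λ m → InjectiveMod m (system W ls′)) (sym M≡)
      (injective-cong {V = V} {W} ls′ close-V (controls⇒injective (system V ls′) c D∣E (+ 2)))

private
  labels : List Label
  labels = none ∷ 1=2 ∷ 2=3 ∷ 1=3 ∷ all ∷ []

  ∈-labels : ∀ l → l ∈ labels
  ∈-labels none = here refl
  ∈-labels 1=2  = there (here refl)
  ∈-labels 2=3  = there (there (here refl))
  ∈-labels 1=3  = there (there (there (here refl)))
  ∈-labels all  = there (there (there (there (here refl))))

  labellings : ∀ r → List (Vec Label r)
  labellings zero    = [] ∷ []
  labellings (suc r) = List.cartesianProductWith _∷_ labels (labellings r)

  ∈-labellings : (ls : Vec Label r) → ls ∈ labellings r
  ∈-labellings []       = here refl
  ∈-labellings (l ∷ ls) = ∈.∈-cartesianProductWith⁺ _∷_ (∈-labels l) (∈-labellings ls)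

-- There are only finitely many labellings of `r` positions, so one choice of vectors and one `E`
-- serve all the rich ones, independently of the block size.
generic-vectors : ∀ k r → ∃[ V ] ∃[ E ] 1 ℕ.≤ E ×
  (∀ ls → Rich k ls → ∀ j → InjectiveMod (1ℤ ℤ.+ j ℤ.* + E) (system {k} {r} V ls))
generic-vectors k r =
  let V , ind = independent k rich (All.all-filter rich? (labellings r))
      E , 1≤E , ctrl = common-control V rich ind
  in V , E , 1≤E , λ ls r →
     let D , D∣E , c = All.lookup ctrl (∈.∈-filter⁺ rich? (∈-labellings ls) r)
     in controls⇒injective (system V ls) c D∣E
  where
  rich? : (ls : Vec Label r) → Dec (Rich k ls)
  rich? ls = ample? k _ _ _ _
  rich = List.filter rich? (labellings r)

-- Families of transversals and their gluing

bit : Bool → ℕ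
bit true  = 1
bit false = 0

∣∷∣ : ∀ b (A : Subset n) → ∣ b ∷ A ∣ ≡ bit b ℕ.+ ∣ A ∣
∣∷∣ true  A = refl
∣∷∣ false A = refl

∣++∣ : (A : Subset n) (B : Subset n′) → ∣ A ++ B ∣ ≡ ∣ A ∣ ℕ.+ ∣ B ∣
∣++∣ []          B = refl
∣++∣ (true  ∷ A) B = cong suc (∣++∣ A B)
∣++∣ (false ∷ A) B = ∣++∣ A B

⊥++⊥ : ∀ n n′ → ⊥ {n} ++ ⊥ {n′} ≡ ⊥
⊥++⊥ zero    n′ = refl
⊥++⊥ (suc n) n′ = cong (false ∷_) (⊥++⊥ n n′)

-- Written through `⋃` so that it agrees definitionally with the union in `Free`. This explains the
-- final `∨ false` and `∪ ⊥` in the lemmas below.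
⋃³ : (A B Z : Subset n) → Subset n
⋃³ A B Z = ⋃ (A ∷ B ∷ Z ∷ [])

∣∷∣₄ : ∀ a b c d (A B Z D : Subset n) → ∣ a ∷ A ∣ ℕ.+ (∣ b ∷ B ∣ ℕ.+ (∣ c ∷ Z ∣ ℕ.+ ∣ d ∷ D ∣)) ≡
  (bit a ℕ.+ (bit b ℕ.+ (bit c ℕ.+ bit d))) ℕ.+ (∣ A ∣ ℕ.+ (∣ B ∣ ℕ.+ (∣ Z ∣ ℕ.+ ∣ D ∣)))
∣∷∣₄ a b c d A B Z D rewrite ∣∷∣ a A | ∣∷∣ b B | ∣∷∣ c Z | ∣∷∣ d D =
  lemma (bit a) (bit b) (bit c) (bit d) (∣ A ∣) (∣ B ∣) (∣ Z ∣) (∣ D ∣)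
  where
  lemma : ∀ a b c d A B Z D → a ℕ.+ A ℕ.+ (b ℕ.+ B ℕ.+ (c ℕ.+ Z ℕ.+ (d ℕ.+ D))) ≡
    (a ℕ.+ (b ℕ.+ (c ℕ.+ d))) ℕ.+ (A ℕ.+ (B ℕ.+ (Z ℕ.+ D)))
  lemma = ℕRing.solve-∀

inclusion-exclusion : (A B Z : Subset n) →
  ∣ A ∣ ℕ.+ (∣ B ∣ ℕ.+ (∣ Z ∣ ℕ.+ ∣ A ∩ (B ∩ Z) ∣)) ≡
  ∣ ⋃³ A B Z ∣ ℕ.+ (∣ A ∩ B ∣ ℕ.+ (∣ A ∩ Z ∣ ℕ.+ ∣ B ∩ Z ∣))
inclusion-exclusion []      []      []      = refl
inclusion-exclusion (a ∷ A) (b ∷ B) (c ∷ Z) = trans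
  (∣∷∣₄ a b c (a ∧ (b ∧ c)) A B Z (A ∩ (B ∩ Z))) (trans
  (cong₂ ℕ._+_ (bits a b c) (inclusion-exclusion A B Z)) (sym
  (∣∷∣₄ (a ∨ (b ∨ (c ∨ false))) (a ∧ b) (a ∧ c) (b ∧ c) (⋃³ A B Z) (A ∩ B) (A ∩ Z) (B ∩ Z))))
  where
  bits : ∀ a b c → bit a ℕ.+ (bit b ℕ.+ (bit c ℕ.+ bit (a ∧ (b ∧ c)))) ≡
    bit (a ∨ (b ∨ (c ∨ false))) ℕ.+ (bit (a ∧ b) ℕ.+ (bit (a ∧ c) ℕ.+ bit (b ∧ c)))
  bits false false false = refl
  bits false false true  = refl
  bits false true  false = refl
  bits false true  true  = refl
  bits true  false false = refl
  bits true  false true  = refl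
  bits true  true  false = refl
  bits true  true  true  = refl

∣∩++∣ : (A B : Subset n) (Z D : Subset n′) → ∣ (A ++ Z) ∩ (B ++ D) ∣ ≡ ∣ A ∩ B ∣ ℕ.+ ∣ Z ∩ D ∣
∣∩++∣ A B Z D = trans (cong ∣_∣ (Vec.zipWith-++ _∧_ A Z B D)) (∣++∣ (A ∩ B) (Z ∩ D))

⋃³-++ : (A B Z : Subset n) (A′ B′ Z′ : Subset n′) →
  ⋃³ (A ++ A′) (B ++ B′) (Z ++ Z′) ≡ ⋃³ A B Z ++ ⋃³ A′ B′ Z′
⋃³-++ {n} {n′} A B Z A′ B′ Z′ rewrite sym (⊥++⊥ n n′)
  | Vec.zipWith-++ _∨_ Z Z′ (⊥ {n}) (⊥ {n′})
  | Vec.zipWith-++ _∨_ B B′ (Z ∪ ⊥) (Z′ ∪ ⊥)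
  | Vec.zipWith-++ _∨_ A A′ (B ∪ (Z ∪ ⊥)) (B′ ∪ (Z′ ∪ ⊥)) = refl

∣⋃³-++∣ : (A B Z : Subset n) (A′ B′ Z′ : Subset n′) →
  ∣ ⋃³ (A ++ A′) (B ++ B′) (Z ++ Z′) ∣ ≡ ∣ ⋃³ A B Z ∣ ℕ.+ ∣ ⋃³ A′ B′ Z′ ∣
∣⋃³-++∣ A B Z A′ B′ Z′ = trans (cong ∣_∣ (⋃³-++ A B Z A′ B′ Z′)) (∣++∣ (⋃³ A B Z) (⋃³ A′ B′ Z′))

∣⊥∩∣≡0 : (A : Subset n) → ∣ ⊥ ∩ A ∣ ≡ 0
∣⊥∩∣≡0 {n} A = trans (cong ∣_∣ (Subset.∩-zeroˡ A)) (Subset.∣⊥∣≡0 n)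

∣∩⊥∣≡0 : (A : Subset n) → ∣ A ∩ ⊥ ∣ ≡ 0
∣∩⊥∣≡0 {n} A = trans (cong ∣_∣ (Subset.∩-zeroʳ A)) (Subset.∣⊥∣≡0 n)

∣⋃³⊥∣≡0 : ∀ n → ∣ ⋃³ (⊥ {n}) ⊥ ⊥ ∣ ≡ 0
∣⋃³⊥∣≡0 n = trans (cong ∣_∣ {x = ⋃³ (⊥ {n}) ⊥ ⊥} (trans (Subset.∪-identityˡ {n} _) (trans (Subset.∪-identityˡ {n} _) (Subset.∪-identityˡ {n} ⊥))))
  (Subset.∣⊥∣≡0 n)

-- The three-edge condition with the subtraction 3r ∸ 2k moved to the other side.
record GoodFamily (r k n : ℕ) (I : Set) : Set where
  field
    member : I → Subset n
    size   : ∀ i → ∣ member i ∣ ≡ r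
    pair   : ∀ {i j} → i ≢ j → ∣ member i ∩ member j ∣ ℕ.< k
    triple : ∀ {i j l} → i ≢ j → i ≢ l → j ≢ l →
             3 ℕ.* r ℕ.< ∣ ⋃³ (member i) (member j) (member l) ∣ ℕ.+ 2 ℕ.* k

open GoodFamily

reindex : ∀ {I J : Set} (h : J → I) → (∀ {i j} → h i ≡ h j → i ≡ j) →
          GoodFamily r k n I → GoodFamily r k n J
reindex h inj F = record
  { member = member F ∘ h
  ; size   = size F ∘ h
  ; pair   = λ i≢j → pair F (i≢j ∘ inj)
  ; triple = λ i≢j i≢l j≢l → triple F (i≢j ∘ inj) (i≢l ∘ inj) (j≢l ∘ inj)
  }

pad : ∀ {I} → n ℕ.≤ n′ → GoodFamily r k n I → GoodFamily r k n′ I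
pad {n} {n′} n≤n′ F with ℕ.m≤n⇒∃[o]m+o≡n n≤n′
... | o , refl = record
  { member = λ i → member F i ++ ⊥
  ; size   = λ i → trans (∣++∣ (member F i) ⊥) (trans (cong (∣ member F i ∣ ℕ.+_) (Subset.∣⊥∣≡0 o))
             (trans (ℕ.+-identityʳ _) (size F i)))
  ; pair   = λ {i} {j} i≢j → subst (ℕ._< _) (sym (∩≡ i j)) (pair F i≢j)
  ; triple = λ {i} {j} {l} i≢j i≢l j≢l →
             subst (λ x → _ ℕ.< x ℕ.+ _) (sym (∪≡ i j l)) (triple F i≢j i≢l j≢l)
  }
  where
  ∩≡ : ∀ i j → ∣ (member F i ++ ⊥ {o}) ∩ (member F j ++ ⊥) ∣ ≡ ∣ member F i ∩ member F j ∣
  ∩≡ i j = trans (∣∩++∣ (member F i) (member F j) ⊥ ⊥)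
    (trans (cong (∣ member F i ∩ member F j ∣ ℕ.+_) (∣⊥∩∣≡0 {o} ⊥)) (ℕ.+-identityʳ _))
  ∪≡ : ∀ i j l → ∣ ⋃³ (member F i ++ ⊥ {o}) (member F j ++ ⊥) (member F l ++ ⊥) ∣ ≡
       ∣ ⋃³ (member F i) (member F j) (member F l) ∣
  ∪≡ i j l = trans (∣⋃³-++∣ (member F i) (member F j) (member F l) ⊥ ⊥ ⊥)
    (trans (cong (∣ ⋃³ (member F i) (member F j) (member F l) ∣ ℕ.+_) (∣⋃³⊥∣≡0 o)) (ℕ.+-identityʳ _))

realize : ∀ {N} → k ℕ.≤ r → GoodFamily r k n (Fin N) → IsSize r n (3 ℕ.* r ℕ.∸ 2 ℕ.* k) 3 N
realize {k} {r} {n} {N} k≤r F = G , free , List.length-tabulate (member F)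
  where
  injective : ∀ {i j} → member F i ≡ member F j → i ≡ j
  injective {i} {j} eq with i Fin.≟ j
  ... | yes i≡j = i≡j
  ... | no  i≢j = contradiction
    (ℕ.<-≤-trans (subst (ℕ._< k) same (pair F i≢j)) k≤r) (ℕ.<-irrefl refl)
    where
    same : ∣ member F i ∩ member F j ∣ ≡ r
    same = trans (cong (λ A → ∣ member F i ∩ A ∣) (sym eq))
      (trans (cong ∣_∣ (Subset.∩-idem (member F i))) (size F i))
  G : Hypergraph r n
  G = record
    { edges   = List.tabulate (member F)
    ; unique  = Unique.tabulate⁺ injective
    ; uniform = All.tabulate⁺ (size F)
    }
  free : Free (3 ℕ.* r ℕ.∸ 2 ℕ.* k) 3 G
  free (A ∷ B ∷ Z ∷ []) ((A≢B ∷ A≢Z ∷ []) ∷ (B≢Z ∷ []) ∷ _) sub refl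
    with ∈.∈-tabulate⁻ (sub (here refl)) | ∈.∈-tabulate⁻ (sub (there (here refl)))
       | ∈.∈-tabulate⁻ (sub (there (there (here refl))))
  ... | i , refl | j , refl | l , refl = bound
    (triple F (A≢B ∘ cong (member F)) (A≢Z ∘ cong (member F)) (B≢Z ∘ cong (member F)))
    where
    U = ∣ ⋃³ (member F i) (member F j) (member F l) ∣
    bound : 3 ℕ.* r ℕ.< U ℕ.+ 2 ℕ.* k → 3 ℕ.* r ℕ.∸ 2 ℕ.* k ℕ.< U
    bound lt = ℕ.+-cancelʳ-< (2 ℕ.* k) _ _
      (subst (ℕ._< U ℕ.+ 2 ℕ.* k) (sym (ℕ.m∸n+n≡m 2k≤3r)) lt)
      where
      2k≤3r : 2 ℕ.* k ℕ.≤ 3 ℕ.* r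
      2k≤3r = ℕ.*-mono-≤ (ℕ.n≤1+n 2) k≤r

-- Edges from different classes meet in at most one vertex, so a triple that is not inside one
-- class loses at most k + 1 < 2k vertices.
glue : ∀ {I Z : Set} → 2 ℕ.≤ k → DecidableEquality Z → (colour : I → Z) (edge : I → Subset n) →
  (∀ i → ∣ edge i ∣ ≡ r) →
  (∀ {i j} → colour i ≢ colour j → ∣ edge i ∩ edge j ∣ ℕ.≤ 1) →
  (∀ {i j} → i ≢ j → colour i ≡ colour j → ∣ edge i ∩ edge j ∣ ℕ.< k) →
  (∀ {i j l} → i ≢ j → i ≢ l → j ≢ l → colour i ≡ colour j → colour i ≡ colour l →
    3 ℕ.* r ℕ.< ∣ ⋃³ (edge i) (edge j) (edge l) ∣ ℕ.+ 2 ℕ.* k) →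
  GoodFamily r k n I
glue {k} {n} {r} {I} 2≤k _≟ᶜ_ colour edge size′ cross same₂ same₃ =
  record { member = edge ; size = size′ ; pair = pair′ ; triple = triple′ }
  where
  pair′ : ∀ {i j} → i ≢ j → ∣ edge i ∩ edge j ∣ ℕ.< k
  pair′ {i} {j} i≢j with colour i ≟ᶜ colour j
  ... | yes eq = same₂ i≢j eq
  ... | no  ≢  = ℕ.≤-trans (s≤s (cross ≢)) 2≤k

  few : ∀ i j l → ∣ edge i ∩ edge j ∣ ℕ.+ (∣ edge i ∩ edge l ∣ ℕ.+ ∣ edge j ∩ edge l ∣) ℕ.< 2 ℕ.* k →
    3 ℕ.* r ℕ.< ∣ ⋃³ (edge i) (edge j) (edge l) ∣ ℕ.+ 2 ℕ.* k
  few i j l lt = begin-strict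
    3 ℕ.* r
      ≡⟨ cong₂ (λ x y → x ℕ.+ y) (sym (size′ i)) (cong₂ ℕ._+_ (sym (size′ j)) (cong (ℕ._+ 0) (sym (size′ l)))) ⟩
    ∣ edge i ∣ ℕ.+ (∣ edge j ∣ ℕ.+ (∣ edge l ∣ ℕ.+ 0))
      ≤⟨ ℕ.+-monoʳ-≤ (∣ edge i ∣) (ℕ.+-monoʳ-≤ (∣ edge j ∣) (ℕ.+-monoʳ-≤ (∣ edge l ∣) z≤n)) ⟩
    ∣ edge i ∣ ℕ.+ (∣ edge j ∣ ℕ.+ (∣ edge l ∣ ℕ.+ ∣ edge i ∩ (edge j ∩ edge l) ∣))
      ≡⟨ inclusion-exclusion (edge i) (edge j) (edge l) ⟩
    ∣ ⋃³ (edge i) (edge j) (edge l) ∣ ℕ.+ _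
      <⟨ ℕ.+-monoʳ-< (∣ ⋃³ (edge i) (edge j) (edge l) ∣) lt ⟩
    ∣ ⋃³ (edge i) (edge j) (edge l) ∣ ℕ.+ 2 ℕ.* k ∎
    where open ℕ.≤-Reasoning

  sum< : ∀ {a b c} → a ℕ.≤ 1 → b ℕ.≤ 1 → c ℕ.< k → a ℕ.+ (b ℕ.+ c) ℕ.< 2 ℕ.* k
  sum< {a} {b} {c} a≤1 b≤1 c<k = begin-strict
    a ℕ.+ (b ℕ.+ c)  ≤⟨ ℕ.+-mono-≤ a≤1 (ℕ.+-monoˡ-≤ c b≤1) ⟩
    2 ℕ.+ c          <⟨ ℕ.+-monoʳ-< 2 c<k ⟩
    2 ℕ.+ k          ≤⟨ ℕ.+-monoˡ-≤ k 2≤k ⟩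
    k ℕ.+ k          ≡⟨ cong (k ℕ.+_) (sym (ℕ.+-identityʳ k)) ⟩
    2 ℕ.* k          ∎
    where open ℕ.≤-Reasoning

  triple′ : ∀ {i j l} → i ≢ j → i ≢ l → j ≢ l → 3 ℕ.* r ℕ.< ∣ ⋃³ (edge i) (edge j) (edge l) ∣ ℕ.+ 2 ℕ.* k
  triple′ {i} {j} {l} i≢j i≢l j≢l with colour i ≟ᶜ colour j | colour i ≟ᶜ colour l
  ... | yes ij | yes il = same₃ i≢j i≢l j≢l ij il
  ... | yes ij | no  il = few i j l (subst (ℕ._< 2 ℕ.* k) (rotate (∣ edge i ∩ edge l ∣) (∣ edge j ∩ edge l ∣) _)
                            (sum< (cross il) (cross (il ∘ trans ij)) (pair′ i≢j)))
    where
    rotate : ∀ a b c → a ℕ.+ (b ℕ.+ c) ≡ c ℕ.+ (a ℕ.+ b)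
    rotate = ℕRing.solve-∀
  ... | no  ij | no  il = few i j l (sum< (cross ij) (cross il) (pair′ j≢l))
  ... | no  ij | yes il = few i j l (subst (ℕ._< 2 ℕ.* k) (swap (∣ edge i ∩ edge j ∣) (∣ edge j ∩ edge l ∣) _)
                            (sum< (cross ij) (cross λ jl → ij (trans il (sym jl))) (pair′ i≢l)))
    where
    swap : ∀ a b c → a ℕ.+ (b ℕ.+ c) ≡ a ℕ.+ (c ℕ.+ b)
    swap = ℕRing.solve-∀

-- Transversals and copies of sets inside a block.

transversal : Vec (Fin q) r → Subset (r ℕ.* q)
transversal []      = []
transversal (a ∷ w) = ⁅ a ⁆ ++ transversal w

∣transversal∣ : (w : Vec (Fin q) r) → ∣ transversal w ∣ ≡ r
∣transversal∣ []      = refl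
∣transversal∣ (a ∷ w) = trans (∣++∣ ⁅ a ⁆ (transversal w)) (cong₂ ℕ._+_ (Subset.∣⁅x⁆∣≡1 a) (∣transversal∣ w))

module _ {a b c : Fin q} where
  label : Dec (a ≡ b) → Dec (b ≡ c) → Dec (a ≡ c) → Label
  label (yes _) (yes _) _       = all
  label (yes _) (no _)  _       = 1=2
  label (no _)  (yes _) _       = 2=3
  label (no _)  (no _)  (yes _) = 1=3
  label (no _)  (no _)  (no _)  = none

labelling : (u v w : Vec (Fin q) r) → Vec Label r
labelling []      []      []      = []
labelling (a ∷ u) (b ∷ v) (c ∷ w) = label (a Fin.≟ b) (b Fin.≟ c) (a Fin.≟ c) ∷ labelling u v w

private
  ∣⁅a⁆∩⁅a⁆∣ : (a : Fin q) → ∣ ⁅ a ⁆ ∩ ⁅ a ⁆ ∣ ≡ 1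
  ∣⁅a⁆∩⁅a⁆∣ a = trans (cong ∣_∣ (Subset.∩-idem ⁅ a ⁆)) (Subset.∣⁅x⁆∣≡1 a)

  ∣⁅a⁆∩⁅b⁆∣ : {a b : Fin q} → a ≢ b → ∣ ⁅ a ⁆ ∩ ⁅ b ⁆ ∣ ≡ 0
  ∣⁅a⁆∩⁅b⁆∣ {a = zero}  {zero}  a≢b = contradiction refl a≢b
  ∣⁅a⁆∩⁅b⁆∣ {a = zero}  {suc b} a≢b = ∣⊥∩∣≡0 ⁅ b ⁆
  ∣⁅a⁆∩⁅b⁆∣ {a = suc a} {zero}  a≢b = ∣∩⊥∣≡0 ⁅ a ⁆
  ∣⁅a⁆∩⁅b⁆∣ {a = suc a} {suc b} a≢b = ∣⁅a⁆∩⁅b⁆∣ (a≢b ∘ cong suc)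

  interchange : ∀ a b c d → (a ℕ.+ b) ℕ.+ (c ℕ.+ d) ≡ (a ℕ.+ c) ℕ.+ (b ℕ.+ d)
  interchange = ℕRing.solve-∀

∩₁₂ : (u v w : Vec (Fin q) r) → let ls = labelling u v w in
  ∣ transversal u ∩ transversal v ∣ ≡ count all ls ℕ.+ count 1=2 ls
∩₁₂ []      []      []      = refl
∩₁₂ (a ∷ u) (b ∷ v) (c ∷ w) = trans (∣∩++∣ ⁅ a ⁆ ⁅ b ⁆ (transversal u) (transversal v))
  (trans (cong₂ ℕ._+_ (head (a Fin.≟ b) (b Fin.≟ c) (a Fin.≟ c)) (∩₁₂ u v w))
         (interchange (δ all l) (δ 1=2 l) _ _))
  where
  l = label (a Fin.≟ b) (b Fin.≟ c) (a Fin.≟ c)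
  head : (d : Dec (a ≡ b)) (e : Dec (b ≡ c)) (f : Dec (a ≡ c)) → let l = label d e f in
    ∣ ⁅ a ⁆ ∩ ⁅ b ⁆ ∣ ≡ δ all l ℕ.+ δ 1=2 l
  head (yes refl) (yes _) _       = ∣⁅a⁆∩⁅a⁆∣ a
  head (yes refl) (no _)  _       = ∣⁅a⁆∩⁅a⁆∣ a
  head (no ≢)     (yes _) _       = ∣⁅a⁆∩⁅b⁆∣ ≢
  head (no ≢)     (no _)  (yes _) = ∣⁅a⁆∩⁅b⁆∣ ≢
  head (no ≢)     (no _)  (no _)  = ∣⁅a⁆∩⁅b⁆∣ ≢

∩₂₃ : (u v w : Vec (Fin q) r) → let ls = labelling u v w in
  ∣ transversal v ∩ transversal w ∣ ≡ count all ls ℕ.+ count 2=3 ls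
∩₂₃ []      []      []      = refl
∩₂₃ (a ∷ u) (b ∷ v) (c ∷ w) = trans (∣∩++∣ ⁅ b ⁆ ⁅ c ⁆ (transversal v) (transversal w))
  (trans (cong₂ ℕ._+_ (head (a Fin.≟ b) (b Fin.≟ c) (a Fin.≟ c)) (∩₂₃ u v w))
         (interchange (δ all l) (δ 2=3 l) _ _))
  where
  l = label (a Fin.≟ b) (b Fin.≟ c) (a Fin.≟ c)
  head : (d : Dec (a ≡ b)) (e : Dec (b ≡ c)) (f : Dec (a ≡ c)) → let l = label d e f in
    ∣ ⁅ b ⁆ ∩ ⁅ c ⁆ ∣ ≡ δ all l ℕ.+ δ 2=3 l
  head (yes _) (yes refl) _       = ∣⁅a⁆∩⁅a⁆∣ b
  head (yes _) (no ≢)     _       = ∣⁅a⁆∩⁅b⁆∣ ≢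
  head (no _)  (yes refl) _       = ∣⁅a⁆∩⁅a⁆∣ b
  head (no _)  (no ≢)     (yes _) = ∣⁅a⁆∩⁅b⁆∣ ≢
  head (no _)  (no ≢)     (no _)  = ∣⁅a⁆∩⁅b⁆∣ ≢

∩₁₃ : (u v w : Vec (Fin q) r) → let ls = labelling u v w in
  ∣ transversal u ∩ transversal w ∣ ≡ count all ls ℕ.+ count 1=3 ls
∩₁₃ []      []      []      = refl
∩₁₃ (a ∷ u) (b ∷ v) (c ∷ w) = trans (∣∩++∣ ⁅ a ⁆ ⁅ c ⁆ (transversal u) (transversal w))
  (trans (cong₂ ℕ._+_ (head (a Fin.≟ b) (b Fin.≟ c) (a Fin.≟ c)) (∩₁₃ u v w))
         (interchange (δ all l) (δ 1=3 l) _ _))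
  where
  l = label (a Fin.≟ b) (b Fin.≟ c) (a Fin.≟ c)
  head : (d : Dec (a ≡ b)) (e : Dec (b ≡ c)) (f : Dec (a ≡ c)) → let l = label d e f in
    ∣ ⁅ a ⁆ ∩ ⁅ c ⁆ ∣ ≡ δ all l ℕ.+ δ 1=3 l
  head (yes refl) (yes refl) _          = ∣⁅a⁆∩⁅a⁆∣ a
  head (yes refl) (no ≢)     _          = ∣⁅a⁆∩⁅b⁆∣ ≢
  head (no ≢)     (yes refl) _          = ∣⁅a⁆∩⁅b⁆∣ ≢
  head (no _)     (no _)     (yes refl) = ∣⁅a⁆∩⁅a⁆∣ a
  head (no _)     (no _)     (no ≢)     = ∣⁅a⁆∩⁅b⁆∣ ≢

∩₁₂₃ : (u v w : Vec (Fin q) r) →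
  count all (labelling u v w) ℕ.≤ ∣ transversal u ∩ (transversal v ∩ transversal w) ∣
∩₁₂₃ []      []      []      = z≤n
∩₁₂₃ (a ∷ u) (b ∷ v) (c ∷ w) = subst (δ all l ℕ.+ _ ℕ.≤_)
  (sym (trans (cong (λ X → ∣ (⁅ a ⁆ ++ transversal u) ∩ X ∣)
                (Vec.zipWith-++ _∧_ ⁅ b ⁆ (transversal v) ⁅ c ⁆ (transversal w)))
       (∣∩++∣ ⁅ a ⁆ (⁅ b ⁆ ∩ ⁅ c ⁆) (transversal u) (transversal v ∩ transversal w))))
  (ℕ.+-mono-≤ (head (a Fin.≟ b) (b Fin.≟ c) (a Fin.≟ c)) (∩₁₂₃ u v w))
  where
  l = label (a Fin.≟ b) (b Fin.≟ c) (a Fin.≟ c)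
  head : (d : Dec (a ≡ b)) (e : Dec (b ≡ c)) (f : Dec (a ≡ c)) →
    δ all (label d e f) ℕ.≤ ∣ ⁅ a ⁆ ∩ (⁅ b ⁆ ∩ ⁅ c ⁆) ∣
  head (yes refl) (yes refl) _ = ℕ.≤-reflexive
    (sym (trans (cong (λ X → ∣ ⁅ a ⁆ ∩ X ∣) (Subset.∩-idem ⁅ a ⁆)) (∣⁅a⁆∩⁅a⁆∣ a)))
  head (yes _)    (no _)  _       = z≤n
  head (no _)     (yes _) _       = z≤n
  head (no _)     (no _)  (yes _) = z≤n
  head (no _)     (no _)  (no _)  = z≤n

place : Fin r → Subset q → Subset (r ℕ.* q)
place {suc r} zero    A = A ++ ⊥
place         (suc i) A = ⊥ ++ place i A

∣place∣ : (i : Fin r) (A : Subset q) → ∣ place i A ∣ ≡ ∣ A ∣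
∣place∣ {suc r} {q} zero    A = trans (∣++∣ A ⊥)
  (trans (cong (∣ A ∣ ℕ.+_) (Subset.∣⊥∣≡0 (r ℕ.* q))) (ℕ.+-identityʳ _))
∣place∣ {q = q}     (suc i) A = trans (∣++∣ (⊥ {q}) (place i A)) (cong₂ ℕ._+_ (Subset.∣⊥∣≡0 q) (∣place∣ i A))

∣place∩place∣ : (i : Fin r) (A B : Subset q) → ∣ place i A ∩ place i B ∣ ≡ ∣ A ∩ B ∣
∣place∩place∣ {suc r} {q} zero    A B = trans (∣∩++∣ A B ⊥ ⊥)
  (trans (cong (∣ A ∩ B ∣ ℕ.+_) (∣⊥∩∣≡0 {r ℕ.* q} ⊥)) (ℕ.+-identityʳ _))
∣place∩place∣ {q = q}     (suc i) A B =
  trans (∣∩++∣ (⊥ {q}) ⊥ (place i A) (place i B)) (cong₂ ℕ._+_ (∣⊥∩∣≡0 {q} ⊥) (∣place∩place∣ i A B))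

∣⋃³-place∣ : (i : Fin r) (A B Z : Subset q) → ∣ ⋃³ (place i A) (place i B) (place i Z) ∣ ≡ ∣ ⋃³ A B Z ∣
∣⋃³-place∣ {suc r} {q} zero    A B Z = trans (∣⋃³-++∣ A B Z ⊥ ⊥ ⊥)
  (trans (cong (∣ ⋃³ A B Z ∣ ℕ.+_) (∣⋃³⊥∣≡0 (r ℕ.* q))) (ℕ.+-identityʳ _))
∣⋃³-place∣ {q = q}     (suc i) A B Z = trans (∣⋃³-++∣ (⊥ {q}) ⊥ ⊥ (place i A) (place i B) (place i Z))
  (cong₂ ℕ._+_ (∣⋃³⊥∣≡0 q) (∣⋃³-place∣ i A B Z))

places-disjoint : {i j : Fin r} (A B : Subset q) → i ≢ j → ∣ place i A ∩ place j B ∣ ≡ 0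
places-disjoint {i = zero}  {zero}  A B i≢j = contradiction refl i≢j
places-disjoint {i = zero}  {suc j} A B i≢j =
  trans (∣∩++∣ A ⊥ ⊥ (place j B)) (cong₂ ℕ._+_ (∣∩⊥∣≡0 A) (∣⊥∩∣≡0 (place j B)))
places-disjoint {i = suc i} {zero}  A B i≢j =
  trans (∣∩++∣ ⊥ B (place i A) ⊥) (cong₂ ℕ._+_ (∣⊥∩∣≡0 B) (∣∩⊥∣≡0 (place i A)))
places-disjoint {q = q} {i = suc i} {suc j} A B i≢j = trans (∣∩++∣ (⊥ {q}) ⊥ (place i A) (place j B))
  (cong₂ ℕ._+_ (∣⊥∩∣≡0 {q} ⊥) (places-disjoint A B (i≢j ∘ cong suc)))

∣transversal∩place∣≤1 : (w : Vec (Fin q) r) (i : Fin r) (A : Subset q) → ∣ transversal w ∩ place i A ∣ ℕ.≤ 1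
∣transversal∩place∣≤1 {q} (a ∷ w) zero A = begin
  ∣ (⁅ a ⁆ ++ transversal w) ∩ (A ++ ⊥) ∣      ≡⟨ ∣∩++∣ ⁅ a ⁆ A (transversal w) ⊥ ⟩
  ∣ ⁅ a ⁆ ∩ A ∣ ℕ.+ ∣ transversal w ∩ ⊥ ∣      ≡⟨ cong (∣ ⁅ a ⁆ ∩ A ∣ ℕ.+_) (∣∩⊥∣≡0 (transversal w)) ⟩
  ∣ ⁅ a ⁆ ∩ A ∣ ℕ.+ 0                          ≡⟨ ℕ.+-identityʳ _ ⟩
  ∣ ⁅ a ⁆ ∩ A ∣                                ≤⟨ Subset.∣p∩q∣≤∣p∣ ⁅ a ⁆ A ⟩
  ∣ ⁅ a ⁆ ∣                                    ≡⟨ Subset.∣⁅x⁆∣≡1 a ⟩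
  1                                            ∎
  where open ℕ.≤-Reasoning
∣transversal∩place∣≤1 (a ∷ w) (suc i) A = begin
  ∣ (⁅ a ⁆ ++ transversal w) ∩ (⊥ ++ place i A) ∣    ≡⟨ ∣∩++∣ ⁅ a ⁆ ⊥ (transversal w) (place i A) ⟩
  ∣ ⁅ a ⁆ ∩ ⊥ ∣ ℕ.+ ∣ transversal w ∩ place i A ∣    ≡⟨ cong (ℕ._+ _) (∣∩⊥∣≡0 ⁅ a ⁆) ⟩
  ∣ transversal w ∩ place i A ∣                      ≤⟨ ∣transversal∩place∣≤1 w i A ⟩
  1                                                  ∎
  where open ℕ.≤-Reasoning

-- Transversals given by linear forms modulo m.

infixl 6 _⊖_
_⊖_ : ∀ {N} → Vec ℤ N → Vec ℤ N → Vec ℤ N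
u ⊖ v = u ⊕ (ℤ.- 1ℤ) · v

dot-⊖ : ∀ {N} (v x y : Vec ℤ N) → dot v (x ⊖ y) ≡ dot v x ℤ.- dot v y
dot-⊖ v x y = trans (dot-⊕ʳ v x ((ℤ.- 1ℤ) · y))
  (cong (λ t → dot v x ℤ.+ t) (trans (dot-·ʳ (ℤ.- 1ℤ) v y) (ℤ.-1*i≡-i (dot v y))))

module Codewords (m : ℕ) .{{_ : ℕ.NonZero m}} (m≤q : m ℕ.≤ q) (V : Vec (Vec ℤ k) r) where

  residue : ℤ → Fin q
  residue a = inject≤ (fromℕ< (ℤ.n%ℕd<d a m)) m≤q

  residue-≡ : ∀ a b → residue a ≡ residue b → + m ∣ a ℤ.- b
  residue-≡ a b eq = divides (a ℤ./ℕ m ℤ.- b ℤ./ℕ m) (begin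
    a ℤ.- b
      ≡⟨ cong₂ ℤ._-_ (ℤ.a≡a%ℕn+[a/ℕn]*n a m) (ℤ.a≡a%ℕn+[a/ℕn]*n b m) ⟩
    (+ (a ℤ.%ℕ m) ℤ.+ (a ℤ./ℕ m) ℤ.* + m) ℤ.- (+ (b ℤ.%ℕ m) ℤ.+ (b ℤ./ℕ m) ℤ.* + m)
      ≡⟨ cong (λ x → (+ x ℤ.+ (a ℤ./ℕ m) ℤ.* + m) ℤ.- (+ (b ℤ.%ℕ m) ℤ.+ (b ℤ./ℕ m) ℤ.* + m)) same ⟩
    (+ (b ℤ.%ℕ m) ℤ.+ (a ℤ./ℕ m) ℤ.* + m) ℤ.- (+ (b ℤ.%ℕ m) ℤ.+ (b ℤ./ℕ m) ℤ.* + m)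
      ≡⟨ cancel (+ (b ℤ.%ℕ m)) (a ℤ./ℕ m) (b ℤ./ℕ m) (+ m) ⟩
    (a ℤ./ℕ m ℤ.- b ℤ./ℕ m) ℤ.* + m ∎)
    where
    open ≡-Reasoning
    same : a ℤ.%ℕ m ≡ b ℤ.%ℕ m
    same = Fin.fromℕ<-injective _ _ (ℤ.n%ℕd<d a m) (ℤ.n%ℕd<d b m) (Fin.inject≤-injective m≤q m≤q _ _ eq)
    cancel : ∀ x a b m → (x ℤ.+ a ℤ.* m) ℤ.- (x ℤ.+ b ℤ.* m) ≡ (a ℤ.- b) ℤ.* m
    cancel = ℤRing.solve-∀

  word : ∀ {r} → Vec (Vec ℤ k) r → Vec ℤ k → Vec (Fin q) r
  word V x = Vec.map (λ v → residue (dot v x)) V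

  labelling-agree : ∀ {r} (V : Vec (Vec ℤ k) r) x y z i →
    Agree (+ m) (lookup (labelling (word V x) (word V y) (word V z)) i)
      (dot (lookup V i) (x ⊖ y)) (dot (lookup V i) (y ⊖ z))
  labelling-agree (v ∷ V) x y z (suc i) = labelling-agree V x y z i
  labelling-agree (v ∷ V) x y z zero    =
    subst₂ (Agree (+ m) (label (a Fin.≟ b) (b Fin.≟ c) (a Fin.≟ c))) (sym (dot-⊖ v x y)) (sym (dot-⊖ v y z))
      (head (a Fin.≟ b) (b Fin.≟ c) (a Fin.≟ c))
    where
    a = residue (dot v x)
    b = residue (dot v y)
    c = residue (dot v z)
    telescope : ∀ x y z → x ℤ.- z ≡ (x ℤ.- y) ℤ.+ (y ℤ.- z)
    telescope = ℤRing.solve-∀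
    head : (d : Dec (a ≡ b)) (e : Dec (b ≡ c)) (f : Dec (a ≡ c)) →
      Agree (+ m) (label d e f) (dot v x ℤ.- dot v y) (dot v y ℤ.- dot v z)
    head (yes d) (yes e) _       = residue-≡ (dot v x) (dot v y) d , residue-≡ (dot v y) (dot v z) e
    head (yes d) (no _)  _       = residue-≡ (dot v x) (dot v y) d
    head (no _)  (yes e) _       = residue-≡ (dot v y) (dot v z) e
    head (no _)  (no _)  (yes f) = subst (+ m ∣_) (telescope (dot v x) (dot v y) (dot v z)) (residue-≡ (dot v x) (dot v z) f)
    head (no _)  (no _)  (no _)  = tt

  module _ (inj : ∀ ls → Rich k ls → InjectiveMod (+ m) (system V ls)) where

    -- The differences x - y and y - z solve the system of the labelling that their own codewords
    -- produce, and genericity makes that system injective modulo `m`.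
    rich⇒congruent : ∀ x y z → Rich k (labelling (word V x) (word V y) (word V z)) →
      VAll.All (+ m ∣_) (x ⊖ y)
    rich⇒congruent x y z rich = let ls = labelling (word V x) (word V y) (word V z) in VAll.++ˡ⁻ (x ⊖ y)
      (inj ls rich ((x ⊖ y) ++ (y ⊖ z)) (agree⇒system (+ m) (x ⊖ y) (y ⊖ z) V ls (labelling-agree V x y z)))

    coefficients : Fin (m ℕ.^ k) → Vec ℤ k
    coefficients t = tabulate λ j → + toℕ (finToFun {m} {k} t j)

    congruent⇒≡ : ∀ {s t} → VAll.All (+ m ∣_) (coefficients s ⊖ coefficients t) → s ≡ t
    congruent⇒≡ {s} {t} cong-m = begin
      s                       ≡⟨ Fin.funToFin-finToFin {k} {m} s ⟨
      funToFin (finToFun {m} {k} s) ≡⟨ funToFin-cong (λ j → same j) ⟩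
      funToFin (finToFun {m} {k} t) ≡⟨ Fin.funToFin-finToFin {k} {m} t ⟩
      t ∎
      where
      open ≡-Reasoning
      funToFin-cong : ∀ {l} {f g : Fin l → Fin m} → (∀ j → f j ≡ g j) → funToFin f ≡ funToFin g
      funToFin-cong {zero}  eq = refl
      funToFin-cong {suc l} eq = cong₂ Fin.combine (eq zero) (funToFin-cong (eq ∘ suc))
      ∣-small : (a b : Fin m) → + m ∣ + toℕ a ℤ.- + toℕ b → a ≡ b
      ∣-small a b d = Fin.toℕ-injective (ℤ.+-injective (ℤ.i-j≡0⇒i≡j (+ toℕ a) (+ toℕ b)
        (ℤ.∣i∣≡0⇒i≡0 (small (ℤ∣.∣⇒∣ᵤ d)
          (ℕ.≤-<-trans (subst (λ x → ℤ.∣ x ∣ ℕ.≤ toℕ a ℕ.⊔ toℕ b) (sym (ℤ.m-n≡m⊖n (toℕ a) (toℕ b)))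
                          (ℤ.∣m⊝n∣≤m⊔n (toℕ a) (toℕ b)))
                       (ℕ.⊔-lub (Fin.toℕ<n a) (Fin.toℕ<n b)))))))
        where
        small : ∀ {x} → m ℕ.∣ x → x ℕ.< m → x ≡ 0
        small {zero}  _ _  = refl
        small {suc x} d lt = contradiction (ℕ.≤-trans lt (ℕ.∣⇒≤ d)) (ℕ.<-irrefl refl)
      same : ∀ j → finToFun {m} {k} s j ≡ finToFun {m} {k} t j
      same j = ∣-small _ _ (subst (+ m ∣_) eq (VAll.lookup⁺ cong-m j))
        where
        eq : lookup (coefficients s ⊖ coefficients t) j ≡ + toℕ (finToFun {m} {k} s j) ℤ.- + toℕ (finToFun {m} {k} t j)
        eq = trans (Vec.lookup-zipWith ℤ._+_ j (coefficients s) _) (cong₂ ℤ._+_ (Vec.lookup∘tabulate _ j)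
          (trans (Vec.lookup-map j _ (coefficients t)) (trans (cong ((ℤ.- 1ℤ) ℤ.*_) (Vec.lookup∘tabulate _ j))
            (ℤ.-1*i≡-i _))))

    codeword : Fin (m ℕ.^ k) → Vec (Fin q) r
    codeword t = word V (coefficients t)

    -- The degenerate triple (s, t, t): a position is labelled `all` where the codewords agree and
    -- `2=3` elsewhere, so k agreements alone satisfy all four inequalities.
    codeword-pair : ∀ {s t} → s ≢ t → ∣ transversal (codeword s) ∩ transversal (codeword t) ∣ ℕ.< k
    codeword-pair {s} {t} s≢t with k ℕ.≤? ∣ transversal (codeword s) ∩ transversal (codeword t) ∣
    ... | no  lt = ℕ.≰⇒> lt
    ... | yes le = contradiction (congruent⇒≡ (rich⇒congruent (coefficients s) (coefficients t) (coefficients t) rich)) s≢t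
      where
      u = codeword s
      v = codeword t
      ls = labelling u v v
      no-1=2 : ∀ {r} (u v : Vec (Fin q) r) → count 1=2 (labelling u v v) ≡ 0
      no-1=2 []      []      = refl
      no-1=2 (a ∷ u) (b ∷ v) = cong₂ ℕ._+_ (head (a Fin.≟ b) (b Fin.≟ b) (a Fin.≟ b)) (no-1=2 u v)
        where
        head : (d : Dec (a ≡ b)) (e : Dec (b ≡ b)) (f : Dec (a ≡ b)) → δ 1=2 (label d e f) ≡ 0
        head (yes _) (yes _) _       = refl
        head (yes _) (no ≢)  _       = contradiction refl ≢
        head (no _)  (yes _) _       = refl
        head (no _)  (no _)  (yes _) = refl
        head (no _)  (no _)  (no _)  = refl
      k≤all : k ℕ.≤ count all ls
      k≤all = subst (k ℕ.≤_) (trans (∩₁₂ u v v) (trans (cong (count all ls ℕ.+_) (no-1=2 u v)) (ℕ.+-identityʳ _))) le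
      rich : Rich k ls
      rich = ample (ℕ.≤-trans (ℕ.*-monoʳ-≤ 2 k≤all) (ℕ.m≤m+n _ _)) (ℕ.≤-trans k≤all (ℕ.m≤m+n _ _))
        (ℕ.≤-trans k≤all (ℕ.m≤m+n _ _)) (ℕ.≤-trans k≤all (ℕ.m≤m+n _ _))

    -- By inclusion and exclusion, too small a union gives `total`. Each other inequality arises by
    -- subtracting from `total` one pairwise intersection, which has fewer than k elements by
    -- `codeword-pair`.
    codeword-triple : ∀ {s t p} → s ≢ t → s ≢ p → t ≢ p → 3 ℕ.* r ℕ.<
      ∣ ⋃³ (transversal (codeword s)) (transversal (codeword t)) (transversal (codeword p)) ∣ ℕ.+ 2 ℕ.* k
    codeword-triple {s} {t} {p} s≢t s≢p t≢p
      with ∣ ⋃³ (transversal (codeword s)) (transversal (codeword t)) (transversal (codeword p)) ∣ ℕ.+ 2 ℕ.* k ℕ.≤? 3 ℕ.* r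
    ... | no  gt = ℕ.≰⇒> gt
    ... | yes le = contradiction (congruent⇒≡ (rich⇒congruent (coefficients s) (coefficients t) (coefficients p) rich)) s≢t
      where
      u = codeword s
      v = codeword t
      w = codeword p
      ls = labelling u v w
      T = count all ls
      A = count 1=2 ls
      B = count 2=3 ls
      Z = count 1=3 ls
      U = ∣ ⋃³ (transversal u) (transversal v) (transversal w) ∣
      open ℕ.≤-Reasoning
      total : 2 ℕ.* k ℕ.≤ 2 ℕ.* T ℕ.+ (A ℕ.+ (B ℕ.+ Z))
      total = ℕ.+-cancelˡ-≤ (U ℕ.+ T) _ _ (begin
        U ℕ.+ T ℕ.+ 2 ℕ.* k
          ≡⟨ e₁ U T (2 ℕ.* k) ⟩
        U ℕ.+ 2 ℕ.* k ℕ.+ T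
          ≤⟨ ℕ.+-mono-≤ le (∩₁₂₃ u v w) ⟩
        3 ℕ.* r ℕ.+ ∣ transversal u ∩ (transversal v ∩ transversal w) ∣
          ≡⟨ e₂ r _ ⟩
        r ℕ.+ (r ℕ.+ (r ℕ.+ ∣ transversal u ∩ (transversal v ∩ transversal w) ∣))
          ≡⟨ cong₂ ℕ._+_ (∣transversal∣ u) (cong₂ ℕ._+_ (∣transversal∣ v) (cong (ℕ._+ ∣ transversal u ∩ (transversal v ∩ transversal w) ∣) (∣transversal∣ w))) ⟨
        ∣ transversal u ∣ ℕ.+ (∣ transversal v ∣ ℕ.+ (∣ transversal w ∣ ℕ.+ ∣ transversal u ∩ (transversal v ∩ transversal w) ∣))
          ≡⟨ inclusion-exclusion (transversal u) (transversal v) (transversal w) ⟩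
        U ℕ.+ (∣ transversal u ∩ transversal v ∣ ℕ.+ (∣ transversal u ∩ transversal w ∣ ℕ.+ ∣ transversal v ∩ transversal w ∣))
          ≡⟨ cong (U ℕ.+_) (cong₂ ℕ._+_ (∩₁₂ u v w) (cong₂ ℕ._+_ (∩₁₃ u v w) (∩₂₃ u v w))) ⟩
        U ℕ.+ ((T ℕ.+ A) ℕ.+ ((T ℕ.+ Z) ℕ.+ (T ℕ.+ B)))
          ≡⟨ e₃ U T A B Z ⟩
        U ℕ.+ T ℕ.+ (2 ℕ.* T ℕ.+ (A ℕ.+ (B ℕ.+ Z))) ∎)
        where
        e₁ : ∀ U T K → U ℕ.+ T ℕ.+ K ≡ U ℕ.+ K ℕ.+ T
        e₁ = ℕRing.solve-∀
        e₂ : ∀ r x → 3 ℕ.* r ℕ.+ x ≡ r ℕ.+ (r ℕ.+ (r ℕ.+ x))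
        e₂ = ℕRing.solve-∀
        e₃ : ∀ U T A B Z → U ℕ.+ ((T ℕ.+ A) ℕ.+ ((T ℕ.+ Z) ℕ.+ (T ℕ.+ B))) ≡
             U ℕ.+ T ℕ.+ (2 ℕ.* T ℕ.+ (A ℕ.+ (B ℕ.+ Z)))
        e₃ = ℕRing.solve-∀
      rest : ∀ {x y} → x ℕ.< k → x ℕ.+ y ≡ 2 ℕ.* T ℕ.+ (A ℕ.+ (B ℕ.+ Z)) → k ℕ.≤ y
      rest {x} {y} x<k eq = ℕ.+-cancelˡ-≤ k _ _ (begin
        k ℕ.+ k         ≡⟨ cong (k ℕ.+_) (ℕ.+-identityʳ k) ⟨
        2 ℕ.* k         ≤⟨ total ⟩
        2 ℕ.* T ℕ.+ (A ℕ.+ (B ℕ.+ Z)) ≡⟨ eq ⟨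
        x ℕ.+ y         ≤⟨ ℕ.+-monoˡ-≤ y (ℕ.<⇒≤ x<k) ⟩
        k ℕ.+ y         ∎)
      rich : Rich k ls
      rich = ample total
        (rest (subst (ℕ._< k) (∩₁₃ u v w) (codeword-pair s≢p)) (c₁ T A B Z))
        (rest (subst (ℕ._< k) (∩₂₃ u v w) (codeword-pair t≢p)) (c₂ T A B Z))
        (rest (subst (ℕ._< k) (∩₁₂ u v w) (codeword-pair s≢t)) (c₃ T A B Z))
        where
        c₁ : ∀ T A B Z → (T ℕ.+ Z) ℕ.+ (T ℕ.+ (A ℕ.+ B)) ≡ 2 ℕ.* T ℕ.+ (A ℕ.+ (B ℕ.+ Z))
        c₁ = ℕRing.solve-∀
        c₂ : ∀ T A B Z → (T ℕ.+ B) ℕ.+ (T ℕ.+ (A ℕ.+ Z)) ≡ 2 ℕ.* T ℕ.+ (A ℕ.+ (B ℕ.+ Z))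
        c₂ = ℕRing.solve-∀
        c₃ : ∀ T A B Z → (T ℕ.+ A) ℕ.+ (T ℕ.+ (B ℕ.+ Z)) ≡ 2 ℕ.* T ℕ.+ (A ℕ.+ (B ℕ.+ Z))
        c₃ = ℕRing.solve-∀

    -- All transversals form one class and the edges inside each block another. A transversal meets
    -- a block in one vertex and distinct blocks are disjoint, which is what `glue` asks for.
    extend : ∀ {N} → 2 ℕ.≤ k → GoodFamily r k q (Fin N) →
      GoodFamily r k (r ℕ.* q) (Fin (m ℕ.^ k ℕ.+ r ℕ.* N))
    extend {N} 2≤k F = reindex split split-injective
      (glue 2≤k (Maybe.≡-dec Fin._≟_) colour edge size′ cross same₂ same₃)
      where
      I = Fin (m ℕ.^ k) ⊎ (Fin r × Fin N)
      colour : I → Maybe (Fin r)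
      colour (inj₁ _)       = nothing
      colour (inj₂ (i , _)) = just i
      edge : I → Subset (r ℕ.* q)
      edge (inj₁ t)       = transversal (codeword t)
      edge (inj₂ (i , e)) = place i (member F e)
      size′ : ∀ i → ∣ edge i ∣ ≡ r
      size′ (inj₁ t)       = ∣transversal∣ (codeword t)
      size′ (inj₂ (i , e)) = trans (∣place∣ i (member F e)) (size F e)
      cross : ∀ {i j} → colour i ≢ colour j → ∣ edge i ∩ edge j ∣ ℕ.≤ 1
      cross {inj₁ _} {inj₁ _} ≢ = contradiction refl ≢
      cross {inj₁ t} {inj₂ (i , e)} _ = ∣transversal∩place∣≤1 (codeword t) i (member F e)
      cross {inj₂ (i , e)} {inj₁ t} _ = subst (ℕ._≤ 1) (cong ∣_∣ (Subset.∩-comm (transversal (codeword t)) _))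
        (∣transversal∩place∣≤1 (codeword t) i (member F e))
      cross {inj₂ (i , e)} {inj₂ (j , e′)} ≢ =
        subst (ℕ._≤ 1) (sym (places-disjoint (member F e) (member F e′) (≢ ∘ cong just))) z≤n
      same₂ : ∀ {i j} → i ≢ j → colour i ≡ colour j → ∣ edge i ∩ edge j ∣ ℕ.< k
      same₂ {inj₁ s} {inj₁ t} ≢ refl = codeword-pair (≢ ∘ cong inj₁)
      same₂ {inj₂ (i , e)} {inj₂ (.i , e′)} ≢ refl =
        subst (ℕ._< k) (sym (∣place∩place∣ i (member F e) (member F e′))) (pair F (≢ ∘ cong (inj₂ ∘ (i ,_))))
      same₃ : ∀ {i j l} → i ≢ j → i ≢ l → j ≢ l → colour i ≡ colour j → colour i ≡ colour l →
        3 ℕ.* r ℕ.< ∣ ⋃³ (edge i) (edge j) (edge l) ∣ ℕ.+ 2 ℕ.* k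
      same₃ {inj₁ s} {inj₁ t} {inj₁ p} a b c refl refl =
        codeword-triple (a ∘ cong inj₁) (b ∘ cong inj₁) (c ∘ cong inj₁)
      same₃ {inj₂ (i , e)} {inj₂ (.i , e′)} {inj₂ (.i , e″)} a b c refl refl =
        subst (λ x → 3 ℕ.* r ℕ.< x ℕ.+ 2 ℕ.* k) (sym (∣⋃³-place∣ i (member F e) (member F e′) (member F e″)))
          (triple F (a ∘ lift) (b ∘ lift) (c ∘ lift))
        where
        lift : ∀ {x y} → x ≡ y → inj₂ {A = Fin (m ℕ.^ k)} (i , x) ≡ inj₂ (i , y)
        lift = cong (inj₂ ∘ (i ,_))
      split : Fin (m ℕ.^ k ℕ.+ r ℕ.* N) → I
      split x = Sum.map₂ (Fin.remQuot {r} N) (Fin.splitAt (m ℕ.^ k) x)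
      unsplit : I → Fin (m ℕ.^ k ℕ.+ r ℕ.* N)
      unsplit y = Fin.join (m ℕ.^ k) (r ℕ.* N) (Sum.map₂ (λ { (i , e) → Fin.combine i e }) y)
      unsplit-split : ∀ x → unsplit (split x) ≡ x
      unsplit-split x = trans (cong (Fin.join (m ℕ.^ k) (r ℕ.* N)) (inner (Fin.splitAt (m ℕ.^ k) x)))
        (Fin.join-splitAt (m ℕ.^ k) (r ℕ.* N) x)
        where
        inner : ∀ y → Sum.map₂ (λ { (i , e) → Fin.combine i e }) (Sum.map₂ (Fin.remQuot {r} N) y) ≡ y
        inner (inj₁ _) = refl
        inner (inj₂ y) = cong inj₂ (Fin.combine-remQuot {r} N y)
      split-injective : ∀ {x y} → split x ≡ split y → x ≡ y
      split-injective {x} {y} eq = trans (sym (unsplit-split x)) (trans (cong unsplit eq) (unsplit-split y))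

-- The lower bound

^-distribʳ-* : ∀ k m n → (m ℕ.* n) ℕ.^ k ≡ m ℕ.^ k ℕ.* n ℕ.^ k
^-distribʳ-* zero    m n = refl
^-distribʳ-* (suc k) m n = trans (cong (m ℕ.* n ℕ.*_) (^-distribʳ-* k m n)) (lemma m n (m ℕ.^ k) (n ℕ.^ k))
  where
  lemma : ∀ m n x y → m ℕ.* n ℕ.* (x ℕ.* y) ≡ m ℕ.* x ℕ.* (n ℕ.* y)
  lemma = ℕRing.solve-∀

-- The estimate (1 + h/s)ᵏ ≤ 1 + c/s, cleared of denominators. In the induction step the term hc/s²
-- is weakened to hc/s.
power-bound : ∀ k h → ∃[ c ] ∀ s → 1 ℕ.≤ s → (s ℕ.+ h) ℕ.^ k ℕ.* s ℕ.≤ s ℕ.^ k ℕ.* (s ℕ.+ c)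
power-bound zero    h = 0 , λ s _ → ℕ.*-monoʳ-≤ 1 (ℕ.m≤m+n s 0)
power-bound (suc k) h with power-bound k h
... | c , bound = h ℕ.+ c ℕ.+ h ℕ.* c , λ s 1≤s → begin
    (s ℕ.+ h) ℕ.* (s ℕ.+ h) ℕ.^ k ℕ.* s              ≡⟨ ℕ.*-assoc (s ℕ.+ h) _ s ⟩
    (s ℕ.+ h) ℕ.* ((s ℕ.+ h) ℕ.^ k ℕ.* s)            ≤⟨ ℕ.*-monoʳ-≤ (s ℕ.+ h) (bound s 1≤s) ⟩
    (s ℕ.+ h) ℕ.* (s ℕ.^ k ℕ.* (s ℕ.+ c))            ≡⟨ e₁ s h c (s ℕ.^ k) ⟩
    s ℕ.^ k ℕ.* (s ℕ.* (s ℕ.+ (h ℕ.+ c)) ℕ.+ 1 ℕ.* (h ℕ.* c))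
      ≤⟨ ℕ.*-monoʳ-≤ (s ℕ.^ k) (ℕ.+-monoʳ-≤ (s ℕ.* (s ℕ.+ (h ℕ.+ c))) (ℕ.*-monoˡ-≤ (h ℕ.* c) 1≤s)) ⟩
    s ℕ.^ k ℕ.* (s ℕ.* (s ℕ.+ (h ℕ.+ c)) ℕ.+ s ℕ.* (h ℕ.* c))
      ≡⟨ e₂ s h c (s ℕ.^ k) ⟩
    s ℕ.* s ℕ.^ k ℕ.* (s ℕ.+ (h ℕ.+ c ℕ.+ h ℕ.* c)) ∎
  where
  open ℕ.≤-Reasoning
  e₁ : ∀ s h c x → (s ℕ.+ h) ℕ.* (x ℕ.* (s ℕ.+ c)) ≡ x ℕ.* (s ℕ.* (s ℕ.+ (h ℕ.+ c)) ℕ.+ 1 ℕ.* (h ℕ.* c))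
  e₁ = ℕRing.solve-∀
  e₂ : ∀ s h c x → x ℕ.* (s ℕ.* (s ℕ.+ (h ℕ.+ c)) ℕ.+ s ℕ.* (h ℕ.* c)) ≡ s ℕ.* x ℕ.* (s ℕ.+ (h ℕ.+ c ℕ.+ h ℕ.* c))
  e₂ = ℕRing.solve-∀

-- By `power-bound` the relative error is c/s, and M c/s is at most 1 once s > M c. The allowance of
-- 1 is what a strict inequality between integers provides.
shift-negligible : ∀ k h M → ∃[ s₀ ] ∀ s → s₀ ℕ.≤ s → M ℕ.* (s ℕ.+ h) ℕ.^ k ℕ.≤ suc M ℕ.* s ℕ.^ k
shift-negligible k h M with power-bound k h
... | c , bound = suc (M ℕ.* c) , λ { s@(suc _) s₀≤s → ℕ.*-cancelʳ-≤ _ _ s (begin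
    M ℕ.* (s ℕ.+ h) ℕ.^ k ℕ.* s          ≡⟨ ℕ.*-assoc M _ s ⟩
    M ℕ.* ((s ℕ.+ h) ℕ.^ k ℕ.* s)        ≤⟨ ℕ.*-monoʳ-≤ M (bound s (s≤s z≤n)) ⟩
    M ℕ.* (s ℕ.^ k ℕ.* (s ℕ.+ c))        ≡⟨ e₁ M (s ℕ.^ k) s c ⟩
    s ℕ.^ k ℕ.* (M ℕ.* s ℕ.+ M ℕ.* c)
      ≤⟨ ℕ.*-monoʳ-≤ (s ℕ.^ k) (ℕ.+-monoʳ-≤ (M ℕ.* s) (ℕ.<⇒≤ s₀≤s)) ⟩
    s ℕ.^ k ℕ.* (M ℕ.* s ℕ.+ s)          ≡⟨ e₂ M (s ℕ.^ k) s ⟩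
    suc M ℕ.* s ℕ.^ k ℕ.* s              ∎) }
  where
  open ℕ.≤-Reasoning
  e₁ : ∀ M x s c → M ℕ.* (x ℕ.* (s ℕ.+ c)) ≡ x ℕ.* (M ℕ.* s ℕ.+ M ℕ.* c)
  e₁ = ℕRing.solve-∀
  e₂ : ∀ M x s → x ℕ.* (M ℕ.* s ℕ.+ s) ≡ suc M ℕ.* x ℕ.* s
  e₂ = ℕRing.solve-∀

empty-family : ∀ r k n → GoodFamily r k n (Fin 0)
empty-family r k n = record
  { member = λ () ; size = λ () ; pair = λ { {()} } ; triple = λ { {()} } }

congruent-below : ∀ E q → 1 ℕ.≤ E → 1 ℕ.≤ q → ∃[ j ] 1 ℕ.+ j ℕ.* E ℕ.≤ q × suc q ℕ.≤ 1 ℕ.+ j ℕ.* E ℕ.+ E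
congruent-below E@(suc _) (suc q) _ _ = q ℕ./ E , s≤s (ℕ.m/n*n≤m q E) , s≤s (begin
  suc q                                  ≡⟨ cong suc (ℕ.m≡m%n+[m/n]*n q E) ⟩
  suc (q ℕ.% E) ℕ.+ q ℕ./ E ℕ.* E        ≤⟨ ℕ.+-monoˡ-≤ (q ℕ./ E ℕ.* E) (ℕ.m%n<n q E) ⟩
  E ℕ.+ q ℕ./ E ℕ.* E                    ≡⟨ ℕ.+-comm E _ ⟩
  q ℕ./ E ℕ.* E ℕ.+ E                    ∎)
  where open ℕ.≤-Reasoning

-- E is a common multiple of the determinants that have to be invertible modulo the block size.
abstract
  block-step : ∀ r {k} → 2 ℕ.≤ k → ∃[ E ] 1 ℕ.≤ E ×
    (∀ j {q N} → 1 ℕ.+ j ℕ.* E ℕ.≤ q → GoodFamily r k q (Fin N) →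
      GoodFamily r k (r ℕ.* q) (Fin ((1 ℕ.+ j ℕ.* E) ℕ.^ k ℕ.+ r ℕ.* N)))
  block-step r {k} 2≤k with V , E , 1≤E , inj ← generic-vectors k r =
    E , 1≤E , λ j m≤q F → Codewords.extend (1 ℕ.+ j ℕ.* E) m≤q V
      (λ ls rich → subst (λ x → InjectiveMod x (system V ls)) (modulus j E) (inj ls rich (+ j))) 2≤k F
    where
    modulus : ∀ j E → 1ℤ ℤ.+ + j ℤ.* + E ≡ + (1 ℕ.+ j ℕ.* E)
    modulus j E = trans (cong (λ x → 1ℤ ℤ.+ x) (sym (ℤ.pos-* j E))) (sym (ℤ.pos-+ 1 (j ℕ.* E)))

-- The error term K n is reproduced exactly by the r subproblems of size n / r.
dense-families : ∀ {r k} → 2 ℕ.≤ k → k ℕ.< r → ∀ P Q → P ℕ.* r ℕ.^ k ℕ.< Q ℕ.+ P ℕ.* r →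
  ∃[ K ] ∀ n → ∃[ N ] GoodFamily r k n (Fin N) × P ℕ.* n ℕ.^ k ℕ.≤ Q ℕ.* N ℕ.+ K ℕ.* n
dense-families {r@(suc r-1)} {k@(suc k-1)} 2≤k k<r P Q PR<
  with E , 1≤E , blocks ← block-step r 2≤k
  with s₀ , negligible ← shift-negligible k E (P ℕ.* r ℕ.^ k) = K , <-rec _ step
  where
  open ℕ.≤-Reasoning
  n₀ = r ℕ.* (suc s₀ ℕ.+ E)
  -- For n ≤ n₀ one has P nᵏ ≤ (P n₀ᵏ⁻¹) n, so the empty family already satisfies the claim.
  K = P ℕ.* n₀ ℕ.^ k-1
  Claim : ℕ → Set
  Claim n = ∃[ N ] GoodFamily r k n (Fin N) × P ℕ.* n ℕ.^ k ℕ.≤ Q ℕ.* N ℕ.+ K ℕ.* n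
  step : ∀ n → (∀ {n′} → n′ ℕ.< n → Claim n′) → Claim n
  step n IH with suc s₀ ℕ.+ E ℕ.≤? n ℕ./ r
  ... | no small = 0 , empty-family r k n , (begin
    P ℕ.* (n ℕ.* n ℕ.^ k-1)       ≤⟨ ℕ.*-monoʳ-≤ P (ℕ.*-monoʳ-≤ n (ℕ.^-monoˡ-≤ k-1 n≤n₀)) ⟩
    P ℕ.* (n ℕ.* n₀ ℕ.^ k-1)      ≡⟨ e P n (n₀ ℕ.^ k-1) ⟩
    K ℕ.* n                       ≤⟨ ℕ.m≤n+m _ (Q ℕ.* 0) ⟩
    Q ℕ.* 0 ℕ.+ K ℕ.* n           ∎)
    where
    e : ∀ P n x → P ℕ.* (n ℕ.* x) ≡ P ℕ.* x ℕ.* n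
    e = ℕRing.solve-∀
    n≤n₀ : n ℕ.≤ n₀
    n≤n₀ = begin
      n                            ≡⟨ ℕ.m≡m%n+[m/n]*n n r ⟩
      n ℕ.% r ℕ.+ n ℕ./ r ℕ.* r    ≤⟨ ℕ.+-monoˡ-≤ _ (ℕ.<⇒≤ (ℕ.m%n<n n r)) ⟩
      suc (n ℕ./ r) ℕ.* r          ≤⟨ ℕ.*-monoˡ-≤ r (ℕ.≰⇒> small) ⟩
      (suc s₀ ℕ.+ E) ℕ.* r         ≡⟨ ℕ.*-comm _ r ⟩
      n₀                           ∎
  ... | yes large =
    let 1≤q = ℕ.≤-trans (s≤s z≤n) large
        j , m≤q , q<m+E = congruent-below E (n ℕ./ r) 1≤E 1≤q
        N , F , bound = IH (ℕ.m/n<m n r {{ℕ.>-nonZero (0<n 1≤q)}} (ℕ.≤-trans 2≤k (ℕ.<⇒≤ k<r)))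
    in _ , pad r*q≤n (blocks j m≤q F) , estimate (1 ℕ.+ j ℕ.* E) N large m≤q q<m+E bound
    where
    r*q≤n : r ℕ.* (n ℕ./ r) ℕ.≤ n
    r*q≤n = subst (ℕ._≤ n) (ℕ.*-comm (n ℕ./ r) r) (ℕ.m/n*n≤m n r)
    0<n : 1 ℕ.≤ n ℕ./ r → 0 ℕ.< n
    0<n 1≤q = ℕ.≤-trans 1≤q (ℕ.m/n≤m n r)
    estimate : ∀ m N → suc s₀ ℕ.+ E ℕ.≤ n ℕ./ r → m ℕ.≤ n ℕ./ r → suc (n ℕ./ r) ℕ.≤ m ℕ.+ E →
      P ℕ.* (n ℕ./ r) ℕ.^ k ℕ.≤ Q ℕ.* N ℕ.+ K ℕ.* (n ℕ./ r) →
      P ℕ.* n ℕ.^ k ℕ.≤ Q ℕ.* (m ℕ.^ k ℕ.+ r ℕ.* N) ℕ.+ K ℕ.* n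
    estimate m N large m≤q q<m+E bound = begin
      P ℕ.* n ℕ.^ k                                   ≤⟨ ℕ.*-monoʳ-≤ P (ℕ.^-monoˡ-≤ k n≤) ⟩
      P ℕ.* (r ℕ.* (m ℕ.+ E)) ℕ.^ k                   ≡⟨ cong (P ℕ.*_) (^-distribʳ-* k r (m ℕ.+ E)) ⟩
      P ℕ.* (r ℕ.^ k ℕ.* (m ℕ.+ E) ℕ.^ k)             ≡⟨ ℕ.*-assoc P _ _ ⟨
      -- Replacing m + E by m costs at most one additional mᵏ. The strict hypothesis P rᵏ + 1 ≤ Q +
      -- P r pays for it in the next line.
      P ℕ.* r ℕ.^ k ℕ.* (m ℕ.+ E) ℕ.^ k               ≤⟨ negligible m s₀≤m ⟩
      suc (P ℕ.* r ℕ.^ k) ℕ.* m ℕ.^ k                 ≤⟨ ℕ.*-monoˡ-≤ (m ℕ.^ k) PR< ⟩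
      (Q ℕ.+ P ℕ.* r) ℕ.* m ℕ.^ k                     ≡⟨ e₁ Q P r (m ℕ.^ k) ⟩
      Q ℕ.* m ℕ.^ k ℕ.+ r ℕ.* (P ℕ.* m ℕ.^ k)
        ≤⟨ ℕ.+-monoʳ-≤ (Q ℕ.* m ℕ.^ k) (ℕ.*-monoʳ-≤ r (ℕ.≤-trans (ℕ.*-monoʳ-≤ P (ℕ.^-monoˡ-≤ k m≤q)) bound)) ⟩
      Q ℕ.* m ℕ.^ k ℕ.+ r ℕ.* (Q ℕ.* N ℕ.+ K ℕ.* n/r)   ≡⟨ e₂ Q (m ℕ.^ k) r N K n/r ⟩
      Q ℕ.* (m ℕ.^ k ℕ.+ r ℕ.* N) ℕ.+ K ℕ.* (r ℕ.* n/r)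
        ≤⟨ ℕ.+-monoʳ-≤ (Q ℕ.* (m ℕ.^ k ℕ.+ r ℕ.* N)) (ℕ.*-monoʳ-≤ K r*q≤n) ⟩
      Q ℕ.* (m ℕ.^ k ℕ.+ r ℕ.* N) ℕ.+ K ℕ.* n         ∎
      where
      n/r = n ℕ./ r
      e₁ : ∀ Q P r x → (Q ℕ.+ P ℕ.* r) ℕ.* x ≡ Q ℕ.* x ℕ.+ r ℕ.* (P ℕ.* x)
      e₁ = ℕRing.solve-∀
      e₂ : ∀ Q x r N K q → Q ℕ.* x ℕ.+ r ℕ.* (Q ℕ.* N ℕ.+ K ℕ.* q) ≡ Q ℕ.* (x ℕ.+ r ℕ.* N) ℕ.+ K ℕ.* (r ℕ.* q)
      e₂ = ℕRing.solve-∀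
      n≤ : n ℕ.≤ r ℕ.* (m ℕ.+ E)
      n≤ = begin
        n                            ≡⟨ ℕ.m≡m%n+[m/n]*n n r ⟩
        n ℕ.% r ℕ.+ n/r ℕ.* r          ≤⟨ ℕ.+-monoˡ-≤ _ (ℕ.<⇒≤ (ℕ.m%n<n n r)) ⟩
        suc n/r ℕ.* r                  ≤⟨ ℕ.*-monoˡ-≤ r q<m+E ⟩
        (m ℕ.+ E) ℕ.* r              ≡⟨ ℕ.*-comm _ r ⟩
        r ℕ.* (m ℕ.+ E)              ∎
      s₀≤m : s₀ ℕ.≤ m
      s₀≤m = ℕ.+-cancelʳ-≤ E _ _ (ℕ.≤-trans (ℕ.n≤1+n _) (ℕ.≤-trans large (ℕ.≤-trans (ℕ.n≤1+n _) q<m+E)))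

-- To absorb the loss K n, `dense-families` is applied to the slightly larger ratio (P(R+1) + 1) /
-- (Q(R+1)). Scaling by R + 1 widens the integer gap in the hypothesis to R + 1, while the added 1
-- costs only R. The resulting surplus nᵏ exceeds K n for n > K because k ≥ 2.
lower-count : ∀ {r k} → 2 ℕ.≤ k → k ℕ.< r → ∀ P Q → P ℕ.* r ℕ.^ k ℕ.< Q ℕ.+ P ℕ.* r →
  ∃[ n₀ ] ∀ n → n₀ ℕ.≤ n → P ℕ.* n ℕ.^ k ℕ.< Q ℕ.* f r n (3 ℕ.* r ℕ.∸ 2 ℕ.* k) 3
lower-count {r} {k} 2≤k k<r P Q PR< = suc (proj₁ dense) , bound
  where
  open ℕ.≤-Reasoning
  R = r ℕ.^ k
  e₁ : ∀ P R → (P ℕ.* suc R ℕ.+ 1) ℕ.* R ≡ P ℕ.* R ℕ.* suc R ℕ.+ R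
  e₁ = ℕRing.solve-∀
  e₂ : ∀ P Q r R → (Q ℕ.+ P ℕ.* r) ℕ.* suc R ℕ.+ r ≡ Q ℕ.* suc R ℕ.+ (P ℕ.* suc R ℕ.+ 1) ℕ.* r
  e₂ = ℕRing.solve-∀
  scaled : (P ℕ.* suc R ℕ.+ 1) ℕ.* R ℕ.< Q ℕ.* suc R ℕ.+ (P ℕ.* suc R ℕ.+ 1) ℕ.* r
  scaled = begin-strict
    (P ℕ.* suc R ℕ.+ 1) ℕ.* R                   ≡⟨ e₁ P R ⟩
    P ℕ.* R ℕ.* suc R ℕ.+ R                     <⟨ ℕ.+-monoʳ-< (P ℕ.* R ℕ.* suc R) (ℕ.n<1+n R) ⟩
    P ℕ.* R ℕ.* suc R ℕ.+ suc R                 ≡⟨ ℕ.+-comm _ (suc R) ⟩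
    suc (P ℕ.* R) ℕ.* suc R                     ≤⟨ ℕ.*-monoˡ-≤ (suc R) PR< ⟩
    (Q ℕ.+ P ℕ.* r) ℕ.* suc R                   ≤⟨ ℕ.m≤m+n _ r ⟩
    (Q ℕ.+ P ℕ.* r) ℕ.* suc R ℕ.+ r             ≡⟨ e₂ P Q r R ⟩
    Q ℕ.* suc R ℕ.+ (P ℕ.* suc R ℕ.+ 1) ℕ.* r   ∎
  dense = dense-families 2≤k k<r (P ℕ.* suc R ℕ.+ 1) (Q ℕ.* suc R) scaled
  K = proj₁ dense
  bound : ∀ n → suc K ℕ.≤ n → P ℕ.* n ℕ.^ k ℕ.< Q ℕ.* f r n (3 ℕ.* r ℕ.∸ 2 ℕ.* k) 3
  bound n K<n = let N , F , dens = proj₂ dense n in ℕ.<-≤-trans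
    (ℕ.*-cancelˡ-< (suc R) _ _ (ℕ.+-cancelʳ-< (K ℕ.* n) _ _ (begin-strict
      suc R ℕ.* (P ℕ.* n ℕ.^ k) ℕ.+ K ℕ.* n       <⟨ ℕ.+-monoʳ-< (suc R ℕ.* (P ℕ.* n ℕ.^ k)) Kn<n^k ⟩
      suc R ℕ.* (P ℕ.* n ℕ.^ k) ℕ.+ n ℕ.^ k       ≡⟨ e₃ R P (n ℕ.^ k) ⟩
      (P ℕ.* suc R ℕ.+ 1) ℕ.* n ℕ.^ k             ≤⟨ dens ⟩
      Q ℕ.* suc R ℕ.* N ℕ.+ K ℕ.* n               ≡⟨ cong (ℕ._+ K ℕ.* n) (e₄ Q R N) ⟩
      suc R ℕ.* (Q ℕ.* N) ℕ.+ K ℕ.* n             ∎)))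
    (ℕ.*-monoʳ-≤ Q (proj₂ (f-isMaximum r n (3 ℕ.* r ℕ.∸ 2 ℕ.* k) 3) (realize (ℕ.<⇒≤ k<r) F)))
    where
    e₃ : ∀ R P x → suc R ℕ.* (P ℕ.* x) ℕ.+ x ≡ (P ℕ.* suc R ℕ.+ 1) ℕ.* x
    e₃ = ℕRing.solve-∀
    e₄ : ∀ Q R N → Q ℕ.* suc R ℕ.* N ≡ suc R ℕ.* (Q ℕ.* N)
    e₄ = ℕRing.solve-∀
    instance _ = ℕ.>-nonZero (ℕ.≤-trans (s≤s z≤n) K<n)
    Kn<n^k : K ℕ.* n ℕ.< n ℕ.^ k
    Kn<n^k = begin-strict
      K ℕ.* n      <⟨ ℕ.*-monoˡ-< n K<n ⟩
      n ℕ.* n      ≡⟨ cong (n ℕ.*_) (ℕ.*-identityʳ n) ⟨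
      n ℕ.^ 2      ≤⟨ ℕ.^-monoʳ-≤ n 2≤k ⟩
      n ℕ.^ k      ∎

-- The upper bound

∑ : List X → (X → ℕ) → ℕ
∑ []       g = 0
∑ (x ∷ xs) g = g x ℕ.+ ∑ xs g

∑-cong : (xs : List X) {g h : X → ℕ} → (∀ x → g x ≡ h x) → ∑ xs g ≡ ∑ xs h
∑-cong []       eq = refl
∑-cong (x ∷ xs) eq = cong₂ ℕ._+_ (eq x) (∑-cong xs eq)

∑-mono : (xs : List X) {g h : X → ℕ} → (∀ {x} → x ∈ xs → g x ℕ.≤ h x) → ∑ xs g ℕ.≤ ∑ xs h
∑-mono []       le = z≤n
∑-mono (x ∷ xs) le = ℕ.+-mono-≤ (le (here refl)) (∑-mono xs (le ∘ there))

∑-+ : (xs : List X) (g h : X → ℕ) → ∑ xs (λ x → g x ℕ.+ h x) ≡ ∑ xs g ℕ.+ ∑ xs h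
∑-+ []       g h = refl
∑-+ (x ∷ xs) g h = trans (cong (g x ℕ.+ h x ℕ.+_) (∑-+ xs g h)) (lemma (g x) (h x) _ _)
  where
  lemma : ∀ a b c d → a ℕ.+ b ℕ.+ (c ℕ.+ d) ≡ a ℕ.+ c ℕ.+ (b ℕ.+ d)
  lemma = ℕRing.solve-∀

∑-*ˡ : ∀ (xs : List X) c (g : X → ℕ) → ∑ xs (λ x → c ℕ.* g x) ≡ c ℕ.* ∑ xs g
∑-*ˡ []       c g = sym (ℕ.*-zeroʳ c)
∑-*ˡ (x ∷ xs) c g = trans (cong (c ℕ.* g x ℕ.+_) (∑-*ˡ xs c g)) (sym (ℕ.*-distribˡ-+ c (g x) _))

∑-const : ∀ (xs : List X) c → ∑ xs (λ _ → c) ≡ length xs ℕ.* c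
∑-const []       c = refl
∑-const (x ∷ xs) c = cong (c ℕ.+_) (∑-const xs c)

∑-++ : (xs ys : List X) (g : X → ℕ) → ∑ (xs List.++ ys) g ≡ ∑ xs g ℕ.+ ∑ ys g
∑-++ []       ys g = refl
∑-++ (x ∷ xs) ys g = trans (cong (g x ℕ.+_) (∑-++ xs ys g)) (sym (ℕ.+-assoc (g x) _ _))

∑-map : (h : X → Y) (xs : List X) (g : Y → ℕ) → ∑ (map h xs) g ≡ ∑ xs (g ∘ h)
∑-map h []       g = refl
∑-map h (x ∷ xs) g = cong (g (h x) ℕ.+_) (∑-map h xs g)

∑-swap : (xs : List X) (ys : List Y) (g : X → Y → ℕ) →
  ∑ xs (λ x → ∑ ys (g x)) ≡ ∑ ys (λ y → ∑ xs (λ x → g x y))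
∑-swap []       ys g = sym (trans (∑-const ys 0) (ℕ.*-zeroʳ (length ys)))
∑-swap (x ∷ xs) ys g = trans (cong (∑ ys (g x) ℕ.+_) (∑-swap xs ys g)) (sym (∑-+ ys (g x) _))

∑-zero : (xs : List X) {g : X → ℕ} → (∀ {x} → x ∈ xs → g x ≡ 0) → ∑ xs g ≡ 0
∑-zero []       eq = refl
∑-zero (x ∷ xs) eq = cong₂ ℕ._+_ (eq (here refl)) (∑-zero xs (eq ∘ there))

∑-* : (xs : List X) (g h : X → ℕ) → ∑ xs g ℕ.* ∑ xs h ≡ ∑ xs (λ x → ∑ xs (λ y → g x ℕ.* h y))
∑-* xs g h = trans (ℕ.*-comm (∑ xs g) _) (trans (sym (∑-*ˡ xs (∑ xs h) g))
  (∑-cong xs λ x → trans (ℕ.*-comm _ (g x)) (sym (∑-*ˡ xs (g x) h))))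

module _ (_≟_ : DecidableEquality X) where
  ∑-support₁ : {xs : List X} (g : X → ℕ) (a : X) → Unique xs →
    (∀ {x} → x ∈ xs → x ≢ a → g x ≡ 0) → ∑ xs g ℕ.≤ g a
  ∑-support₁ {[]}     g a _            zeros = z≤n
  ∑-support₁ {x ∷ xs} g a (x∉ ∷ uniq) zeros with x ≟ a
  ... | yes refl = ℕ.≤-reflexive (trans (cong (g x ℕ.+_) (∑-zero xs λ y∈ →
                     zeros (there y∈) (≢-sym (All.lookup x∉ y∈)))) (ℕ.+-identityʳ (g x)))
  ... | no  x≢a = subst (ℕ._≤ g a) (cong (ℕ._+ ∑ xs g) (sym (zeros (here refl) x≢a)))
                    (∑-support₁ g a uniq (zeros ∘ there))

  ∑-support₂ : {xs : List X} (g : X → ℕ) (a b : X) → Unique xs →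
    (∀ {x} → x ∈ xs → x ≢ a → x ≢ b → g x ≡ 0) → ∑ xs g ℕ.≤ g a ℕ.+ g b
  ∑-support₂ {[]}     g a b _            zeros = z≤n
  ∑-support₂ {x ∷ xs} g a b (x∉ ∷ uniq) zeros with x ≟ a | x ≟ b
  ... | yes refl | _ = ℕ.+-monoʳ-≤ (g x) (∑-support₁ g b uniq λ y∈ →
                         zeros (there y∈) (≢-sym (All.lookup x∉ y∈)))
  ... | no _ | yes refl = subst (g x ℕ.+ ∑ xs g ℕ.≤_) (ℕ.+-comm (g x) (g a))
                            (ℕ.+-monoʳ-≤ (g x) (∑-support₁ g a uniq λ y∈ y≢a →
                              zeros (there y∈) y≢a (≢-sym (All.lookup x∉ y∈))))
  ... | no x≢a | no x≢b = subst (ℕ._≤ g a ℕ.+ g b) (cong (ℕ._+ ∑ xs g) (sym (zeros (here refl) x≢a x≢b)))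
                            (∑-support₂ g a b uniq (zeros ∘ there))

-- Counts the support of `g` by filtering. In the hypothesis on three elements, `2 ≤ 1` stands for
-- absurdity.
∑≤2 : {xs : List X} (g : X → ℕ) → Unique xs → (∀ x → g x ℕ.≤ 1) →
  (∀ {x y z} → x ∈ xs → y ∈ xs → z ∈ xs → x ≢ y → x ≢ z → y ≢ z →
    0 ℕ.< g x → 0 ℕ.< g y → 0 ℕ.< g z → 2 ℕ.≤ 1) → ∑ xs g ℕ.≤ 2
∑≤2 {xs = xs} g uniq g≤1 no-three = ℕ.≤-trans (bound xs) length≤2
  where
  positive? : Decidable (λ x → 0 ℕ.< g x)
  positive? x = 0 ℕ.<? g x
  bound : ∀ xs → ∑ xs g ℕ.≤ length (filter positive? xs)
  bound []       = z≤n
  bound (x ∷ xs) with 0 ℕ.<? g x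
  ... | yes p rewrite List.filter-accept positive? {xs = xs} p = ℕ.+-mono-≤ (g≤1 x) (bound xs)
  ... | no ¬p rewrite List.filter-reject positive? {xs = xs} ¬p | ℕ.n≤0⇒n≡0 (ℕ.≮⇒≥ ¬p) = bound xs
  length≤2 : length (filter positive? xs) ℕ.≤ 2
  length≤2 with filter positive? xs in eq | Unique.filter⁺ positive? uniq
  ... | []              | _ = z≤n
  ... | _ ∷ []          | _ = s≤s z≤n
  ... | _ ∷ _ ∷ []      | _ = s≤s (s≤s z≤n)
  ... | x ∷ y ∷ z ∷ _ | (x≢y ∷ x≢z ∷ _) ∷ (y≢z ∷ _) ∷ _ =
    contradiction (no-three (proj₁ mx) (proj₁ my) (proj₁ mz) x≢y x≢z y≢z (proj₂ mx) (proj₂ my) (proj₂ mz))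
      (ℕ.<-irrefl refl)
    where
    kept : ∀ {a} → a ∈ filter positive? xs → a ∈ xs × 0 ℕ.< g a
    kept = ∈.∈-filter⁻ positive?
    mx = kept (subst (x ∈_) (sym eq) (here refl))
    my = kept (subst (y ∈_) (sym eq) (there (here refl)))
    mz = kept (subst (z ∈_) (sym eq) (there (there (here refl))))

-- The k-subsets and their incidences.

ksets : ∀ n → ℕ → List (Subset n)
ksets n       zero    = ⊥ ∷ []
ksets zero    (suc k) = []
ksets (suc n) (suc k) = map (false ∷_) (ksets n (suc k)) List.++ map (true ∷_) (ksets n k)

∣ksets∣ : ∀ n k → All (λ T → ∣ T ∣ ≡ k) (ksets n k)
∣ksets∣ n       zero    = Subset.∣⊥∣≡0 n ∷ []
∣ksets∣ zero    (suc k) = []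
∣ksets∣ (suc n) (suc k) = All.++⁺ (All.map⁺ (∣ksets∣ n (suc k))) (All.map⁺ (All.map (cong suc) (∣ksets∣ n k)))

-- A numerical indicator, so that incidences can be summed in either order and a product of
-- incidences becomes incidence with the intersection.
[_⊆_] : Subset n → Subset n → ℕ
[ []        ⊆ []        ] = 1
[ false ∷ T ⊆ _ ∷ A     ] = [ T ⊆ A ]
[ true ∷ T  ⊆ false ∷ A ] = 0
[ true ∷ T  ⊆ true ∷ A  ] = [ T ⊆ A ]

[⊆]≤1 : (T A : Subset n) → [ T ⊆ A ] ℕ.≤ 1
[⊆]≤1 []          []          = ℕ.≤-refl
[⊆]≤1 (false ∷ T) (_ ∷ A)     = [⊆]≤1 T A
[⊆]≤1 (true ∷ T)  (false ∷ A) = z≤n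
[⊆]≤1 (true ∷ T)  (true ∷ A)  = [⊆]≤1 T A

[⊥⊆] : (A : Subset n) → [ ⊥ ⊆ A ] ≡ 1
[⊥⊆] []      = refl
[⊥⊆] (_ ∷ A) = [⊥⊆] A

[⊆⊤] : (T : Subset n) → [ T ⊆ ⊤ ] ≡ 1
[⊆⊤] []          = refl
[⊆⊤] (false ∷ T) = [⊆⊤] T
[⊆⊤] (true ∷ T)  = [⊆⊤] T

[⊆]-∩ : (T A B : Subset n) → [ T ⊆ A ] ℕ.* [ T ⊆ B ] ≡ [ T ⊆ A ∩ B ]
[⊆]-∩ []          []          []          = refl
[⊆]-∩ (false ∷ T) (_ ∷ A)     (_ ∷ B)     = [⊆]-∩ T A B
[⊆]-∩ (true ∷ T)  (false ∷ A) (_ ∷ B)     = refl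
[⊆]-∩ (true ∷ T)  (true ∷ A)  (false ∷ B) = ℕ.*-zeroʳ [ T ⊆ A ]
[⊆]-∩ (true ∷ T)  (true ∷ A)  (true ∷ B)  = [⊆]-∩ T A B

[⊆]⇒∣∣≤ : (T A : Subset n) → 0 ℕ.< [ T ⊆ A ] → ∣ T ∣ ℕ.≤ ∣ A ∣
[⊆]⇒∣∣≤ []          []          _ = z≤n
[⊆]⇒∣∣≤ (false ∷ T) (false ∷ A) p = [⊆]⇒∣∣≤ T A p
[⊆]⇒∣∣≤ (false ∷ T) (true ∷ A)  p = ℕ.m≤n⇒m≤1+n ([⊆]⇒∣∣≤ T A p)
[⊆]⇒∣∣≤ (true ∷ T)  (true ∷ A)  p = s≤s ([⊆]⇒∣∣≤ T A p)

∑ksets : ∀ k (A : Subset n) → ∑ (ksets n k) [_⊆ A ] ≡ ∣ A ∣ C k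
∑ksets         zero    A  = cong (ℕ._+ 0) ([⊥⊆] A)
∑ksets {zero}  (suc k) [] = refl
∑ksets {suc n} (suc k) (false ∷ A) = begin
  ∑ (map (false ∷_) (ksets n (suc k)) List.++ map (true ∷_) (ksets n k)) [_⊆ false ∷ A ]
    ≡⟨ ∑-++ (map (false ∷_) (ksets n (suc k))) _ _ ⟩
  ∑ (map (false ∷_) (ksets n (suc k))) [_⊆ false ∷ A ] ℕ.+ ∑ (map (true ∷_) (ksets n k)) [_⊆ false ∷ A ]
    ≡⟨ cong₂ ℕ._+_ (∑-map (false ∷_) (ksets n (suc k)) _)
                   (trans (∑-map (true ∷_) (ksets n k) _) (∑-zero (ksets n k) λ _ → refl)) ⟩
  ∑ (ksets n (suc k)) [_⊆ A ] ℕ.+ 0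
    ≡⟨ trans (ℕ.+-identityʳ _) (∑ksets (suc k) A) ⟩
  ∣ A ∣ C suc k ∎
  where open ≡-Reasoning
∑ksets {suc n} (suc k) (true ∷ A) = begin
  ∑ (map (false ∷_) (ksets n (suc k)) List.++ map (true ∷_) (ksets n k)) [_⊆ true ∷ A ]
    ≡⟨ ∑-++ (map (false ∷_) (ksets n (suc k))) _ _ ⟩
  ∑ (map (false ∷_) (ksets n (suc k))) [_⊆ true ∷ A ] ℕ.+ ∑ (map (true ∷_) (ksets n k)) [_⊆ true ∷ A ]
    ≡⟨ cong₂ ℕ._+_ (∑-map (false ∷_) (ksets n (suc k)) _) (∑-map (true ∷_) (ksets n k) _) ⟩
  ∑ (ksets n (suc k)) [_⊆ A ] ℕ.+ ∑ (ksets n k) [_⊆ A ]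
    ≡⟨ cong₂ ℕ._+_ (∑ksets (suc k) A) (∑ksets k A) ⟩
  ∣ A ∣ C suc k ℕ.+ ∣ A ∣ C k
    ≡⟨ trans (ℕ.+-comm _ (∣ A ∣ C k)) (nCk+nC[k+1]≡[n+1]C[k+1] (∣ A ∣) k) ⟩
  suc ∣ A ∣ C suc k ∎
  where open ≡-Reasoning

length-ksets : ∀ n k → length (ksets n k) ≡ n C k
length-ksets n k = begin
  length (ksets n k)             ≡⟨ ℕ.*-identityʳ _ ⟨
  length (ksets n k) ℕ.* 1       ≡⟨ ∑-const (ksets n k) 1 ⟨
  ∑ (ksets n k) (λ _ → 1)        ≡⟨ ∑-cong (ksets n k) (λ T → sym ([⊆⊤] T)) ⟩
  ∑ (ksets n k) [_⊆ ⊤ ]          ≡⟨ ∑ksets k ⊤ ⟩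
  ∣ ⊤ {n} ∣ C k                  ≡⟨ cong (_C k) (Subset.∣⊤∣≡n n) ⟩
  n C k                          ∎
  where open ≡-Reasoning

C-monoˡ : ∀ {m n} k → m ℕ.≤ n → m C k ℕ.≤ n C k
C-monoˡ {m} {n} zero    _ = ℕ.≤-refl
C-monoˡ         (suc k) z≤n = z≤n
C-monoˡ {suc m} {suc n} (suc k) (s≤s m≤n) =
  subst₂ ℕ._≤_ (nCk+nC[k+1]≡[n+1]C[k+1] m k) (nCk+nC[k+1]≡[n+1]C[k+1] n k)
    (ℕ.+-mono-≤ (C-monoˡ k m≤n) (C-monoˡ (suc k) m≤n))

nCk*k!≤n^k : ∀ n k → (n C k) ℕ.* k ! ℕ.≤ n ℕ.^ k
nCk*k!≤n^k n k with k ℕ.≤? n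
... | no  k≰n = subst (λ x → x ℕ.* k ! ℕ.≤ n ℕ.^ k) (sym (k>n⇒nCk≡0 (ℕ.≰⇒> k≰n))) z≤n
... | yes k≤n = begin
  (n C k) ℕ.* k !                            ≡⟨ cong (ℕ._* k !) (nCk≡nPk/k! k≤n) ⟩
  ((n Comb.P k) ℕ./ k !) {{k ℕ.!≢0}} ℕ.* k !      ≤⟨ ℕ.m/n*n≤m (n Comb.P k) (k !) {{k ℕ.!≢0}} ⟩
  n Comb.P k                                      ≤⟨ nPk≤n^k ⟩
  n ℕ.^ k                                    ∎
  where
  open ℕ.≤-Reasoning
  nP′k≤n^k : ∀ k → n P′ k ℕ.≤ n ℕ.^ k
  nP′k≤n^k zero    = ℕ.≤-refl
  nP′k≤n^k (suc k) = ℕ.*-mono-≤ (ℕ.m∸n≤m n k) (nP′k≤n^k k)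
  nPk≤n^k : n Comb.P k ℕ.≤ n ℕ.^ k
  nPk≤n^k with k ℕ.≤ᵇ n
  ... | true  = nP′k≤n^k k
  ... | false = z≤n

private
  _≟ˢ_ : DecidableEquality (Subset n)
  _≟ˢ_ = Vec.≡-dec Bool._≟_

-- The quadratic bound is (d - 1)(d - 2) ≥ 0, with equality at degrees 1 and 2. Double counting
-- gives |E| C(r,k) for the sum of the degrees and the sum of C(|A ∩ B|, k) over ordered pairs of
-- edges for the sum of their squares.
second-moment : (E : List (Subset n)) → All (λ A → ∣ A ∣ ≡ r) E → ∀ k →
  3 ℕ.* (length E ℕ.* (r C k)) ℕ.≤ ∑ E (λ A → ∑ E (λ B → ∣ A ∩ B ∣ C k)) ℕ.+ 2 ℕ.* (n C k)
second-moment {n} {r} E unif k = begin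
  3 ℕ.* (length E ℕ.* (r C k))
    ≡⟨ cong (3 ℕ.*_) ∑d ⟨
  3 ℕ.* ∑ Ts d
    ≡⟨ ∑-*ˡ Ts 3 d ⟨
  ∑ Ts (λ T → 3 ℕ.* d T)
    ≤⟨ ∑-mono Ts (λ {T} _ → quadratic (d T)) ⟩
  ∑ Ts (λ T → d T ℕ.* d T ℕ.+ 2)
    ≡⟨ ∑-+ Ts (λ T → d T ℕ.* d T) (λ _ → 2) ⟩
  ∑ Ts (λ T → d T ℕ.* d T) ℕ.+ ∑ Ts (λ _ → 2)
    ≡⟨ cong₂ ℕ._+_ ∑d² (trans (∑-const Ts 2) (trans (ℕ.*-comm (length Ts) 2) (cong (2 ℕ.*_) (length-ksets n k)))) ⟩
  ∑ E (λ A → ∑ E (λ B → ∣ A ∩ B ∣ C k)) ℕ.+ 2 ℕ.* (n C k) ∎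
  where
  Ts = ksets n k
  d : Subset n → ℕ
  d T = ∑ E [ T ⊆_]
  quadratic : ∀ d → 3 ℕ.* d ℕ.≤ d ℕ.* d ℕ.+ 2
  quadratic 0 = z≤n
  quadratic 1 = ℕ.≤-refl
  quadratic 2 = ℕ.≤-refl
  quadratic d@(suc (suc (suc _))) = ℕ.≤-trans (ℕ.*-monoˡ-≤ d {3} {d} (s≤s (s≤s (s≤s z≤n)))) (ℕ.m≤m+n (d ℕ.* d) 2)
  open ℕ.≤-Reasoning
  sizes : ∀ {E : List (Subset n)} → All (λ A → ∣ A ∣ ≡ r) E → ∑ E (λ A → ∣ A ∣ C k) ≡ length E ℕ.* (r C k)
  sizes []          = refl
  sizes (eq ∷ unif) = cong₂ ℕ._+_ (cong (_C k) eq) (sizes unif)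
  ∑d : ∑ Ts d ≡ length E ℕ.* (r C k)
  ∑d = trans (∑-swap Ts E [_⊆_]) (trans (∑-cong E (∑ksets k)) (sizes unif))
  ∑d² : ∑ Ts (λ T → d T ℕ.* d T) ≡ ∑ E (λ A → ∑ E (λ B → ∣ A ∩ B ∣ C k))
  ∑d² = begin-equality
    ∑ Ts (λ T → d T ℕ.* d T)
      ≡⟨ ∑-cong Ts (λ T → trans (∑-* E [ T ⊆_] [ T ⊆_])
           (∑-cong E λ A → ∑-cong E λ B → [⊆]-∩ T A B)) ⟩
    ∑ Ts (λ T → ∑ E (λ A → ∑ E (λ B → [ T ⊆ A ∩ B ])))
      ≡⟨ ∑-swap Ts E _ ⟩
    ∑ E (λ A → ∑ Ts (λ T → ∑ E (λ B → [ T ⊆ A ∩ B ])))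
      ≡⟨ ∑-cong E (λ A → trans (∑-swap Ts E _) (∑-cong E λ B → ∑ksets k (A ∩ B))) ⟩
    ∑ E (λ A → ∑ E (λ B → ∣ A ∩ B ∣ C k)) ∎

-- Intersections of edges in a free hypergraph.

module _ {r n k-1 : ℕ} (k<r : suc k-1 ℕ.< r)
         (G : Hypergraph r n) (free : Free (3 ℕ.* r ℕ.∸ 2 ℕ.* suc k-1) 3 G) where
  private
    K = suc k-1
    E = edges G
    c = r C K

    ∣edge∣ : ∀ {A} → A ∈ E → ∣ A ∣ ≡ r
    ∣edge∣ = All.lookup (uniform G)

  -- Since |A ∩ B ∩ X| ≤ |B ∩ X|, the union has at most 3r - |A ∩ B| - |A ∩ X| vertices. The lemma
  -- is used with intersections of sizes at least K and K in `row-bound`, and at least K + 1 and K -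
  -- 1 in `clash`.
  few-common : ∀ {A B X} → A ∈ E → B ∈ E → X ∈ E → A ≢ B → A ≢ X → B ≢ X →
    ∣ A ∩ B ∣ ℕ.+ ∣ A ∩ X ∣ ℕ.< 2 ℕ.* K
  few-common {A} {B} {X} A∈ B∈ X∈ A≢B A≢X B≢X with 2 ℕ.* K ℕ.≤? ∣ A ∩ B ∣ ℕ.+ ∣ A ∩ X ∣
  ... | no  lt = ℕ.≰⇒> lt
  ... | yes le = contradiction (ℕ.<-≤-trans
      (free (A ∷ B ∷ X ∷ []) ((A≢B ∷ A≢X ∷ []) ∷ (B≢X ∷ []) ∷ [] ∷ []) sub refl) small)
      (ℕ.<-irrefl refl)
    where
    sub : ∀ {Y} → Y ∈ A ∷ B ∷ X ∷ [] → Y ∈ E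
    sub (here refl)                 = A∈
    sub (there (here refl))         = B∈
    sub (there (there (here refl))) = X∈
    U = ∣ ⋃³ A B X ∣
    open ℕ.≤-Reasoning
    small : U ℕ.≤ 3 ℕ.* r ℕ.∸ 2 ℕ.* K
    small = ℕ.m+n≤o⇒m≤o∸n U (ℕ.+-cancelʳ-≤ (∣ B ∩ X ∣) _ _ (begin
      U ℕ.+ 2 ℕ.* K ℕ.+ ∣ B ∩ X ∣
        ≤⟨ ℕ.+-monoˡ-≤ (∣ B ∩ X ∣) (ℕ.+-monoʳ-≤ U le) ⟩
      U ℕ.+ (∣ A ∩ B ∣ ℕ.+ ∣ A ∩ X ∣) ℕ.+ ∣ B ∩ X ∣
        ≡⟨ e₁ U (∣ A ∩ B ∣) (∣ A ∩ X ∣) (∣ B ∩ X ∣) ⟩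
      U ℕ.+ (∣ A ∩ B ∣ ℕ.+ (∣ A ∩ X ∣ ℕ.+ ∣ B ∩ X ∣))
        ≡⟨ inclusion-exclusion A B X ⟨
      ∣ A ∣ ℕ.+ (∣ B ∣ ℕ.+ (∣ X ∣ ℕ.+ ∣ A ∩ (B ∩ X) ∣))
        ≤⟨ ℕ.+-monoʳ-≤ (∣ A ∣) (ℕ.+-monoʳ-≤ (∣ B ∣) (ℕ.+-monoʳ-≤ (∣ X ∣) (Subset.∣p∩q∣≤∣q∣ A (B ∩ X)))) ⟩
      ∣ A ∣ ℕ.+ (∣ B ∣ ℕ.+ (∣ X ∣ ℕ.+ ∣ B ∩ X ∣))
        ≡⟨ cong₂ ℕ._+_ (∣edge∣ A∈) (cong₂ ℕ._+_ (∣edge∣ B∈) (cong (ℕ._+ ∣ B ∩ X ∣) (∣edge∣ X∈))) ⟩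
      r ℕ.+ (r ℕ.+ (r ℕ.+ ∣ B ∩ X ∣))
        ≡⟨ e₂ r (∣ B ∩ X ∣) ⟩
      3 ℕ.* r ℕ.+ ∣ B ∩ X ∣ ∎))
      where
      e₁ : ∀ U a b c → U ℕ.+ (a ℕ.+ b) ℕ.+ c ≡ U ℕ.+ (a ℕ.+ (b ℕ.+ c))
      e₁ = ℕRing.solve-∀
      e₂ : ∀ r x → r ℕ.+ (r ℕ.+ (r ℕ.+ x)) ≡ 3 ℕ.* r ℕ.+ x
      e₂ = ℕRing.solve-∀

  Partner : ℕ → Subset n → Subset n → Set
  Partner s A B = A ≢ B × s ℕ.≤ ∣ A ∩ B ∣

  partner? : ∀ s A → Decidable (Partner s A)
  partner? s A B = ¬? (A ≟ˢ B) ×-dec s ℕ.≤? ∣ A ∩ B ∣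

  -- Marks the exceptional edges, which may share more than one K-set with another edge. `row-bound`
  -- charges each of them a full C(r,K), and `∑excess` shows that they are few.
  excess : Subset n → ℕ
  excess A with Any.any? (partner? (suc K) A) E
  ... | yes _ = 1
  ... | no  _ = 0

  excess≤1 : ∀ A → excess A ℕ.≤ 1
  excess≤1 A with Any.any? (partner? (suc K) A) E
  ... | yes _ = ℕ.≤-refl
  ... | no  _ = z≤n

  excess-partner : ∀ A → 0 ℕ.< excess A → ∃[ B ] B ∈ E × Partner (suc K) A B
  excess-partner A p with Any.any? (partner? (suc K) A) E
  ... | yes any = find any

  partner-excess : ∀ {A B} → B ∈ E → Partner (suc K) A B → excess A ≡ 1
  partner-excess {A} B∈ p with Any.any? (partner? (suc K) A) E
  ... | yes _  = refl
  ... | no  ¬p = contradiction (lose B∈ p) ¬p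

  -- `A` itself contributes c. By `few-common` at most one other edge meets it in K or more
  -- vertices: an intersection of exactly K vertices contributes 1, a larger one at most c, charged
  -- to `excess`.
  row-bound : ∀ {A} → A ∈ E → ∑ E (λ B → ∣ A ∩ B ∣ C K) ℕ.≤ c ℕ.+ (1 ℕ.+ c ℕ.* excess A)
  row-bound {A} A∈ with Any.any? (partner? K A) E
  ... | no ¬any = ℕ.≤-trans (∑-support₁ _≟ˢ_ _ A (unique G) λ {B} B∈ B≢A →
        k>n⇒nCk≡0 (ℕ.≰⇒> λ le → ¬any (lose B∈ (≢-sym B≢A , le))))
        (ℕ.≤-trans (ℕ.≤-reflexive self) (ℕ.m≤m+n c _))
    where
    self : ∣ A ∩ A ∣ C K ≡ c
    self = cong (_C K) (trans (cong ∣_∣ (Subset.∩-idem A)) (∣edge∣ A∈))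
  ... | yes any with find any
  ... | P , P∈ , A≢P , k≤ = ℕ.≤-trans (∑-support₂ _≟ˢ_ _ A P (unique G) λ {B} B∈ B≢A B≢P →
        k>n⇒nCk≡0 (ℕ.+-cancelˡ-< K _ _ (ℕ.≤-<-trans (ℕ.+-monoˡ-≤ (∣ A ∩ B ∣) k≤)
          (subst (∣ A ∩ P ∣ ℕ.+ ∣ A ∩ B ∣ ℕ.<_) (cong (K ℕ.+_) (ℕ.+-identityʳ K))
            (few-common A∈ P∈ B∈ A≢P (≢-sym B≢A) (≢-sym B≢P))))))
        (ℕ.+-mono-≤ (ℕ.≤-reflexive self) other)
    where
    self : ∣ A ∩ A ∣ C K ≡ c
    self = cong (_C K) (trans (cong ∣_∣ (Subset.∩-idem A)) (∣edge∣ A∈))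
    other : ∣ A ∩ P ∣ C K ℕ.≤ 1 ℕ.+ c ℕ.* excess A
    other with suc K ℕ.≤? ∣ A ∩ P ∣
    ... | yes big = begin
      ∣ A ∩ P ∣ C K          ≤⟨ C-monoˡ K (subst (∣ A ∩ P ∣ ℕ.≤_) (∣edge∣ A∈) (Subset.∣p∩q∣≤∣p∣ A P)) ⟩
      c                      ≡⟨ ℕ.*-identityʳ c ⟨
      c ℕ.* 1                ≡⟨ cong (c ℕ.*_) (partner-excess P∈ (A≢P , big)) ⟨
      c ℕ.* excess A         ≤⟨ ℕ.n≤1+n _ ⟩
      1 ℕ.+ c ℕ.* excess A   ∎
      where open ℕ.≤-Reasoning
    ... | no small = ℕ.≤-trans (ℕ.≤-reflexive
      (trans (cong (_C K) (ℕ.≤-antisym (ℕ.s≤s⁻¹ (ℕ.≰⇒> small)) k≤)) (nCn≡1 K))) (ℕ.m≤m+n 1 _)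

  -- A (k-1)-set lies in at most two edges having a partner that they meet in more than K vertices.
  ∑excess : ∑ E excess ℕ.≤ 2 ℕ.* (n C k-1)
  ∑excess = begin
    ∑ E excess
      ≤⟨ ∑-mono E (λ {A} A∈ → ℕ.≤-trans (ℕ.≤-reflexive (sym (ℕ.*-identityʳ (excess A))))
           (ℕ.*-monoʳ-≤ (excess A) (1≤∣A∣C[k-1] A∈))) ⟩
    ∑ E (λ A → excess A ℕ.* (∣ A ∣ C k-1))
      ≡⟨ ∑-cong E (λ A → trans (cong (excess A ℕ.*_) (sym (∑ksets k-1 A))) (sym (∑-*ˡ Ts (excess A) [_⊆ A ]))) ⟩
    ∑ E (λ A → ∑ Ts (λ T → excess A ℕ.* [ T ⊆ A ]))
      ≡⟨ ∑-swap E Ts _ ⟩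
    ∑ Ts (λ T → ∑ E (λ A → excess A ℕ.* [ T ⊆ A ]))
      ≤⟨ ∑-mono Ts at-most-two ⟩
    ∑ Ts (λ _ → 2)
      ≡⟨ trans (∑-const Ts 2) (trans (ℕ.*-comm (length Ts) 2) (cong (2 ℕ.*_) (length-ksets n k-1))) ⟩
    2 ℕ.* (n C k-1) ∎
    where
    open ℕ.≤-Reasoning
    Ts = ksets n k-1
    1≤∣A∣C[k-1] : ∀ {A} → A ∈ E → 1 ℕ.≤ ∣ A ∣ C k-1
    1≤∣A∣C[k-1] {A} A∈ = subst (ℕ._≤ ∣ A ∣ C k-1) (nCn≡1 k-1)
      (C-monoˡ k-1 (subst (k-1 ℕ.≤_) (sym (∣edge∣ A∈)) (ℕ.≤-trans (ℕ.n≤1+n _) (ℕ.<⇒≤ k<r))))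
    factorˡ : ∀ x {y} → 0 ℕ.< x ℕ.* y → 0 ℕ.< x
    factorˡ (suc x) _ = s≤s z≤n
    factorʳ : ∀ x {y} → 0 ℕ.< x ℕ.* y → 0 ℕ.< y
    factorʳ x {zero}  p = subst (0 ℕ.<_) (ℕ.*-zeroʳ x) p
    factorʳ x {suc y} _ = s≤s z≤n
    at-most-two : ∀ {T} → T ∈ Ts → ∑ E (λ A → excess A ℕ.* [ T ⊆ A ]) ℕ.≤ 2
    at-most-two {T} T∈ = ∑≤2 _ (unique G) (λ A → ℕ.*-mono-≤ (excess≤1 A) ([⊆]≤1 T A)) three
      where
      meet : ∀ A B → 0 ℕ.< [ T ⊆ A ] → 0 ℕ.< [ T ⊆ B ] → k-1 ℕ.≤ ∣ A ∩ B ∣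
      meet A B a b = subst (ℕ._≤ ∣ A ∩ B ∣) (All.lookup (∣ksets∣ n k-1) T∈)
        ([⊆]⇒∣∣≤ T (A ∩ B) (subst (0 ℕ.<_) ([⊆]-∩ T A B) (ℕ.*-mono-< a b)))
      clash : ∀ {A P X} → A ∈ E → P ∈ E → X ∈ E → Partner (suc K) A P → A ≢ X → P ≢ X →
              k-1 ℕ.≤ ∣ A ∩ X ∣ → 2 ℕ.≤ 1
      clash {A} {P} {X} A∈ P∈ X∈ (A≢P , big) A≢X P≢X le = contradiction
        (ℕ.≤-<-trans (subst (ℕ._≤ ∣ A ∩ P ∣ ℕ.+ ∣ A ∩ X ∣) (e k-1) (ℕ.+-mono-≤ big le))
                     (few-common A∈ P∈ X∈ A≢P A≢X P≢X))
        (ℕ.<-irrefl refl)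
        where
        e : ∀ x → suc (suc x) ℕ.+ x ≡ 2 ℕ.* suc x
        e = ℕRing.solve-∀
      three : ∀ {A B X} → A ∈ E → B ∈ E → X ∈ E → A ≢ B → A ≢ X → B ≢ X →
        0 ℕ.< excess A ℕ.* [ T ⊆ A ] → 0 ℕ.< excess B ℕ.* [ T ⊆ B ] → 0 ℕ.< excess X ℕ.* [ T ⊆ X ] → 2 ℕ.≤ 1
      three {A} {B} {X} A∈ B∈ X∈ A≢B A≢X B≢X a b x
        with excess-partner A (factorˡ (excess A) a)
      -- The partner `P` of `A` can coincide with at most one of `B` and `X`. The other meets `A` in
      -- at least K - 1 vertices through `T`, which with the K + 1 shared with `P` makes 2K.
      ... | P , P∈ , partner with P ≟ˢ B
      ... | yes refl = clash A∈ P∈ X∈ partner A≢X B≢X (meet A X (factorʳ (excess A) a) (factorʳ (excess X) x))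
      ... | no  P≢B  = clash A∈ P∈ B∈ partner A≢B P≢B (meet A B (factorʳ (excess A) a) (factorʳ (excess B) b))

  -- Summing `row-bound` bounds the second moment by |E| c + |E| plus the exceptional term. The
  -- diagonal part |E| c then cancels against the factor 3 of `second-moment`.
  edge-bound : 2 ℕ.* (length E ℕ.* c) ℕ.≤ length E ℕ.+ 2 ℕ.* (n C K) ℕ.+ c ℕ.* (2 ℕ.* (n C k-1))
  edge-bound = ℕ.+-cancelˡ-≤ (length E ℕ.* c) _ _ (begin
    length E ℕ.* c ℕ.+ 2 ℕ.* (length E ℕ.* c)
      ≤⟨ second-moment E (uniform G) K ⟩
    ∑ E (λ A → ∑ E (λ B → ∣ A ∩ B ∣ C K)) ℕ.+ 2 ℕ.* (n C K)
      ≤⟨ ℕ.+-monoˡ-≤ _ (∑-mono E row-bound) ⟩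
    ∑ E (λ A → c ℕ.+ (1 ℕ.+ c ℕ.* excess A)) ℕ.+ 2 ℕ.* (n C K)
      ≡⟨ cong (ℕ._+ 2 ℕ.* (n C K)) (trans (∑-+ E (λ _ → c) _) (cong₂ ℕ._+_ (∑-const E c)
           (trans (∑-+ E (λ _ → 1) _) (cong₂ ℕ._+_ (trans (∑-const E 1) (ℕ.*-identityʳ (length E))) (∑-*ˡ E c excess))))) ⟩
    length E ℕ.* c ℕ.+ (length E ℕ.+ c ℕ.* ∑ E excess) ℕ.+ 2 ℕ.* (n C K)
      ≤⟨ ℕ.+-monoˡ-≤ (2 ℕ.* (n C K)) (ℕ.+-monoʳ-≤ (length E ℕ.* c) (ℕ.+-monoʳ-≤ (length E) (ℕ.*-monoʳ-≤ c ∑excess))) ⟩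
    length E ℕ.* c ℕ.+ (length E ℕ.+ c ℕ.* (2 ℕ.* (n C k-1))) ℕ.+ 2 ℕ.* (n C K)
      ≡⟨ e (length E) c (c ℕ.* (2 ℕ.* (n C k-1))) (2 ℕ.* (n C K)) ⟩
    length E ℕ.* c ℕ.+ (length E ℕ.+ 2 ℕ.* (n C K) ℕ.+ c ℕ.* (2 ℕ.* (n C k-1))) ∎)
    where
    open ℕ.≤-Reasoning
    e : ∀ l c x y → l ℕ.* c ℕ.+ (l ℕ.+ x) ℕ.+ y ≡ l ℕ.* c ℕ.+ (l ℕ.+ y ℕ.+ x)
    e = ℕRing.solve-∀

-- Here d = k! (2 C(r,k) - 1), so 2/d is the claimed bound and P/Q any ratio above it. Strictness
-- leaves a spare nᵏ, which absorbs the error Q W nᵏ⁻¹ once n > Q W.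
upper-count : ∀ {r k} → 2 ℕ.≤ k → k ℕ.< r → ∀ d → d ℕ.+ k ! ≡ 2 ℕ.* (k ! ℕ.* (r C k)) →
  ∀ P Q → 2 ℕ.* Q ℕ.< P ℕ.* d →
  ∃[ n₀ ] ∀ n → n₀ ℕ.≤ n → Q ℕ.* f r n (3 ℕ.* r ℕ.∸ 2 ℕ.* k) 3 ℕ.< P ℕ.* n ℕ.^ k
upper-count {r} {k@(suc k-1)} 2≤k k<r d d≡ P Q 2Q<Pd =
  suc (Q ℕ.* W) , λ n n₀≤n → bound n n₀≤n (f r n (3 ℕ.* r ℕ.∸ 2 ℕ.* k) 3) (edges≤ n (f-isMaximum r n (3 ℕ.* r ℕ.∸ 2 ℕ.* k) 3))
  where
  open ℕ.≤-Reasoning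
  c = r C k
  W = k ! ℕ.* (c ℕ.* 2)
  -- `m` is a variable instead of the value of `f`, so that matching on `refl` can replace it by the
  -- number of edges.
  edges≤ : ∀ n {m} → IsMaximum (IsSize r n (3 ℕ.* r ℕ.∸ 2 ℕ.* k) 3) m →
    m ℕ.* d ℕ.≤ 2 ℕ.* n ℕ.^ k ℕ.+ W ℕ.* n ℕ.^ k-1
  edges≤ n ((G , free , refl) , _) = ℕ.+-cancelʳ-≤ (m ℕ.* k !) _ _ (begin
    m ℕ.* d ℕ.+ m ℕ.* k !                         ≡⟨ ℕ.*-distribˡ-+ m d (k !) ⟨
    m ℕ.* (d ℕ.+ k !)                             ≡⟨ cong (m ℕ.*_) d≡ ⟩
    m ℕ.* (2 ℕ.* (k ! ℕ.* c))                     ≡⟨ e₁ m (k !) c ⟩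
    k ! ℕ.* (2 ℕ.* (m ℕ.* c))                     ≤⟨ ℕ.*-monoʳ-≤ (k !) (edge-bound k<r G free) ⟩
    k ! ℕ.* (m ℕ.+ 2 ℕ.* (n C k) ℕ.+ c ℕ.* (2 ℕ.* (n C k-1)))
      ≡⟨ e₂ (k !) m (n C k) c (n C k-1) ⟩
    2 ℕ.* ((n C k) ℕ.* k !) ℕ.+ W ℕ.* (n C k-1) ℕ.+ m ℕ.* k !
      ≤⟨ ℕ.+-monoˡ-≤ (m ℕ.* k !) (ℕ.+-mono-≤ (ℕ.*-monoʳ-≤ 2 (nCk*k!≤n^k n k)) (ℕ.*-monoʳ-≤ W
           (ℕ.≤-trans (ℕ.m≤m*n (n C k-1) (k-1 !) {{k-1 ℕ.!≢0}}) (nCk*k!≤n^k n k-1)))) ⟩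
    2 ℕ.* n ℕ.^ k ℕ.+ W ℕ.* n ℕ.^ k-1 ℕ.+ m ℕ.* k ! ∎)
    where
    m = length (edges G)
    e₁ : ∀ m x c → m ℕ.* (2 ℕ.* (x ℕ.* c)) ≡ x ℕ.* (2 ℕ.* (m ℕ.* c))
    e₁ = ℕRing.solve-∀
    e₂ : ∀ x m a c b → x ℕ.* (m ℕ.+ 2 ℕ.* a ℕ.+ c ℕ.* (2 ℕ.* b)) ≡ 2 ℕ.* (a ℕ.* x) ℕ.+ x ℕ.* (c ℕ.* 2) ℕ.* b ℕ.+ m ℕ.* x
    e₂ = ℕRing.solve-∀
  bound : ∀ n → suc (Q ℕ.* W) ℕ.≤ n → ∀ m → m ℕ.* d ℕ.≤ 2 ℕ.* n ℕ.^ k ℕ.+ W ℕ.* n ℕ.^ k-1 →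
    Q ℕ.* m ℕ.< P ℕ.* n ℕ.^ k
  bound n@(suc _) QW<n m le = ℕ.*-cancelʳ-< d _ _ (begin-strict
    Q ℕ.* m ℕ.* d                                          ≡⟨ ℕ.*-assoc Q m d ⟩
    Q ℕ.* (m ℕ.* d)                                        ≤⟨ ℕ.*-monoʳ-≤ Q le ⟩
    Q ℕ.* (2 ℕ.* n ℕ.^ k ℕ.+ W ℕ.* n ℕ.^ k-1)              ≡⟨ e₁ Q (n ℕ.^ k) W (n ℕ.^ k-1) ⟩
    2 ℕ.* Q ℕ.* n ℕ.^ k ℕ.+ Q ℕ.* W ℕ.* n ℕ.^ k-1
      <⟨ ℕ.+-monoʳ-< (2 ℕ.* Q ℕ.* n ℕ.^ k) (ℕ.*-monoˡ-< (n ℕ.^ k-1) {{ℕ.m^n≢0 n k-1}} QW<n) ⟩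
    2 ℕ.* Q ℕ.* n ℕ.^ k ℕ.+ n ℕ.^ k                        ≡⟨ ℕ.+-comm _ (n ℕ.^ k) ⟩
    suc (2 ℕ.* Q) ℕ.* n ℕ.^ k                              ≤⟨ ℕ.*-monoˡ-≤ (n ℕ.^ k) 2Q<Pd ⟩
    P ℕ.* d ℕ.* n ℕ.^ k                                    ≡⟨ e₂ P d (n ℕ.^ k) ⟩
    P ℕ.* n ℕ.^ k ℕ.* d                                    ∎)
    where
    e₁ : ∀ Q x W y → Q ℕ.* (2 ℕ.* x ℕ.+ W ℕ.* y) ≡ 2 ℕ.* Q ℕ.* x ℕ.+ Q ℕ.* W ℕ.* y
    e₁ = ℕRing.solve-∀
    e₂ : ∀ P d x → P ℕ.* d ℕ.* x ≡ P ℕ.* x ℕ.* d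
    e₂ = ℕRing.solve-∀

-- Limits

/-mono-< : ∀ a b c d .{{_ : ℕ.NonZero b}} .{{_ : ℕ.NonZero d}} → a * d < c * b → + a / b ℚ.< + c / d
/-mono-< a b@(suc _) c d@(suc _) lt = ℚ.toℚᵘ-cancel-<
  (ℚᵘ.<-respˡ-≃ (ℚᵘ.≃-sym (ℚ.toℚᵘ-fromℚᵘ (+ a ℚᵘ./ b)))
  (ℚᵘ.<-respʳ-≃ (ℚᵘ.≃-sym (ℚ.toℚᵘ-fromℚᵘ (+ c ℚᵘ./ d)))
  (ℚᵘ.*<* (subst₂ ℤ._<_ (ℤ.pos-* a d) (ℤ.pos-* c b) (ℤ.+<+ lt)))))

/-cancel-< : ∀ a b c d .{{_ : ℕ.NonZero b}} .{{_ : ℕ.NonZero d}} → + a / b ℚ.< + c / d → a * d < c * b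
/-cancel-< a b@(suc _) c d@(suc _) lt
  with ℚᵘ.*<* lt′ ← ℚᵘ.<-respˡ-≃ (ℚ.toℚᵘ-fromℚᵘ (+ a ℚᵘ./ b))
         (ℚᵘ.<-respʳ-≃ (ℚ.toℚᵘ-fromℚᵘ (+ c ℚᵘ./ d)) (ℚ.toℚᵘ-mono-< lt))
  = ℤ.drop‿+<+ (subst₂ ℤ._<_ (sym (ℤ.pos-* a d)) (sym (ℤ.pos-* c b)) lt′)

/-─ : ∀ a b c d e .{{_ : ℕ.NonZero b}} .{{_ : ℕ.NonZero d}} → e ℕ.+ c * b ≡ a * d →
  + a / b - + c / d ≡ (+ e / (b * d)) {{ℕ.m*n≢0 b d}}
/-─ a b@(suc _) c d@(suc _) e eq = ℚ.toℚᵘ-injective (begin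
  ℚ.toℚᵘ (+ a / b - + c / d)
    ≈⟨ ℚ.toℚᵘ-homo-+ (+ a / b) (ℚ.- (+ c / d)) ⟩
  ℚ.toℚᵘ (+ a / b) ℚᵘ.+ ℚ.toℚᵘ (ℚ.- (+ c / d))
    ≈⟨ ℚᵘ.+-cong (ℚ.toℚᵘ-fromℚᵘ (+ a ℚᵘ./ b))
         (ℚᵘ.≃-trans (ℚ.toℚᵘ-homo‿- (+ c / d)) (ℚᵘ.-‿cong (ℚ.toℚᵘ-fromℚᵘ (+ c ℚᵘ./ d)))) ⟩
  (+ a ℚᵘ./ b) ℚᵘ.+ (ℚᵘ.- (+ c ℚᵘ./ d))
    ≈⟨ ℚᵘ.*≡* (cong (ℤ._* + (b * d)) numerator) ⟩
  + e ℚᵘ./ (b * d)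
    ≈⟨ ℚ.toℚᵘ-fromℚᵘ (+ e ℚᵘ./ (b * d)) ⟨
  ℚ.toℚᵘ (+ e / (b * d)) ∎)
  where
  open ℚᵘ.≃-Reasoning
  cancel : ∀ x y z → z ≡ x ℤ.+ y → z ℤ.+ ℤ.- y ≡ x
  cancel x y z refl = trans (ℤ.+-assoc x y (ℤ.- y)) (trans (cong (λ t → x ℤ.+ t) (ℤ.+-inverseʳ y)) (ℤ.+-identityʳ x))
  numerator : + a ℤ.* + d ℤ.+ (ℤ.- (+ c)) ℤ.* + b ≡ + e
  numerator = trans (cong (λ t → + a ℤ.* + d ℤ.+ t) (sym (ℤ.neg-distribˡ-* (+ c) (+ b))))
    (cancel (+ e) (+ c ℤ.* + b) (+ a ℤ.* + d) (trans (sym (ℤ.pos-* a d)) (trans (cong +_ (sym eq))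
      (trans (ℤ.pos-+ e (c * b)) (cong (λ t → + e ℤ.+ t) (ℤ.pos-* c b))))))

1/-/ : ∀ a b .{{_ : ℕ.NonZero a}} .{{_ : ℕ.NonZero b}} p .{{_ : NonZero p}} → p ≡ + a / b → 1/ p ≡ + b / a
1/-/ a@(suc _) b@(suc _) p eq = begin
  1/ p                          ≡⟨ ℚ.*-identityʳ (1/ p) ⟨
  1/ p ℚ.* ℚ.1ℚ                 ≡⟨ cong (1/ p ℚ.*_) inverse ⟨
  1/ p ℚ.* (p ℚ.* (+ b / a))    ≡⟨ ℚ.*-assoc (1/ p) p (+ b / a) ⟨
  1/ p ℚ.* p ℚ.* (+ b / a)      ≡⟨ cong (ℚ._* (+ b / a)) (ℚ.*-inverseˡ p) ⟩
  ℚ.1ℚ ℚ.* (+ b / a)            ≡⟨ ℚ.*-identityˡ (+ b / a) ⟩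
  + b / a                       ∎
  where
  inverse : p ℚ.* (+ b / a) ≡ ℚ.1ℚ
  inverse = ℚ.toℚᵘ-injective (ℚᵘ.≃-trans (ℚ.toℚᵘ-homo-* p (+ b / a))
    (ℚᵘ.≃-trans (ℚᵘ.*-cong
        (ℚᵘ.≃-trans (ℚᵘ.≃-reflexive (cong ℚ.toℚᵘ eq)) (ℚ.toℚᵘ-fromℚᵘ (+ a ℚᵘ./ b)))
        (ℚ.toℚᵘ-fromℚᵘ (+ b ℚᵘ./ a)))
      (ℚᵘ.*≡* (trans (ℤ.*-identityʳ _) (trans (ℤ.*-comm (+ a) (+ b)) (sym (ℤ.*-identityˡ _)))))))
  open ≡-Reasoning

-- Against a rational cut, one half of the order yields the other even without locatedness. If q ≤ c
-- were in the upper cut, roundedness would give a smaller p there, and p < c lies in the lower cut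
-- as well.
≤-from-lower : ∀ {c x} → (∀ {q} → q ℚ.< c → lower x q) → fromℚ c ≤ x
≤-from-lower {c} {x} low = low , high
  where
  high : ∀ {q} → upper x q → c ℚ.< q
  high {q} u with c ℚ.<? q
  ... | yes c<q = c<q
  ... | no  c≮q with p , p<q , u′ ← upper-rounded x u =
    contradiction (disjoint x (low (ℚ.<-≤-trans p<q (ℚ.≮⇒≥ c≮q))) u′) (ℚ.<-irrefl refl)

≤-from-upper : ∀ {c x} → (∀ {q} → c ℚ.< q → upper x q) → x ≤ fromℚ c
≤-from-upper {c} {x} high = low , high
  where
  low : ∀ {q} → lower x q → q ℚ.< c
  low {q} l with q ℚ.<? c
  ... | yes q<c = q<c
  ... | no  q≮c with p , q<p , l′ ← lower-rounded x l =
    contradiction (disjoint x l′ (high (ℚ.≤-<-trans (ℚ.≮⇒≥ q≮c) q<p))) (ℚ.<-irrefl refl)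

-- The tails starting at N and at M share the index N + M, where a bound valid on one tail provides
-- the witness for the other.
liminf≤limsup : ∀ a → liminf a ≤ limsup a
liminf≤limsup a =
  (λ { (N , s , q<s , below) → s , q<s , λ M → N , subst (λ i → s ℚ.< a i) (ℕ.+-comm N M) (below M) }) ,
  (λ { (N , s , s<q , above) → s , s<q , λ M → N , subst (λ i → a i ℚ.< s) (ℕ.+-comm N M) (above M) })

module _ (g : ℕ → ℕ) (k : ℕ) where
  private
    a = g /n^ k

  liminf-≥ : ∀ A B .{{_ : ℕ.NonZero B}} →
    (∀ P Q → P * B < A * Q → ∃[ n₀ ] ∀ n → n₀ ℕ.≤ n → P * n ^ k < Q * g n) →
    fromℚ (+ A / B) ≤ liminf a
  liminf-≥ A B count = ≤-from-lower {x = liminf a} eventually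
    where
    eventually : ∀ {q} → q ℚ.< + A / B → lower (liminf a) q
    eventually q<c with ℚ.<-dense q<c
    -- A negative rational lies below every term of the sequence, so the counting hypothesis is
    -- called only for natural numerators.
    ... | s@(mkℚ -[1+ _ ] _ _) , q<s , s<c = 0 , s , q<s , λ m → ℚ.<-≤-trans
      (ℚ.negative⁻¹ s) (ℚ.nonNegative⁻¹ (a m) {{ℚ.normalize-nonNeg (g (suc m)) (suc m ^ k) {{ℕ.m^n≢0 (suc m) k}}}})
    ... | s@(mkℚ (+ P) Q-1 _) , q<s , s<c =
      let Q = suc Q-1
          s≡ = ℚ.↥p/↧p≡p s
          n₀ , large = count P Q (/-cancel-< P Q A B (subst (ℚ._< + A / B) (sym s≡) s<c))
      in n₀ , s , q<s , λ m → let n = suc (n₀ ℕ.+ m) in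
         subst (ℚ._< a (n₀ ℕ.+ m)) s≡ (/-mono-< P Q (g n) (n ^ k) {{_}} {{ℕ.m^n≢0 n k}}
           (subst (P * n ^ k <_) (ℕ.*-comm Q (g n)) (large n (ℕ.m≤n⇒m≤1+n (ℕ.m≤m+n n₀ m)))))

  limsup-≤ : ∀ A B .{{_ : ℕ.NonZero B}} →
    (∀ P Q → A * Q < P * B → ∃[ n₀ ] ∀ n → n₀ ℕ.≤ n → Q * g n < P * n ^ k) →
    limsup a ≤ fromℚ (+ A / B)
  limsup-≤ A B count = ≤-from-upper {x = limsup a} eventually
    where
    eventually : ∀ {q} → + A / B ℚ.< q → upper (limsup a) q
    eventually c<q with ℚ.<-dense c<q
    ... | s@(mkℚ -[1+ _ ] _ _) , c<s , s<q = contradiction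
      (ℚ.<-trans c<s (ℚ.<-≤-trans (ℚ.negative⁻¹ s) (ℚ.nonNegative⁻¹ (+ A / B) {{ℚ.normalize-nonNeg A B}})))
      (ℚ.<-irrefl refl)
    ... | s@(mkℚ (+ P) Q-1 _) , c<s , s<q =
      let Q = suc Q-1
          s≡ = ℚ.↥p/↧p≡p s
          n₀ , large = count P Q (/-cancel-< A B P Q (subst (+ A / B ℚ.<_) (sym s≡) c<s))
      in n₀ , s , s<q , λ m → let n = suc (n₀ ℕ.+ m) in
         subst (a (n₀ ℕ.+ m) ℚ.<_) s≡ (/-mono-< (g n) (n ^ k) P Q {{ℕ.m^n≢0 n k}}
           (subst (_< P * n ^ k) (ℕ.*-comm Q (g n)) (large n (ℕ.m≤n⇒m≤1+n (ℕ.m≤m+n n₀ m)))))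

theorem6 : (r k : ℕ) (2≤k : 2 ℕ.≤ k) (k<r : k < r) →
    let a = (λ n → f r n (3 * r ∸ 2 * k) 3) /n^ k in
    fromℚ ((1/ (fromℕ (r ^ k) - fromℕ r)) {{r^k-r≢0 2≤k k<r}}) ≤ liminf a
    × liminf a ≤ limsup a
    × limsup a ≤ fromℚ ((1/ (fromℕ (k ! * (r C k)) - + (k !) / 2)) {{k!C-k!/2≢0 k<r}})
theorem6 r k 2≤k k<r =
    subst (λ c → fromℚ c ≤ liminf (g /n^ k)) (sym (1/-/ S 1 _ {{r^k-r≢0 2≤k k<r}} (/-─ R 1 r 1 S S≡)))
      (liminf-≥ g k 1 S λ P Q lt → lower-count 2≤k k<r P Q (lower-hypothesis P Q lt))
  , liminf≤limsup (g /n^ k)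
  , subst (λ c → limsup (g /n^ k) ≤ fromℚ c) (sym (1/-/ d 2 _ {{k!C-k!/2≢0 k<r}} (/-─ M 1 (k !) 2 d d≡)))
      (limsup-≤ g k 2 d λ P Q lt → upper-count 2≤k k<r d d≡′ P Q lt)
  where
  g : ℕ → ℕ
  g n = f r n (3 * r ∸ 2 * k) 3
  R = r ^ k
  S = R ∸ r
  r<R : r < R
  r<R = subst (_< R) (ℕ.^-identityʳ r) (ℕ.^-monoʳ-< r (ℕ.<-trans 2≤k k<r) 2≤k)
  M = k ! * (r C k)
  -- The denominator M - k!/2 of the theorem is d/2, so the upper bound takes the form 2/d required
  -- by `limsup-≤`.
  d = 2 * M ∸ k !
  S≡ : S ℕ.+ r * 1 ≡ R * 1
  S≡ = trans (cong (S ℕ.+_) (ℕ.*-identityʳ r)) (trans (ℕ.m∸n+n≡m (ℕ.<⇒≤ r<R)) (sym (ℕ.*-identityʳ R)))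
  lower-hypothesis : ∀ P Q → P * S < 1 * Q → P * R < Q ℕ.+ P * r
  lower-hypothesis P Q lt = begin-strict
    P * R                 ≡⟨ cong (P *_) (ℕ.m∸n+n≡m (ℕ.<⇒≤ r<R)) ⟨
    P * (S ℕ.+ r)         ≡⟨ ℕ.*-distribˡ-+ P S r ⟩
    P * S ℕ.+ P * r       <⟨ ℕ.+-monoˡ-< (P * r) lt ⟩
    1 * Q ℕ.+ P * r       ≡⟨ cong (ℕ._+ P * r) (ℕ.*-identityˡ Q) ⟩
    Q ℕ.+ P * r           ∎
    where open ℕ.≤-Reasoning
  k!<2M : k ! < 2 * M
  k!<2M = begin-strict
    k !          ≤⟨ ℕ.m≤m*n (k !) (r C k) {{ℕ.>-nonZero rCk>0}} ⟩
    M            <⟨ ℕ.m<m*n M 2 {{ℕ.m*n≢0 (k !) (r C k) {{k ℕ.!≢0}} {{ℕ.>-nonZero rCk>0}}}} (s≤s (s≤s z≤n)) ⟩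
    M * 2        ≡⟨ ℕ.*-comm M 2 ⟩
    2 * M        ∎
    where
    open ℕ.≤-Reasoning
    rCk>0 : 0 < r C k
    rCk>0 = subst (ℕ._≤ r C k) (nCn≡1 k) (C-monoˡ k (ℕ.<⇒≤ k<r))
  d≡′ : d ℕ.+ k ! ≡ 2 * M
  d≡′ = ℕ.m∸n+n≡m (ℕ.<⇒≤ k!<2M)
  d≡ : d ℕ.+ k ! * 1 ≡ M * 2
  d≡ = trans (cong (d ℕ.+_) (ℕ.*-identityʳ (k !))) (trans d≡′ (ℕ.*-comm 2 M))
  instance
    S≢0 : ℕ.NonZero S
    S≢0 = ℕ.>-nonZero (ℕ.m<n⇒0<n∸m r<R)
    d≢0 : ℕ.NonZero d
    d≢0 = ℕ.>-nonZero (ℕ.m<n⇒0<n∸m k!<2M)
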